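{- Let $W$ be an irreducible $T$-module with endpoint $r$ and diameter $d=D-2r$. Then the following hold for $0\le i,j\le d$ and nonzero vectors $u\in E_rW$, $u^*\in E^*_rW$, $u^{\varepsilon}\in E^{\varepsilon}_rW$. (i) $$\langle E_{r+i}u^*,E^*_{r+j}u^{\varepsilon}\rangle=\mathbf{i}^j\,2^{ -d}\langle u^*,u^{\varepsilon}\rangle\binom{d}{i}\binom{d}{j}\;{}_2F_1\Big({ -i,-j\atop -d};2\Big).$$ (ii) $$\langle E^*_{r+i}u^{\varepsilon},E^{\varepsilon}_{r+j}u\rangle=\mathbf{i}^j\,2^{ -d}\langle u^{\varepsilon},u\rangle\binom{d}{i}\binom{d}{j}\;{}_2F_1\Big({ -i,-j\atop -d};2\Big).$$ (iii) $$\langle E^{\varepsilon}_{r+i}u,E_{r+j}u^*\rangle=\mathbf{i}^j\,2^{ -d}\langle u,u^*\rangle\binom{d}{i}\binom{d}{j}\;{}_2F_1\Big({ -i,-j\atop -d};2\Big).$$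
   Context: Let $D$ be a positive integer and let $Q_D$ be the $D$-cube: the graph with vertex set $X=\{0,1\}^D$, two vertices being adjacent iff they differ in exactly one coordinate; $\partial$ denotes path-length distance. $\mathrm{Mat}_X(\mathbb{C})$ is the algebra of complex matrices with rows and columns indexed by $X$, acting on $V=\mathbb{C}^X$ (column vectors) by left multiplication. $V$ carries the Hermitian inner product $\langle v,w\rangle=v^t\overline{w}$ (linear in the first argument). Write $\mathbf{i}^2=-1$ (the bold $\mathbf{i}$ is the imaginary unit; the plain $i$ is an index). Let $A$ be the adjacency matrix of $Q_D$. Fix $x=(0,0,\ldots,0)\in X$. Let $A^*$ be the diagonal matrix in $\mathrm{Mat}_X(\mathbb{C})$ with $(y,y)$-entry $D-2\partial(x,y)$ for $y\in X$, and let $A^{\varepsilon}=-\mathbf{i}(AA^*-A^*A)/2$. Let $T$ be the subalgebra of $\mathrm{Mat}_X(\mathbb{C})$ generated by $A$ and $A^*$. The eigenvalues of $A$ are $\theta_i=D-2i$ $(0\le i\le D)$. For $0\le i\le D$: $E_i=\prod_{0\le j\le D,\,j\ne i}\frac{A-\theta_jI}{\theta_i-\theta_j}$ is the primitive idempotent of $A$ for $\theta_i$ (the orthogonal projection onto the $\theta_i$-eigenspace of $A$); $E_i^*$ is the diagonal matrix with $(y,y)$-entry $1$ if $\partial(x,y)=i$ and $0$ otherwise; and $E_i^{\varepsilon}=P^{ -1}E_iP$, where $P=P_1^{\otimes D}$ (Kronecker power, $P_{yz}=\prod_{k=1}^D(P_1)_{y_kz_k}$, invertible) with $P_1=\begin{pmatrix}1&1\\-\mathbf{i}&\mathbf{i}\end{pmatrix}$,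 rows and columns indexed by $0,1$ in that order. ($E_i^*$ and $E_i^{\varepsilon}$ are the primitive idempotents of $A^*$ and $A^{\varepsilon}$ for the eigenvalue $D-2i$.) A $T$-module is a subspace $W\subseteq V$ with $BW\subseteq W$ for all $B\in T$; it is irreducible if $W\ne0$ and it contains no $T$-modules other than $0$ and $W$. The endpoint of an irreducible $T$-module $W$ is $r=\min\{i\mid 0\le i\le D,\ E_i^*W\neq0\}$ (it is known that also $r=\min\{i\mid E_iW\ne0\}$), and its diameter is $d=|\{i\mid 0\le i\le D,\ E_i^*W\ne0\}|-1$; it is known that $d=D-2r$ and $0\le r\le D/2$. For $a\in\mathbb{C}$ and an integer $n\ge0$, $(a)_n=a(a+1)\cdots(a+n-1)$ with $(a)_0=1$. For integers $0\le i,j\le d$, ${}_2F_1\big({ -i,-j\atop -d};2\big)=\sum_{n=0}^d\frac{(-i)_n(-j)_n}{(-d)_n\,n!}2^n$. -}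

module Defs where

open import Level using (0ℓ)
open import Algebra.Bundles using (RawRing)
import Algebra.Definitions.RawSemiring as RawSemiringOps
open import Data.Nat.Base as ℕ using (ℕ; zero; suc; _≤_; z≤n; s≤s)
import Data.Nat.Properties as ℕₚ
import Data.Integer.Base as ℤ
open import Data.Rational.Base as ℚ using (ℚ; 0ℚ; 1ℚ; ½; ∣_∣)
import Data.Rational.Properties as ℚₚ
open import Data.Rational.Solver using (module +-*-Solver)
open import Data.Fin.Base using (Fin; zero; suc; toℕ)
import Data.Fin.Properties as Finₚ
open import Data.Fin.Subset using (Subset; _∈_) renaming (∣_∣ to card)
open import Data.Vec.Base using (Vec; []; _∷_; zip; count; lookup; replicate)
open import Data.Vec.Properties using (≡-dec)
open import Data.List.Base as List using (upTo; filter)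
open import Data.Product using (Σ; ∃; _×_; _,_; proj₁; proj₂)
open import Function.Base using (_∘_)
open import Function.Bundles using (_⇔_)
open import Relation.Binary.PropositionalEquality
  using (_≡_; refl; sym; trans; cong; cong₂; subst; module ≡-Reasoning)
open import Relation.Nullary using (¬_; does; yes; no)
open import Relation.Nullary.Decidable using (¬?)
open import Relation.Unary using (Pred; _⊆_; _≐_)
open import Data.Bool.Base using (if_then_else_)

------------------------------------------------------------------------
-- The library has no real numbers.  Here they are Cauchy sequences of
-- rationals, and equality _≃_ says that the difference tends to 0.

IsCauchy : (ℕ → ℚ) → Set
IsCauchy x = ∀ ε → 0ℚ ℚ.< ε →
  ∃ λ N → ∀ m n → N ≤ m → N ≤ n → ∣ x m ℚ.- x n ∣ ℚ.< ε

record ℝ : Set where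
  constructor mkℝ
  field
    seq    : ℕ → ℚ
    cauchy : IsCauchy seq
open ℝ public

infix 4 _≃_
_≃_ : ℝ → ℝ → Set
x ≃ y = ∀ ε → 0ℚ ℚ.< ε →
  ∃ λ N → ∀ n → N ≤ n → ∣ seq x n ℚ.- seq y n ∣ ℚ.< ε

private
  open +-*-Solver using (solve; _:=_; _:+_; _:*_; _:-_; :-_)

  -- Abstract, so that the type checker never unfolds these proofs.
  abstract
    half-pos : ∀ ε → 0ℚ ℚ.< ε → 0ℚ ℚ.< ε ℚ.* ½
    half-pos ε 0<ε = ℚₚ.positive⁻¹ (ε ℚ.* ½) ⦃ ℚₚ.pos*pos⇒pos ε ⦃ ℚ.positive 0<ε ⦄ ½ ⦄

    half+half : ∀ ε → ε ℚ.* ½ ℚ.+ ε ℚ.* ½ ≡ ε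
    half+half ε = trans (sym (ℚₚ.*-distribˡ-+ ε ½ ½)) (ℚₚ.*-identityʳ ε)

    near-bound : ∀ p q → ∣ p ℚ.- q ∣ ℚ.< 1ℚ → ∣ p ∣ ℚ.≤ 1ℚ ℚ.+ ∣ q ∣
    near-bound p q h = begin
      ∣ p ∣                   ≡⟨ cong ∣_∣ (solve 2 (λ p q → p := (p :- q) :+ q) refl p q) ⟩
      ∣ (p ℚ.- q) ℚ.+ q ∣     ≤⟨ ℚₚ.∣p+q∣≤∣p∣+∣q∣ (p ℚ.- q) q ⟩
      ∣ p ℚ.- q ∣ ℚ.+ ∣ q ∣   ≤⟨ ℚₚ.+-monoˡ-≤ ∣ q ∣ (ℚₚ.<⇒≤ h) ⟩
      1ℚ ℚ.+ ∣ q ∣            ∎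
      where open ℚₚ.≤-Reasoning

    0<1 : 0ℚ ℚ.< 1ℚ
    0<1 = ℚₚ.positive⁻¹ 1ℚ

    bound-pos : ∀ q → ℚ.Positive (1ℚ ℚ.+ ∣ q ∣)
    bound-pos q = ℚₚ.pos+nonNeg⇒pos 1ℚ ∣ q ∣ ⦃ ℚₚ.∣-∣-nonNeg q ⦄

    eventually-bounded : ∀ {x} → IsCauchy x →
      ∃ λ B → ℚ.Positive B × ∃ λ N → ∀ n → N ≤ n → ∣ x n ∣ ℚ.≤ B
    eventually-bounded {x} cx with cx 1ℚ 0<1
    ... | N , h = 1ℚ ℚ.+ ∣ x N ∣ , bound-pos (x N) , N ,
                  λ n N≤n → near-bound (x n) (x N) (h n N N≤n ℕₚ.≤-refl)

    share : (ε B : ℚ) → ℚ.Positive B → ℚ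
    share ε B B>0 = (ε ℚ.* ½) ℚ.* (ℚ.1/ B) ⦃ ℚₚ.pos⇒nonZero B ⦃ B>0 ⦄ ⦄

    share-pos : ∀ ε B (B>0 : ℚ.Positive B) → 0ℚ ℚ.< ε → 0ℚ ℚ.< share ε B B>0
    share-pos ε B B>0 0<ε = ℚₚ.positive⁻¹ (share ε B B>0)
      ⦃ ℚₚ.pos*pos⇒pos (ε ℚ.* ½) ⦃ ℚ.positive (half-pos ε 0<ε) ⦄
          ((ℚ.1/ B) ⦃ ℚₚ.pos⇒nonZero B ⦃ B>0 ⦄ ⦄) ⦃ ℚₚ.1/pos⇒pos B ⦃ B>0 ⦄ ⦄ ⦄

    cancel : ∀ p q r → p ℚ.* r ≡ 1ℚ → p ℚ.* (q ℚ.* r) ≡ q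
    cancel p q r pr≡1 = begin
      p ℚ.* (q ℚ.* r)  ≡⟨ solve 3 (λ p q r → p :* (q :* r) := q :* (p :* r)) refl p q r ⟩
      q ℚ.* (p ℚ.* r)  ≡⟨ cong (q ℚ.*_) pr≡1 ⟩
      q ℚ.* 1ℚ         ≡⟨ ℚₚ.*-identityʳ q ⟩
      q                ∎
      where open ≡-Reasoning

    share-cancel : ∀ ε B (B>0 : ℚ.Positive B) → B ℚ.* share ε B B>0 ≡ ε ℚ.* ½
    share-cancel ε B B>0 = cancel B (ε ℚ.* ½) ((ℚ.1/ B) ⦃ B≢0 ⦄) (ℚₚ.*-inverseʳ B ⦃ B≢0 ⦄)
      where
      B≢0 : ℚ.NonZero B
      B≢0 = ℚₚ.pos⇒nonZero B ⦃ B>0 ⦄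

    +-cauchy : ∀ {x y} → IsCauchy x → IsCauchy y → IsCauchy (λ n → x n ℚ.+ y n)
    +-cauchy {x} {y} cx cy ε 0<ε
      with cx (ε ℚ.* ½) (half-pos ε 0<ε) | cy (ε ℚ.* ½) (half-pos ε 0<ε)
    ... | M , hx | N , hy = M ℕ.⊔ N , λ m n p q → begin-strict
      ∣ (x m ℚ.+ y m) ℚ.- (x n ℚ.+ y n) ∣
        ≡⟨ cong ∣_∣ (solve 4 (λ a b c d → (a :+ b) :- (c :+ d) := (a :- c) :+ (b :- d))
                       refl (x m) (y m) (x n) (y n)) ⟩
      ∣ (x m ℚ.- x n) ℚ.+ (y m ℚ.- y n) ∣
        ≤⟨ ℚₚ.∣p+q∣≤∣p∣+∣q∣ (x m ℚ.- x n) (y m ℚ.- y n) ⟩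
      ∣ x m ℚ.- x n ∣ ℚ.+ ∣ y m ℚ.- y n ∣
        <⟨ ℚₚ.+-mono-< (hx m n (ℕₚ.m⊔n≤o⇒m≤o M N p) (ℕₚ.m⊔n≤o⇒m≤o M N q))
                       (hy m n (ℕₚ.m⊔n≤o⇒n≤o M N p) (ℕₚ.m⊔n≤o⇒n≤o M N q)) ⟩
      ε ℚ.* ½ ℚ.+ ε ℚ.* ½  ≡⟨ half+half ε ⟩
      ε ∎
      where open ℚₚ.≤-Reasoning

    neg-cauchy : ∀ {x} → IsCauchy x → IsCauchy (λ n → ℚ.- x n)
    neg-cauchy {x} cx ε 0<ε with cx ε 0<ε
    ... | N , h = N , λ m n p q → subst (ℚ._< ε)
      (trans (sym (ℚₚ.∣-p∣≡∣p∣ (x m ℚ.- x n)))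
             (cong ∣_∣ (solve 2 (λ a b → :- (a :- b) := (:- a) :- (:- b)) refl (x m) (x n))))
      (h m n p q)

    const-cauchy : ∀ q → IsCauchy (λ _ → q)
    const-cauchy q ε 0<ε = 0 , λ _ _ _ _ →
      subst (ℚ._< ε) (sym (cong ∣_∣ (ℚₚ.+-inverseʳ q))) 0<ε

    product-diff : ∀ a b c d →
      a ℚ.* b ℚ.- c ℚ.* d ≡ a ℚ.* (b ℚ.- d) ℚ.+ d ℚ.* (a ℚ.- c)
    product-diff = solve 4 (λ a b c d → a :* b :- c :* d := a :* (b :- d) :+ d :* (a :- c)) refl

    product-bound : ∀ p q K e → ℚ.Positive K →
      ∣ p ∣ ℚ.≤ K → ∣ q ∣ ℚ.< e → ∣ p ℚ.* q ∣ ℚ.< K ℚ.* e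
    product-bound p q K e K>0 p≤K q<e = begin-strict
      ∣ p ℚ.* q ∣        ≡⟨ ℚₚ.∣p*q∣≡∣p∣*∣q∣ p q ⟩
      ∣ p ∣ ℚ.* ∣ q ∣    ≤⟨ ℚₚ.*-monoʳ-≤-nonNeg ∣ q ∣ ⦃ ℚₚ.∣-∣-nonNeg q ⦄ p≤K ⟩
      K ℚ.* ∣ q ∣        <⟨ ℚₚ.*-monoʳ-<-pos K ⦃ K>0 ⦄ q<e ⟩
      K ℚ.* e            ∎
      where open ℚₚ.≤-Reasoning

    product-close : ∀ a b c d B C ε (B>0 : ℚ.Positive B) (C>0 : ℚ.Positive C) →
      ∣ a ∣ ℚ.≤ B → ∣ d ∣ ℚ.≤ C →
      ∣ b ℚ.- d ∣ ℚ.< share ε B B>0 → ∣ a ℚ.- c ∣ ℚ.< share ε C C>0 →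
      ∣ a ℚ.* b ℚ.- c ℚ.* d ∣ ℚ.< ε
    product-close a b c d B C ε B>0 C>0 a≤B d≤C bd ac = begin-strict
      ∣ a ℚ.* b ℚ.- c ℚ.* d ∣
        ≡⟨ cong ∣_∣ (product-diff a b c d) ⟩
      ∣ a ℚ.* (b ℚ.- d) ℚ.+ d ℚ.* (a ℚ.- c) ∣
        ≤⟨ ℚₚ.∣p+q∣≤∣p∣+∣q∣ (a ℚ.* (b ℚ.- d)) (d ℚ.* (a ℚ.- c)) ⟩
      ∣ a ℚ.* (b ℚ.- d) ∣ ℚ.+ ∣ d ℚ.* (a ℚ.- c) ∣
        <⟨ ℚₚ.+-mono-< (product-bound a (b ℚ.- d) B (share ε B B>0) B>0 a≤B bd)
                       (product-bound d (a ℚ.- c) C (share ε C C>0) C>0 d≤C ac) ⟩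
      B ℚ.* share ε B B>0 ℚ.+ C ℚ.* share ε C C>0
        ≡⟨ cong₂ ℚ._+_ (share-cancel ε B B>0) (share-cancel ε C C>0) ⟩
      ε ℚ.* ½ ℚ.+ ε ℚ.* ½  ≡⟨ half+half ε ⟩
      ε ∎
      where open ℚₚ.≤-Reasoning

    *-cauchy : ∀ {x y} → IsCauchy x → IsCauchy y → IsCauchy (λ n → x n ℚ.* y n)
    *-cauchy {x} {y} cx cy ε 0<ε = combine (eventually-bounded {x} cx) (eventually-bounded {y} cy)
      where
      Bounded : (ℕ → ℚ) → Set
      Bounded z = ∃ λ B → ℚ.Positive B × ∃ λ N → ∀ n → N ≤ n → ∣ z n ∣ ℚ.≤ B

      Close : (ℕ → ℚ) → ℚ → Set
      Close z δ = ∃ λ N → ∀ m n → N ≤ m → N ≤ n → ∣ z m ℚ.- z n ∣ ℚ.< δ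

      finish : ∀ B C (B>0 : ℚ.Positive B) (C>0 : ℚ.Positive C) Mx My →
        (∀ n → Mx ≤ n → ∣ x n ∣ ℚ.≤ B) → (∀ n → My ≤ n → ∣ y n ∣ ℚ.≤ C) →
        Close x (share ε C C>0) → Close y (share ε B B>0) →
        Close (λ n → x n ℚ.* y n) ε
      finish B C B>0 C>0 Mx My bx by (Nx , hx) (Ny , hy) =
        (Mx ℕ.⊔ My) ℕ.⊔ (Nx ℕ.⊔ Ny) , λ m n p q →
        product-close (x m) (y m) (x n) (y n) B C ε B>0 C>0
          (bx m (ℕₚ.m⊔n≤o⇒m≤o Mx My (left p))) (by n (ℕₚ.m⊔n≤o⇒n≤o Mx My (left q)))
          (hy m n (ℕₚ.m⊔n≤o⇒n≤o Nx Ny (right p)) (ℕₚ.m⊔n≤o⇒n≤o Nx Ny (right q)))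
          (hx m n (ℕₚ.m⊔n≤o⇒m≤o Nx Ny (right p)) (ℕₚ.m⊔n≤o⇒m≤o Nx Ny (right q)))
        where
        left : ∀ {n} → (Mx ℕ.⊔ My) ℕ.⊔ (Nx ℕ.⊔ Ny) ≤ n → Mx ℕ.⊔ My ≤ n
        left = ℕₚ.m⊔n≤o⇒m≤o (Mx ℕ.⊔ My) (Nx ℕ.⊔ Ny)
        right : ∀ {n} → (Mx ℕ.⊔ My) ℕ.⊔ (Nx ℕ.⊔ Ny) ≤ n → Nx ℕ.⊔ Ny ≤ n
        right = ℕₚ.m⊔n≤o⇒n≤o (Mx ℕ.⊔ My) (Nx ℕ.⊔ Ny)

      combine : Bounded x → Bounded y → Close (λ n → x n ℚ.* y n) ε
      combine (B , B>0 , Mx , bx) (C , C>0 , My , by) = finish B C B>0 C>0 Mx My bx by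
        (cx (share ε C C>0) (share-pos ε C C>0 0<ε))
        (cy (share ε B B>0) (share-pos ε B B>0 0<ε))

infixl 6 _+ᵣ_
infixl 7 _*ᵣ_
infix  8 -ᵣ_

_+ᵣ_ _*ᵣ_ : ℝ → ℝ → ℝ
mkℝ x cx +ᵣ mkℝ y cy = mkℝ (λ n → x n ℚ.+ y n) (+-cauchy {x} {y} cx cy)
mkℝ x cx *ᵣ mkℝ y cy = mkℝ (λ n → x n ℚ.* y n) (*-cauchy {x} {y} cx cy)

-ᵣ_ : ℝ → ℝ
-ᵣ mkℝ x cx = mkℝ (λ n → ℚ.- x n) (neg-cauchy {x} cx)

fromℚ : ℚ → ℝ
fromℚ q = mkℝ (λ _ → q) (const-cauchy q)

------------------------------------------------------------------------

record ℂ : Set where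
  constructor _+i_
  field
    re im : ℝ
open ℂ public

infix  4 _≈_
infixl 6 _+_
infixl 7 _*_
infix  8 -_

_≈_ : ℂ → ℂ → Set
z ≈ w = re z ≃ re w × im z ≃ im w

_+_ _*_ : ℂ → ℂ → ℂ
(a +i b) + (c +i d) = (a +ᵣ c) +i (b +ᵣ d)
(a +i b) * (c +i d) = (a *ᵣ c +ᵣ (-ᵣ (b *ᵣ d))) +i (a *ᵣ d +ᵣ b *ᵣ c)

-_ conj : ℂ → ℂ
- (a +i b)    = (-ᵣ a) +i (-ᵣ b)
conj (a +i b) = a +i (-ᵣ b)

ι : ℚ → ℂ
ι q = fromℚ q +i fromℚ 0ℚ

ιℕ : ℕ → ℂ
ιℕ n = ι (ℤ.+ n ℚ./ 1)

0ℂ 1ℂ 𝐢 : ℂ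
0ℂ = ι 0ℚ
1ℂ = ι 1ℚ
𝐢  = fromℚ 0ℚ +i fromℚ 1ℚ

ℂ-rawRing : RawRing 0ℓ 0ℓ
ℂ-rawRing = record
  { Carrier = ℂ ; _≈_ = _≈_ ; _+_ = _+_ ; _*_ = _*_ ; -_ = -_ ; 0# = 0ℂ ; 1# = 1ℂ }

open RawSemiringOps (RawRing.rawSemiring ℂ-rawRing) public
  using (_^_; product)
open RawSemiringOps ℚ.+-*-rawSemiring public
  using () renaming (_^_ to _^ℚ_; sum to sumℚ)

------------------------------------------------------------------------

-- Total division, with p ÷₀ 0 = 0.  It is only used below with nonzero
-- denominators: (-d)ₙ n! with n ≤ d, and θᵢ - θⱼ with i ≠ j.
infixl 7 _÷₀_
_÷₀_ : ℚ → ℚ → ℚ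
p ÷₀ q with q ℚₚ.≟ 0ℚ
... | yes _  = 0ℚ
... | no q≢0 = (p ℚ.÷ q) ⦃ ℚ.≢-nonZero q≢0 ⦄

-- (a)ₙ = a (a + 1) ⋯ (a + n - 1); only integer a occur.
poch : ℚ → ℕ → ℚ
poch a zero    = 1ℚ
poch a (suc n) = poch a n ℚ.* (a ℚ.+ ℤ.+ n ℚ./ 1)

-- ₂F₁ i j d is the value ₂F₁(-i, -j; -d; 2), for i, j ≤ d
₂F₁ : ℕ → ℕ → ℕ → ℚ
₂F₁ i j d = sumℚ {suc d} (λ k → let n = toℕ k in
  (poch (neg i) n ℚ.* poch (neg j) n) ÷₀ (poch (neg d) n ℚ.* (ℤ.+ (n !) ℚ./ 1))
    ℚ.* ((ℤ.+ 2 ℚ./ 1) ^ℚ n))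
  where
  open import Data.Nat.Base using (_!)
  neg : ℕ → ℚ
  neg m = ℚ.- (ℤ.+ m ℚ./ 1)

------------------------------------------------------------------------

X : ℕ → Set
X D = Vec (Fin 2) D

hamming : ∀ {D} → X D → X D → ℕ
hamming y z = count (λ p → ¬? (proj₁ p Finₚ.≟ proj₂ p)) (zip y z)

Adjacent : ∀ {D} → X D → X D → Set
Adjacent y z = hamming y z ≡ 1

data Walk {D : ℕ} : X D → X D → ℕ → Set where
  stop : ∀ {y} → Walk y y 0
  step : ∀ {y z w n} → Adjacent y z → Walk z w n → Walk y w (suc n)

private
  hamming-refl : ∀ {D} (y : X D) → hamming y y ≡ 0
  hamming-refl []      = refl
  hamming-refl (a ∷ y) with a Finₚ.≟ a
  ... | yes _  = hamming-refl y
  ... | no a≢a with () ← a≢a refl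

  hamming-triangle : ∀ {D} (y z w : X D) → hamming y w ≤ hamming y z ℕ.+ hamming z w
  hamming-triangle []      []      []      = z≤n
  hamming-triangle (a ∷ y) (b ∷ z) (c ∷ w)
    with a Finₚ.≟ c | a Finₚ.≟ b | b Finₚ.≟ c | hamming-triangle y z w
  ... | yes _  | yes _  | yes _  | h = h
  ... | yes _  | yes _  | no _   | h = ℕₚ.≤-trans h (ℕₚ.+-monoʳ-≤ (hamming y z) (ℕₚ.n≤1+n _))
  ... | yes _  | no _   | yes _  | h = ℕₚ.m≤n⇒m≤1+n h
  ... | yes _  | no _   | no _   | h =
    ℕₚ.m≤n⇒m≤1+n (ℕₚ.≤-trans h (ℕₚ.+-monoʳ-≤ (hamming y z) (ℕₚ.n≤1+n _)))
  ... | no a≢c | yes p  | yes q  | h with () ← a≢c (trans p q)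
  ... | no _   | yes _  | no _   | h =
    subst (suc (hamming y w) ≤_) (sym (ℕₚ.+-suc (hamming y z) (hamming z w))) (s≤s h)
  ... | no _   | no _   | yes _  | h = s≤s h
  ... | no _   | no _   | no _   | h =
    s≤s (ℕₚ.≤-trans h (ℕₚ.+-monoʳ-≤ (hamming y z) (ℕₚ.n≤1+n _)))

  hamming≤walk : ∀ {D n} {y z : X D} → Walk y z n → hamming y z ≤ n
  hamming≤walk {y = y} stop = ℕₚ.≤-reflexive (hamming-refl y)
  hamming≤walk {y = y} {w} (step {z = z} a p) =
    ℕₚ.≤-trans (hamming-triangle y z w)
      (ℕₚ.+-mono-≤ (ℕₚ.≤-reflexive a) (hamming≤walk p))

  walk-∷ : ∀ {D n} {y z : X D} a → Walk y z n → Walk (a ∷ y) (a ∷ z) n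
  walk-∷ a stop = stop
  walk-∷ {y = y} a (step {z = z} h p) = step (adj-∷ h) (walk-∷ a p)
    where
    adj-∷ : hamming y z ≡ 1 → hamming (a ∷ y) (a ∷ z) ≡ 1
    adj-∷ h with a Finₚ.≟ a
    ... | yes _  = h
    ... | no a≢a with () ← a≢a refl

  hamming-walk : ∀ {D} (y z : X D) → Walk y z (hamming y z)
  hamming-walk []      []      = stop
  hamming-walk (a ∷ y) (b ∷ z) with a Finₚ.≟ b
  ... | yes refl = walk-∷ a (hamming-walk y z)
  ... | no a≢b   = step flip (walk-∷ b (hamming-walk y z))
    where
    flip : hamming (a ∷ y) (b ∷ y) ≡ 1
    flip with a Finₚ.≟ b
    ... | yes a≡b with () ← a≢b a≡b
    ... | no _    = cong suc (hamming-refl y)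

-- The path-length distance ∂ is the minimal length of a walk; the minimum is
-- computed by counting the coordinates that differ.
shortestWalk : ∀ {D} (y z : X D) →
  ∃ λ n → Walk y z n × (∀ m → Walk y z m → n ≤ m)
shortestWalk y z = hamming y z , hamming-walk y z , λ _ → hamming≤walk

∂ : ∀ {D} → X D → X D → ℕ
∂ y z = proj₁ (shortestWalk y z)

origin : ∀ D → X D
origin D = replicate D zero

------------------------------------------------------------------------

∑ : ∀ {D} → (X D → ℂ) → ℂ
∑ {zero}  f = f []
∑ {suc D} f = ∑ (λ y → f (zero ∷ y)) + ∑ (λ y → f (suc zero ∷ y))

V : ℕ → Set
V D = X D → ℂ

Mat : ℕ → Set
Mat D = X D → X D → ℂ

module _ {D : ℕ} where

  infix  4 _≈ᵥ_ _≈ₘ_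
  infixl 6 _+ᵥ_ _+ₘ_
  infixr 7 _•ᵥ_ _•ₘ_
  infixl 7 _*ₘ_
  infixr 8 _·_

  _≈ᵥ_ : V D → V D → Set
  v ≈ᵥ w = ∀ y → v y ≈ w y

  0ᵥ : V D
  0ᵥ _ = 0ℂ

  _+ᵥ_ : V D → V D → V D
  (v +ᵥ w) y = v y + w y

  _•ᵥ_ : ℂ → V D → V D
  (c •ᵥ v) y = c * v y

  ⟨_,_⟩ : V D → V D → ℂ
  ⟨ v , w ⟩ = ∑ λ y → v y * conj (w y)

  _≈ₘ_ : Mat D → Mat D → Set
  M ≈ₘ N = ∀ y z → M y z ≈ N y z

  diag : (X D → ℂ) → Mat D
  diag f y z = if does (≡-dec Finₚ._≟_ y z) then f y else 0ℂ

  Iₘ : Mat D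
  Iₘ = diag (λ _ → 1ℂ)

  _+ₘ_ _*ₘ_ : Mat D → Mat D → Mat D
  (M +ₘ N) y z = M y z + N y z
  (M *ₘ N) y z = ∑ λ w → M y w * N w z

  _•ₘ_ : ℂ → Mat D → Mat D
  (c •ₘ M) y z = c * M y z

  _·_ : Mat D → V D → V D
  (M · v) y = ∑ λ z → M y z * v z

  IsInverse : Mat D → Mat D → Set
  IsInverse M N = M *ₘ N ≈ₘ Iₘ × N *ₘ M ≈ₘ Iₘ

------------------------------------------------------------------------

θ : ℕ → ℕ → ℚ
θ D i = (ℤ.+ D ℤ.- ℤ.+ (2 ℕ.* i)) ℚ./ 1

A : ∀ {D} → Mat D
A y z = if does (hamming y z ℕₚ.≟ 1) then 1ℂ else 0ℂ

A* : ∀ {D} → Mat D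
A* {D} = diag λ y → ι (θ D (∂ (origin D) y))

-- The product over 0 ≤ j ≤ D, j ≠ i of (A - θⱼ I) / (θᵢ - θⱼ).
E : ∀ {D} → ℕ → Mat D
E {D} i = List.foldr _*ₘ_ Iₘ (List.map factor (filter (λ j → ¬? (j ℕₚ.≟ i)) (upTo (suc D))))
  where
  factor : ℕ → Mat D
  factor j = ι (1ℚ ÷₀ (θ D i ℚ.- θ D j)) •ₘ (A +ₘ (- ι (θ D j)) •ₘ Iₘ)

E* : ∀ {D} → ℕ → Mat D
E* {D} i = diag λ y → if does (∂ (origin D) y ℕₚ.≟ i) then 1ℂ else 0ℂ

P₁ : Fin 2 → Fin 2 → ℂ
P₁ zero    zero    = 1ℂ
P₁ zero    (suc _) = 1ℂ
P₁ (suc _) zero    = - 𝐢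
P₁ (suc _) (suc _) = 𝐢

P : ∀ {D} → Mat D
P y z = product λ k → P₁ (lookup y k) (lookup z k)

-- To be used with a P⁻¹ such that IsInverse P P⁻¹.
Eε : ∀ {D} → Mat D → ℕ → Mat D
Eε P⁻¹ i = P⁻¹ *ₘ (E i *ₘ P)

------------------------------------------------------------------------

data GeneratedBy {D : ℕ} (G H : Mat D) : Pred (Mat D) 0ℓ where
  gen₁  : GeneratedBy G H G
  gen₂  : GeneratedBy G H H
  unit  : GeneratedBy G H Iₘ
  add   : ∀ {M N} → GeneratedBy G H M → GeneratedBy G H N → GeneratedBy G H (M +ₘ N)
  mul   : ∀ {M N} → GeneratedBy G H M → GeneratedBy G H N → GeneratedBy G H (M *ₘ N)
  scale : ∀ c {M} → GeneratedBy G H M → GeneratedBy G H (c •ₘ M)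
  resp  : ∀ {M N} → M ≈ₘ N → GeneratedBy G H M → GeneratedBy G H N

T : ∀ {D} → Pred (Mat D) 0ℓ
T = GeneratedBy A A*

module _ {D : ℕ} where

  record IsSubspace (W : Pred (V D) 0ℓ) : Set where
    field
      ≈-closed : ∀ {v w} → v ≈ᵥ w → W v → W w
      0-closed : W 0ᵥ
      +-closed : ∀ {v w} → W v → W w → W (v +ᵥ w)
      •-closed : ∀ c {v} → W v → W (c •ᵥ v)

  record IsModule (W : Pred (V D) 0ℓ) : Set where
    field
      isSubspace : IsSubspace W
      T-closed   : ∀ {B w} → T B → W w → W (B · w)

  IsZero : Pred (V D) 0ℓ → Set
  IsZero U = ∀ v → U v → v ≈ᵥ 0ᵥ

  infix 8 _⟪_⟫
  _⟪_⟫ : Mat D → Pred (V D) 0ℓ → Pred (V D) 0ℓ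
  (B ⟪ W ⟫) v = ∃ λ w → W w × v ≈ᵥ B · w

  -- For simple: "no T-modules other than 0 and W" is stated negatively: asking for a
  -- decision U = 0 or U = W would be a constructively stronger hypothesis.
  record IsIrreducible (W : Pred (V D) 0ℓ) : Set₁ where
    field
      isModule : IsModule W
      nonzero  : ¬ IsZero W
      simple   : ∀ U → IsModule U → U ⊆ W → ¬ (¬ IsZero U × ¬ (U ≐ W))

  record IsEndpoint (W : Pred (V D) 0ℓ) (r : ℕ) : Set where
    field
      r≤D      : r ≤ D
      attained : ¬ IsZero (E* r ⟪ W ⟫)
      minimal  : ∀ i → i ≤ D → ¬ IsZero (E* i ⟪ W ⟫) → r ≤ i

  IsDiameter : Pred (V D) 0ℓ → ℕ → Set
  IsDiameter W d = Σ (Subset (suc D)) λ S →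
    (∀ i → i ∈ S ⇔ (¬ IsZero (E* (toℕ i) ⟪ W ⟫))) × card S ≡ suc d

-- The matrices A, A*, Aε act on (ℂ²)^{⊗D} as sums of the Pauli matrices σx, σz, σy
-- over the D tensor factors, so they are self-adjoint and satisfy the cyclic
-- relations [A,A*] = 2i Aε, [A*,Aε] = 2i A, [Aε,A] = 2i A*.  Put R = (A + i Aε)/2
-- and L = (A - i Aε)/2.  A nonzero u* ∈ E*ᵣW satisfies L u* = 0 because r is
-- minimal, so the vectors vₖ = Rᵏu*/k! (0 ≤ k ≤ d) span a nonzero submodule, which
-- is W.  Comparing coefficients, a vector of W on which Aε has eigenvalue d is a
-- multiple of exp(-iR) u* = Σ (-i)ᵏ vₖ; it is again a highest weight vector for the
-- rotated triple (A*, Aε, A), whence (ii) and (iii) follow from (i) by rotation.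
-- For (i), E_{r+i} u* = 2⁻ᵈ C(d,i) Σⱼ ₂F₁(-i,-j;-d;2) vⱼ: the sums on the right are
-- eigenvectors of A by the three-term recurrence of ₂F₁, and they add up to u* by
-- orthogonality.  Finally ⟨Σ cₖ vₖ , vⱼ⟩ = C(d,j) cⱼ ⟨u*,u*⟩, as R and L are adjoint.
--
-- Constructively, W is only doubly-negated equal to that span; this suffices because
-- equality of complex numbers is stable under double negation.
module Submission where

open import Level using (0ℓ)
open import Algebra.Bundles using (CommutativeRing; RawRing)
import Algebra.Solver.Ring as RingSolver
open import Algebra.Solver.Ring.AlmostCommutativeRing
  using (_-Raw-AlmostCommutative⟶_; fromCommutativeRing)
open import Data.Bool.Base using (if_then_else_)
open import Data.Fin.Base using (Fin; zero; suc; toℕ)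
open import Data.Fin.Patterns using (0F; 1F)
import Data.Fin.Properties as Finₚ
import Data.Integer.Base as ℤ
import Data.Integer.Properties as ℤₚ
open import Data.List.Base as List using (List; []; _∷_; upTo; filter)
open import Data.Maybe.Base as Maybe using (Maybe)
open import Data.Nat.Base as ℕ using (ℕ; NonZero; zero; suc; _≤_; z≤n; s≤s)
open import Data.Nat.Combinatorics using (_C_)
import Data.Nat.Properties as ℕₚ
open import Data.Product using (∃; _×_; _,_; proj₁; proj₂)
open import Data.Product.Properties using () renaming (≡-dec to ×-≡-dec)
open import Data.Rational.Base as ℚ using (ℚ; 0ℚ; 1ℚ; ½)
import Data.Rational.Properties as ℚₚ
open import Data.Rational.Solver using (module +-*-Solver)
open import Data.Vec.Base using ([]; _∷_)
open import Data.Vec.Properties using (≡-dec)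
open import Function.Base using (_∘_)
open import Relation.Binary.PropositionalEquality as ≡ using (_≡_; _≢_)
open import Relation.Nullary using (¬_; Dec; yes; no; does; contradiction)
open import Relation.Nullary.Decidable using (dec⇒maybe; from-yes; ¬?)
open import Relation.Unary using (Pred)
open import Defs using (X; hamming; θ; ∂; origin; _÷₀_; poch; ₂F₁; _^ℚ_)

-- The diameter is given as a count, so `d = D - 2r` has to be proved. As `L vₖ₊₁ = (D - 2r - k) vₖ`
-- and there is no vertex at distance beyond `D`, the string of a nonzero `u*` can only exist if
-- `2r ≤ D`, and it stops at `v_{D-2r}`. Hence `E*ᵢW` is nonzero exactly for `r ≤ i ≤ D - r`.
--
-- The matrices `E* i` visibly project onto eigenspaces; the Lagrange products `E i` do not. The
-- relations `P A = A* P` and `P Aε = A P` transport the spectral resolution of `A*` to `A` and then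
-- to `Aε`, and a family of projections is determined by its action on eigenvectors, which
-- identifies the transported family with the products.
--
-- Minimality of `r` speaks of `E*` only, so `uε` and `u` are not known beforehand to be highest
-- weight vectors. Each formula is therefore proved together with that property of the next vector
-- in the cycle `u*`, `uε`, `u`.
--
-- The algebra runs over an abstract commutative ring with conjugation that receives `ℚ(𝐢)`. Without
-- inverses or a zero test for scalars, only nonzero rationals are cancelled.

-- Finite sums over initial segments of the naturals

module RangeSum (R : CommutativeRing 0ℓ 0ℓ) where
  open CommutativeRing R
  open import Algebra.Properties.CommutativeMonoid.Sum +-commutativeMonoid
    using (sum; sum-cong-≋; ∑-distrib-+; ∑-comm; sum-replicate-zero)
  open import Algebra.Properties.Semiring.Sum semiring using (*-distribˡ-sum)
  open import Relation.Binary.Reasoning.Setoid setoid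

  ∑< : ℕ → (ℕ → Carrier) → Carrier
  ∑< n f = sum {n} (f ∘ toℕ)

  ∑<-cong : ∀ n {f g : ℕ → Carrier} → (∀ k → k ℕ.< n → f k ≈ g k) → ∑< n f ≈ ∑< n g
  ∑<-cong n h = sum-cong-≋ {n} (λ k → h (toℕ k) (Finₚ.toℕ<n k))

  ∑<-+ : ∀ n (f g : ℕ → Carrier) → ∑< n (λ k → f k + g k) ≈ ∑< n f + ∑< n g
  ∑<-+ n f g = ∑-distrib-+ {n} (f ∘ toℕ) (g ∘ toℕ)

  ∑<-*ˡ : ∀ n c (f : ℕ → Carrier) → ∑< n (λ k → c * f k) ≈ c * ∑< n f
  ∑<-*ˡ n c f = sym (*-distribˡ-sum {n} c (f ∘ toℕ))

  ∑<-zero : ∀ n {f : ℕ → Carrier} → (∀ k → k ℕ.< n → f k ≈ 0#) → ∑< n f ≈ 0#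
  ∑<-zero n h = trans (∑<-cong n h) (sum-replicate-zero n)

  ∑<-comm : ∀ m n (f : ℕ → ℕ → Carrier) →
    ∑< m (λ i → ∑< n (f i)) ≈ ∑< n (λ j → ∑< m (λ i → f i j))
  ∑<-comm m n f = ∑-comm {m} {n} (λ i j → f (toℕ i) (toℕ j))

  ∑<-last : ∀ n (f : ℕ → Carrier) → ∑< (suc n) f ≈ ∑< n f + f n
  ∑<-last zero    f = +-comm (f 0) 0#
  ∑<-last (suc n) f = begin
    f 0 + ∑< (suc n) (f ∘ suc)         ≈⟨ +-congˡ (∑<-last n (f ∘ suc)) ⟩
    f 0 + (∑< n (f ∘ suc) + f (suc n)) ≈⟨ +-assoc _ _ _ ⟨
    f 0 + ∑< n (f ∘ suc) + f (suc n)   ∎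

  -- Shifting the index costs only the two boundary terms. Telescoping sums and the index changes
  -- caused by raising and lowering operators go through this.
  ∑<-shift : ∀ n (f : ℕ → Carrier) → f 0 ≈ 0# → f n ≈ 0# → ∑< n (f ∘ suc) ≈ ∑< n f
  ∑<-shift n f f0 fn = begin
    ∑< n (f ∘ suc)         ≈⟨ +-identityˡ _ ⟨
    0# + ∑< n (f ∘ suc)    ≈⟨ +-congʳ f0 ⟨
    ∑< (suc n) f           ≈⟨ ∑<-last n f ⟩
    ∑< n f + f n           ≈⟨ +-congˡ fn ⟩
    ∑< n f + 0#            ≈⟨ +-identityʳ _ ⟩
    ∑< n f                 ∎

  ∑<-single : ∀ n m {f : ℕ → Carrier} → m ℕ.< n → (∀ k → k ℕ.< n → k ≡.≢ m → f k ≈ 0#) → ∑< n f ≈ f m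
  ∑<-single (suc n) zero {f} _ h = begin
    f 0 + ∑< n (f ∘ suc)   ≈⟨ +-congˡ (∑<-zero n (λ k k<n → h (suc k) (s≤s k<n) λ ())) ⟩
    f 0 + 0#               ≈⟨ +-identityʳ _ ⟩
    f 0                    ∎
  ∑<-single (suc n) (suc m) {f} (s≤s m<n) h = begin
    f 0 + ∑< n (f ∘ suc)
      ≈⟨ +-cong (h 0 (s≤s z≤n) λ ())
           (∑<-single n m m<n (λ k k<n k≢m → h (suc k) (s≤s k<n) (k≢m ∘ ℕₚ.suc-injective))) ⟩
    0# + f (suc m)         ≈⟨ +-identityˡ _ ⟩
    f (suc m)              ∎

natℚ : ℕ → ℚ
natℚ n = ℤ.+ n ℚ./ 1

-- Terminating ₂F₁ sums and binomial coefficients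

2ℚ : ℚ
2ℚ = ℤ.+ 2 ℚ./ 1

module KrawtchoukSums where
  open import Data.Nat.Base using (_!)
  open import Data.Nat.Combinatorics using (nCk+nC[k+1]≡[n+1]C[k+1]; k>n⇒nCk≡0; nCk≡nC[n∸k]; nCn≡1)
  open import Data.Nat.Coprimality as Coprime using ()
  open import Data.Rational.Base using (_+_; _*_; _-_; -_)
  open ≡ using (refl; sym; trans; cong; cong₂; subst; module ≡-Reasoning)
  open +-*-Solver using (solve; _:=_; _:+_; _:*_; _:-_; :-_; con)
  open RangeSum ℚₚ.+-*-commutativeRing public using () renaming (∑< to ∑<ℚ)
  open RangeSum ℚₚ.+-*-commutativeRing

  abstract
    -- `_/_` divides by a gcd that does not reduce for a variable `z`; on the explicit fraction with
    -- denominator 1 the ring operations compute.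
    intℚ≡mkℚ : ∀ z → z ℚ./ 1 ≡ ℚ.mkℚ z 0 (Coprime.sym (Coprime.1-coprimeTo ℤ.∣ z ∣))
    intℚ≡mkℚ z = ℚₚ.↥p/↧p≡p (ℚ.mkℚ z 0 (Coprime.sym (Coprime.1-coprimeTo ℤ.∣ z ∣)))

    intℚ-+ : ∀ z w → (z ℤ.+ w) ℚ./ 1 ≡ z ℚ./ 1 + w ℚ./ 1
    intℚ-+ z w = trans
      (cong (ℚ._/ 1) (cong₂ ℤ._+_ (sym (ℤₚ.*-identityʳ z)) (sym (ℤₚ.*-identityʳ w))))
      (sym (cong₂ _+_ (intℚ≡mkℚ z) (intℚ≡mkℚ w)))

    intℚ-* : ∀ z w → (z ℤ.* w) ℚ./ 1 ≡ z ℚ./ 1 * (w ℚ./ 1)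
    intℚ-* z w = sym (cong₂ _*_ (intℚ≡mkℚ z) (intℚ≡mkℚ w))

    intℚ-neg : ∀ z → (ℤ.- z) ℚ./ 1 ≡ - (z ℚ./ 1)
    intℚ-neg z = trans (intℚ≡mkℚ (ℤ.- z)) (trans (cases z) (cong -_ (sym (intℚ≡mkℚ z))))
      where
      cases : ∀ z → ℚ.mkℚ (ℤ.- z) 0 (Coprime.sym (Coprime.1-coprimeTo ℤ.∣ ℤ.- z ∣))
                    ≡ - ℚ.mkℚ z 0 (Coprime.sym (Coprime.1-coprimeTo ℤ.∣ z ∣))
      cases (ℤ.+ zero)   = refl
      cases (ℤ.+ suc n)  = refl
      cases (ℤ.-[1+ n ]) = refl

    intℚ-injective : ∀ z w → z ℚ./ 1 ≡ w ℚ./ 1 → z ≡ w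
    intℚ-injective z w h = cong ℚ.ℚ.numerator (trans (sym (intℚ≡mkℚ z)) (trans h (intℚ≡mkℚ w)))

    natℚ-+ : ∀ m n → natℚ (m ℕ.+ n) ≡ natℚ m + natℚ n
    natℚ-+ m n = intℚ-+ (ℤ.+ m) (ℤ.+ n)

    natℚ-suc : ∀ n → natℚ (suc n) ≡ 1ℚ + natℚ n
    natℚ-suc n = natℚ-+ 1 n

    natℚ-* : ∀ m n → natℚ (m ℕ.* n) ≡ natℚ m * natℚ n
    natℚ-* m n = trans (cong (ℚ._/ 1) (ℤₚ.pos-* m n)) (intℚ-* (ℤ.+ m) (ℤ.+ n))

    natℚ-injective : ∀ m n → natℚ m ≡ natℚ n → m ≡ n
    natℚ-injective m n h = ℤₚ.+-injective (intℚ-injective (ℤ.+ m) (ℤ.+ n) h)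

    natℚ-suc≢0 : ∀ n → natℚ (suc n) ≢ 0ℚ
    natℚ-suc≢0 n h with () ← natℚ-injective (suc n) 0 h

    *-cancelˡ-≢0 : ∀ p {q r} → p ≢ 0ℚ → p * q ≡ p * r → q ≡ r
    *-cancelˡ-≢0 p {q} {r} p≢0 h = begin
      q                  ≡⟨ sym (ℚₚ.*-identityˡ q) ⟩
      1ℚ * q             ≡⟨ cong (_* q) (sym p⁻¹p) ⟩
      p⁻¹ * p * q        ≡⟨ ℚₚ.*-assoc p⁻¹ p q ⟩
      p⁻¹ * (p * q)      ≡⟨ cong (p⁻¹ *_) h ⟩
      p⁻¹ * (p * r)      ≡⟨ ℚₚ.*-assoc p⁻¹ p r ⟨
      p⁻¹ * p * r        ≡⟨ cong (_* r) p⁻¹p ⟩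
      1ℚ * r             ≡⟨ ℚₚ.*-identityˡ r ⟩
      r                  ∎
      where
      open ≡-Reasoning
      p⁻¹ : ℚ
      p⁻¹ = (ℚ.1/ p) ⦃ ℚ.≢-nonZero p≢0 ⦄
      p⁻¹p : p⁻¹ * p ≡ 1ℚ
      p⁻¹p = ℚₚ.*-inverseˡ p ⦃ ℚ.≢-nonZero p≢0 ⦄

    *-≢0 : ∀ {p q} → p ≢ 0ℚ → q ≢ 0ℚ → p * q ≢ 0ℚ
    *-≢0 {p} {q} p≢0 q≢0 pq≡0 = q≢0 (*-cancelˡ-≢0 p p≢0 (trans pq≡0 (sym (ℚₚ.*-zeroʳ p))))

    natℚ-sub≢0 : ∀ {m n} → m ≢ n → natℚ m - natℚ n ≢ 0ℚ
    natℚ-sub≢0 {m} {n} m≢n h = m≢n (natℚ-injective m n (begin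
      natℚ m                        ≡⟨ solve 2 (λ m n → m := (m :- n) :+ n) refl (natℚ m) (natℚ n) ⟩
      natℚ m - natℚ n + natℚ n      ≡⟨ cong (_+ natℚ n) h ⟩
      0ℚ + natℚ n                   ≡⟨ ℚₚ.+-identityˡ (natℚ n) ⟩
      natℚ n                        ∎))
      where open ≡-Reasoning

    -- For `q = 0ℚ` both sides take the default value 0, so a numerator can be split off without a
    -- side condition.
    ÷₀-* : ∀ p q → p ÷₀ q ≡ p * (1ℚ ÷₀ q)
    ÷₀-* p q with q ℚₚ.≟ 0ℚ
    ... | yes _  = sym (ℚₚ.*-zeroʳ p)
    ... | no q≢0 = cong (p *_) (sym (ℚₚ.*-identityˡ _))

    ÷₀-inverse : ∀ q → q ≢ 0ℚ → (1ℚ ÷₀ q) * q ≡ 1ℚ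
    ÷₀-inverse q q≢0 with q ℚₚ.≟ 0ℚ
    ... | yes q≡0 = contradiction q≡0 q≢0
    ... | no q≢0′ = trans (cong (_* q) (ℚₚ.*-identityˡ ((ℚ.1/ q) ⦃ ℚ.≢-nonZero q≢0′ ⦄))) (ℚₚ.*-inverseˡ q ⦃ ℚ.≢-nonZero q≢0′ ⦄)

    poch-vanishes : ∀ i n → i ℕ.< n → poch (- natℚ i) n ≡ 0ℚ
    poch-vanishes i (suc n) i<1+n with i ℕₚ.≟ n
    ... | yes refl = trans (cong (poch (- natℚ i) i *_) (ℚₚ.+-inverseˡ (natℚ i))) (ℚₚ.*-zeroʳ (poch (- natℚ i) i))
    ... | no i≢n = trans (cong (_* (- natℚ i + natℚ n)) (poch-vanishes i n (ℕₚ.≤∧≢⇒< (ℕₚ.≤-pred i<1+n) i≢n)))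
      (ℚₚ.*-zeroˡ (- natℚ i + natℚ n))

    -- The factors are `k - d` with `k < n`; the vanishing one, `k = d`, first appears at
    -- `n = suc d`.
    poch-≢0 : ∀ d n → n ℕ.≤ d → poch (- natℚ d) n ≢ 0ℚ
    poch-≢0 d zero    _   = λ ()
    poch-≢0 d (suc n) n<d = *-≢0 (poch-≢0 d n (ℕₚ.<⇒≤ n<d))
      (subst (_≢ 0ℚ) (ℚₚ.+-comm (natℚ n) (- natℚ d)) (natℚ-sub≢0 (ℕₚ.<⇒≢ n<d)))

    -- Both sides are `poch x (suc n)`, with its first or its last factor split off.
    poch-shift-up : ∀ x n → x * poch (x + 1ℚ) n ≡ (x + natℚ n) * poch x n
    poch-shift-up x zero    = solve 1 (λ x → x :* con 1ℚ := (x :+ con 0ℚ) :* con 1ℚ) refl x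
    poch-shift-up x (suc n) = begin
      x * (poch (x + 1ℚ) n * (x + 1ℚ + natℚ n))
        ≡⟨ solve 3 (λ x p n → x :* (p :* (x :+ con 1ℚ :+ n)) := (x :* p) :* (x :+ (con 1ℚ :+ n))) refl
             x (poch (x + 1ℚ) n) (natℚ n) ⟩
      x * poch (x + 1ℚ) n * (x + (1ℚ + natℚ n))
        ≡⟨ cong₂ _*_ (poch-shift-up x n) (cong (x +_) (sym (natℚ-suc n))) ⟩
      (x + natℚ n) * poch x n * (x + natℚ (suc n))
        ≡⟨ solve 3 (λ a p b → (a :* p) :* b := b :* (p :* a)) refl (x + natℚ n) (poch x n) (x + natℚ (suc n)) ⟩
      (x + natℚ (suc n)) * (poch x n * (x + natℚ n)) ∎
      where open ≡-Reasoning

    poch-shift-down : ∀ x n → poch (x - 1ℚ) (suc n) ≡ (x - 1ℚ) * poch x n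
    poch-shift-down x zero    = solve 1 (λ x → con 1ℚ :* (x :- con 1ℚ :+ con 0ℚ) := (x :- con 1ℚ) :* con 1ℚ) refl x
    poch-shift-down x (suc n) = begin
      poch (x - 1ℚ) (suc n) * (x - 1ℚ + natℚ (suc n))
        ≡⟨ cong₂ (λ p m → p * (x - 1ℚ + m)) (poch-shift-down x n) (natℚ-suc n) ⟩
      (x - 1ℚ) * poch x n * (x - 1ℚ + (1ℚ + natℚ n))
        ≡⟨ solve 3 (λ x p n → (x :- con 1ℚ) :* p :* (x :- con 1ℚ :+ (con 1ℚ :+ n))
                            := (x :- con 1ℚ) :* (p :* (x :+ n))) refl x (poch x n) (natℚ n) ⟩
      (x - 1ℚ) * (poch x n * (x + natℚ n)) ∎
      where open ≡-Reasoning

  -- The three-term recurrence of ₂F₁ at argument 2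

  module _ (d : ℕ) where
    weight : ℕ → ℚ
    weight n = (1ℚ ÷₀ (poch (- natℚ d) n * natℚ (n !))) * (2ℚ ^ℚ n)

    -- The numerator parameters are rationals `y` and `x` instead of `-i` and `-j`, so that `x` can
    -- be shifted by 1 in both directions.
    series : ℚ → ℚ → ℕ → ℚ
    series y x n = (poch y n * poch x n) ÷₀ (poch (- natℚ d) n * natℚ (n !)) * (2ℚ ^ℚ n)

    abstract
      series-weight : ∀ y x n → series y x n ≡ poch y n * poch x n * weight n
      series-weight y x n = trans
        (cong (_* (2ℚ ^ℚ n)) (÷₀-* (poch y n * poch x n) (poch (- natℚ d) n * natℚ (n !))))
        (ℚₚ.*-assoc (poch y n * poch x n) _ (2ℚ ^ℚ n))

      -- The ratio of consecutive weights, cleared of denominators. The bound matters: at `n = d`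
      -- the left side is 0, as `natℚ n - natℚ d` is.
      weight-step : ∀ n → n ℕ.< d →
        weight (suc n) * ((1ℚ + natℚ n) * (natℚ n - natℚ d)) ≡ 2ℚ * weight n
      weight-step n n<d = *-cancelˡ-≢0 b b≢0 (begin
        b * (b′⁻¹ * (2ℚ * t) * ((1ℚ + natℚ n) * (natℚ n - natℚ d)))
          ≡⟨ solve 7 (λ p f b′⁻¹ w t n d →
               (p :* f) :* (b′⁻¹ :* (w :* t) :* ((con 1ℚ :+ n) :* (n :- d)))
                 := (b′⁻¹ :* ((p :* (:- d :+ n)) :* ((con 1ℚ :+ n) :* f))) :* (w :* t)) refl
               (poch (- natℚ d) n) (natℚ (n !)) b′⁻¹ 2ℚ t (natℚ n) (natℚ d) ⟩
        b′⁻¹ * (poch (- natℚ d) (suc n) * ((1ℚ + natℚ n) * natℚ (n !))) * (2ℚ * t)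
          ≡⟨ cong (λ m → b′⁻¹ * (poch (- natℚ d) (suc n) * m) * (2ℚ * t))
               (trans (cong (_* natℚ (n !)) (sym (natℚ-suc n))) (sym (natℚ-* (suc n) (n !)))) ⟩
        b′⁻¹ * b′ * (2ℚ * t)
          ≡⟨ cong (_* (2ℚ * t)) (trans (÷₀-inverse b′ b′≢0) (sym (÷₀-inverse b b≢0))) ⟩
        b⁻¹ * b * (2ℚ * t)
          ≡⟨ solve 4 (λ b⁻¹ b w t → (b⁻¹ :* b) :* (w :* t) := b :* (w :* (b⁻¹ :* t))) refl b⁻¹ b 2ℚ t ⟩
        b * (2ℚ * (b⁻¹ * t)) ∎)
        where
        open ≡-Reasoning
        t b b′ b⁻¹ b′⁻¹ : ℚ
        t = 2ℚ ^ℚ n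
        b = poch (- natℚ d) n * natℚ (n !)
        b′ = poch (- natℚ d) (suc n) * natℚ (suc n !)
        b⁻¹ = 1ℚ ÷₀ b
        b′⁻¹ = 1ℚ ÷₀ b′
        !≢0 : ∀ n → natℚ (n !) ≢ 0ℚ
        !≢0 n h = ℕ.≢-nonZero⁻¹ (n !) ⦃ n ℕₚ.!≢0 ⦄ (natℚ-injective (n !) 0 h)
        b≢0 : b ≢ 0ℚ
        b≢0 = *-≢0 (poch-≢0 d n (ℕₚ.<⇒≤ n<d)) (!≢0 n)
        b′≢0 : b′ ≢ 0ℚ
        b′≢0 = *-≢0 (poch-≢0 d (suc n) n<d) (!≢0 (suc n))

      -- A contiguous relation with a telescoping certificate: term by term, the left side minus the
      -- right side is `h (suc n) - h n`. The boundary values vanish, since `h 0 = 0` and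
      -- `h (suc d)` contains the factor `poch y (suc d)`.
      series-telescope : ∀ y x → poch y (suc d) ≡ 0ℚ →
        (natℚ d + 2ℚ * y) * ∑< (suc d) (series y x) + x * ∑< (suc d) (series y (x + 1ℚ))
          ≡ (natℚ d + x) * ∑< (suc d) (series y (x - 1ℚ))
      series-telescope y x y-vanishes = ℚ-cancel (begin
        (α * ∑< N (series y x) + x * ∑< N (series y (x + 1ℚ))) - β * ∑< N (series y (x - 1ℚ))
          ≡⟨ solve 6 (λ α s x t β u → (α :* s :+ x :* t) :- β :* u := (α :* s :+ x :* t) :+ (:- β) :* u) refl
               α (∑< N (series y x)) x (∑< N (series y (x + 1ℚ))) β (∑< N (series y (x - 1ℚ))) ⟩
        (α * ∑< N (series y x) + x * ∑< N (series y (x + 1ℚ))) + (- β) * ∑< N (series y (x - 1ℚ))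
          ≡⟨ sym (cong₂ _+_ (cong₂ _+_ (∑<-*ˡ N α (series y x)) (∑<-*ˡ N x (series y (x + 1ℚ))))
                   (∑<-*ˡ N (- β) (series y (x - 1ℚ)))) ⟩
        (∑< N (λ n → α * series y x n) + ∑< N (λ n → x * series y (x + 1ℚ) n))
          + ∑< N (λ n → (- β) * series y (x - 1ℚ) n)
          ≡⟨ sym (trans (∑<-+ N (λ n → α * series y x n + x * series y (x + 1ℚ) n)
                                  (λ n → (- β) * series y (x - 1ℚ) n))
                    (cong (_+ ∑< N (λ n → (- β) * series y (x - 1ℚ) n))
                      (∑<-+ N (λ n → α * series y x n) (λ n → x * series y (x + 1ℚ) n)))) ⟩
        ∑< N (λ n → (α * series y x n + x * series y (x + 1ℚ) n) + (- β) * series y (x - 1ℚ) n)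
          ≡⟨ ∑<-cong N telescopes ⟩
        ∑< N (λ n → h (suc n) + - 1ℚ * h n)
          ≡⟨ ∑<-+ N (h ∘ suc) (λ n → - 1ℚ * h n) ⟩
        ∑< N (h ∘ suc) + ∑< N (λ n → - 1ℚ * h n)
          ≡⟨ cong₂ _+_ (∑<-shift N h refl h-end) (∑<-*ˡ N (- 1ℚ) h) ⟩
        ∑< N h + - 1ℚ * ∑< N h
          ≡⟨ solve 1 (λ s → s :+ con (- 1ℚ) :* s := con 0ℚ) refl (∑< N h) ⟩
        0ℚ ∎)
        where
        open ≡-Reasoning
        N : ℕ
        N = suc d
        α β : ℚ
        α = natℚ d + 2ℚ * y
        β = natℚ d + x
        h : ℕ → ℚ
        h zero    = 0ℚ
        h (suc n) = (y + natℚ n) * poch y n * poch x n * (2ℚ * weight n)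
        ℚ-cancel : ∀ {p q} → p - q ≡ 0ℚ → p ≡ q
        ℚ-cancel {p} {q} e = trans (solve 2 (λ p q → p := (p :- q) :+ q) refl p q)
          (trans (cong (_+ q) e) (ℚₚ.+-identityˡ q))
        h-end : h N ≡ 0ℚ
        h-end = begin
          (y + natℚ d) * poch y d * poch x d * (2ℚ * weight d)
            ≡⟨ solve 4 (λ a p q w → a :* p :* q :* w := (p :* a) :* (q :* w)) refl
                 (y + natℚ d) (poch y d) (poch x d) (2ℚ * weight d) ⟩
          poch y (suc d) * (poch x d * (2ℚ * weight d))
            ≡⟨ cong (_* (poch x d * (2ℚ * weight d))) y-vanishes ⟩
          0ℚ * (poch x d * (2ℚ * weight d))
            ≡⟨ ℚₚ.*-zeroˡ (poch x d * (2ℚ * weight d)) ⟩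
          0ℚ ∎
        telescopes : ∀ n → n ℕ.< N →
          (α * series y x n + x * series y (x + 1ℚ) n) + (- β) * series y (x - 1ℚ) n ≡ h (suc n) + - 1ℚ * h n
        telescopes zero _ = begin
          (α * series y x 0 + x * series y (x + 1ℚ) 0) + (- β) * series y (x - 1ℚ) 0
            ≡⟨ cong₂ _+_ (cong₂ (λ a b → α * a + x * b) (series-weight y x 0) (series-weight y (x + 1ℚ) 0))
                 (cong (- β *_) (series-weight y (x - 1ℚ) 0)) ⟩
          (α * (1ℚ * 1ℚ * weight 0) + x * (1ℚ * 1ℚ * weight 0)) + (- β) * (1ℚ * 1ℚ * weight 0)
            ≡⟨ solve 4 (λ d y x w →
                 ((d :+ con 2ℚ :* y) :* (con 1ℚ :* con 1ℚ :* w) :+ x :* (con 1ℚ :* con 1ℚ :* w))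
                   :+ (:- (d :+ x)) :* (con 1ℚ :* con 1ℚ :* w)
                 := (y :+ con 0ℚ) :* con 1ℚ :* con 1ℚ :* (con 2ℚ :* w) :+ con (- 1ℚ) :* con 0ℚ) refl
                 (natℚ d) y x (weight 0) ⟩
          h 1 + - 1ℚ * h 0 ∎
        -- With `m = suc n`, the shift identities express all three Pochhammer symbols in `x`
        -- through `poch x n`; `weight-step` then trades `weight m` for `weight n` in the subtracted
        -- term `h m`.
        telescopes (suc n) (s≤s n<d) = begin
          (α * series y x m + x * series y (x + 1ℚ) m) + (- β) * series y (x - 1ℚ) m
            ≡⟨ cong₂ _+_ (cong₂ (λ a b → α * a + x * b) (series-weight y x m) (series-weight y (x + 1ℚ) m))
                 (cong (- β *_) (series-weight y (x - 1ℚ) m)) ⟩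
          (α * (Q′ * P′ * w′) + x * (Q′ * poch (x + 1ℚ) m * w′)) + (- β) * (Q′ * poch (x - 1ℚ) m * w′)
            ≡⟨ solve 8 (λ α Q′ P′ w′ x u β v →
                 (α :* (Q′ :* P′ :* w′) :+ x :* (Q′ :* u :* w′)) :+ (:- β) :* (Q′ :* v :* w′)
                 := Q′ :* w′ :* ((α :* P′ :+ x :* u) :- β :* v)) refl
                 α Q′ P′ w′ x (poch (x + 1ℚ) m) β (poch (x - 1ℚ) m) ⟩
          Q′ * w′ * ((α * P′ + x * poch (x + 1ℚ) m) - β * poch (x - 1ℚ) m)
            ≡⟨ cong₂ (λ a b → Q′ * w′ * ((α * P′ + a) - β * b)) (poch-shift-up x m) (poch-shift-down x n) ⟩
          Q′ * w′ * ((α * P′ + (x + natℚ m) * P′) - β * ((x - 1ℚ) * P))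
            ≡⟨ cong (λ k → Q′ * w′ * ((α * P′ + (x + k) * P′) - β * ((x - 1ℚ) * P))) (natℚ-suc n) ⟩
          Q′ * w′ * ((α * P′ + (x + (1ℚ + k)) * P′) - β * ((x - 1ℚ) * P))
            ≡⟨ solve 7 (λ d y x k P Q w′ →
                 (Q :* (y :+ k)) :* w′ :*
                   (((d :+ con 2ℚ :* y) :* (P :* (x :+ k)) :+ (x :+ (con 1ℚ :+ k)) :* (P :* (x :+ k)))
                     :- (d :+ x) :* ((x :- con 1ℚ) :* P))
                 := (y :+ (con 1ℚ :+ k)) :* (Q :* (y :+ k)) :* (P :* (x :+ k)) :* (con 2ℚ :* w′)
                    :+ con (- 1ℚ) :* ((y :+ k) :* Q :* P :* (w′ :* ((con 1ℚ :+ k) :* (k :- d))))) refl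
                 (natℚ d) y x k P Q w′ ⟩
          (y + (1ℚ + k)) * Q′ * P′ * (2ℚ * w′) + - 1ℚ * ((y + k) * Q * P * (w′ * ((1ℚ + k) * (k - natℚ d))))
            ≡⟨ cong₂ (λ a b → (y + a) * Q′ * P′ * (2ℚ * w′) + - 1ℚ * ((y + k) * Q * P * b))
                 (sym (natℚ-suc n)) (weight-step n n<d) ⟩
          h (suc m) + - 1ℚ * h m ∎
          where
          m : ℕ
          m = suc n
          k P P′ Q Q′ w′ : ℚ
          k = natℚ n
          P = poch x n
          P′ = poch x m
          Q = poch y n
          Q′ = poch y m
          w′ = weight m

      ₂F₁-sym : ∀ i j → ₂F₁ i j d ≡ ₂F₁ j i d
      ₂F₁-sym i j = ∑<-cong (suc d) {series (- natℚ i) (- natℚ j)} {series (- natℚ j) (- natℚ i)} λ n _ →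
        cong (λ p → p ÷₀ (poch (- natℚ d) n * natℚ (n !)) * (2ℚ ^ℚ n))
          (ℚₚ.*-comm (poch (- natℚ i) n) (poch (- natℚ j) n))

      -- The contiguous relation at `y = -i`, `x = -j`. At both ends the value out of range is
      -- multiplied by 0: the one at `pred 0` by `j = 0`, the one at `suc d` by `d - d`.
      ₂F₁-recurrence : ∀ i j → i ℕ.≤ d →
        (natℚ d - 2ℚ * natℚ i) * ₂F₁ i j d
          ≡ natℚ j * ₂F₁ i (ℕ.pred j) d + (natℚ d - natℚ j) * ₂F₁ i (suc j) d
      ₂F₁-recurrence i j i≤d = begin
        (natℚ d - 2ℚ * natℚ i) * F (- natℚ j)
          ≡⟨ solve 5 (λ d i j f g → (d :- con 2ℚ :* i) :* f
               := ((d :+ con 2ℚ :* (:- i)) :* f :+ (:- j) :* g) :+ j :* g) refl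
               (natℚ d) (natℚ i) (natℚ j) (F (- natℚ j)) (F (- natℚ j + 1ℚ)) ⟩
        ((natℚ d + 2ℚ * - natℚ i) * F (- natℚ j) + - natℚ j * F (- natℚ j + 1ℚ)) + natℚ j * F (- natℚ j + 1ℚ)
          ≡⟨ cong₂ _+_ (series-telescope (- natℚ i) (- natℚ j) (poch-vanishes i (suc d) (s≤s i≤d))) (down j) ⟩
        (natℚ d - natℚ j) * F (- natℚ j - 1ℚ) + natℚ j * F (- natℚ (ℕ.pred j))
          ≡⟨ cong (λ x → (natℚ d - natℚ j) * F x + natℚ j * F (- natℚ (ℕ.pred j))) up ⟩
        (natℚ d - natℚ j) * F (- natℚ (suc j)) + natℚ j * F (- natℚ (ℕ.pred j))
          ≡⟨ ℚₚ.+-comm ((natℚ d - natℚ j) * F (- natℚ (suc j))) (natℚ j * F (- natℚ (ℕ.pred j))) ⟩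
        natℚ j * F (- natℚ (ℕ.pred j)) + (natℚ d - natℚ j) * F (- natℚ (suc j)) ∎
        where
        open ≡-Reasoning
        F : ℚ → ℚ
        F x = ∑< (suc d) (series (- natℚ i) x)
        up : - natℚ j - 1ℚ ≡ - natℚ (suc j)
        up = trans (solve 1 (λ j → (:- j) :- con 1ℚ := :- (con 1ℚ :+ j)) refl (natℚ j)) (cong -_ (sym (natℚ-suc j)))
        down : ∀ j → natℚ j * F (- natℚ j + 1ℚ) ≡ natℚ j * F (- natℚ (ℕ.pred j))
        down zero    = trans (ℚₚ.*-zeroˡ (F (- natℚ 0 + 1ℚ))) (sym (ℚₚ.*-zeroˡ (F (- natℚ 0))))
        down (suc j) = cong (λ x → natℚ (suc j) * F x)
          (trans (cong (λ m → - m + 1ℚ) (natℚ-suc j)) (solve 1 (λ j → (:- (con 1ℚ :+ j)) :+ con 1ℚ := :- j) refl (natℚ j)))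

      ₂F₁-zeroʳ : ∀ i → ₂F₁ i 0 d ≡ 1ℚ
      ₂F₁-zeroʳ i = begin
        ∑< (suc d) (series (- natℚ i) (- natℚ 0))
          ≡⟨ ∑<-single (suc d) 0 {series (- natℚ i) (- natℚ 0)} (s≤s z≤n) vanishes ⟩
        series (- natℚ i) (- natℚ 0) 0
          ≡⟨⟩
        1ℚ ∎
        where
        open ≡-Reasoning
        vanishes : ∀ n → n ℕ.< suc d → n ≢ 0 → series (- natℚ i) (- natℚ 0) n ≡ 0ℚ
        vanishes zero    _ n≢0 = contradiction refl n≢0
        vanishes (suc n) _ _ = begin
          series (- natℚ i) (- natℚ 0) (suc n)
            ≡⟨ series-weight (- natℚ i) (- natℚ 0) (suc n) ⟩
          poch (- natℚ i) (suc n) * poch (- natℚ 0) (suc n) * weight (suc n)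
            ≡⟨ cong (λ p → poch (- natℚ i) (suc n) * p * weight (suc n)) (poch-vanishes 0 (suc n) (s≤s z≤n)) ⟩
          poch (- natℚ i) (suc n) * 0ℚ * weight (suc n)
            ≡⟨ solve 2 (λ p w → p :* con 0ℚ :* w := con 0ℚ) refl (poch (- natℚ i) (suc n)) (weight (suc n)) ⟩
          0ℚ ∎

  -- Binomial coefficients and orthogonality

  binomial : ℕ → ℕ → ℚ
  binomial n k = natℚ (n C k)

  abstract
    binomial-pascal : ∀ n k → binomial (suc n) (suc k) ≡ binomial n k + binomial n (suc k)
    binomial-pascal n k = trans (cong natℚ (sym (nCk+nC[k+1]≡[n+1]C[k+1] n k))) (natℚ-+ (n C k) (n C suc k))

    binomial-vanishes : ∀ n → binomial n (suc n) ≡ 0ℚ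
    binomial-vanishes n = cong natℚ (k>n⇒nCk≡0 (ℕₚ.n<1+n n))

    binomial-zero : ∀ n → binomial n 0 ≡ 1ℚ
    binomial-zero n = cong natℚ (trans (nCk≡nC[n∸k] (z≤n {n})) (nCn≡1 n))

    -- The difference is taken in ℚ, so the identity is valid for every `k`: from `k = n` on both
    -- sides vanish. It gives the ratio by which the orthogonality weights, and also the norms of
    -- the string vectors, change from one index to the next.
    binomial-absorb : ∀ n k → natℚ (suc k) * binomial n (suc k) ≡ (natℚ n - natℚ k) * binomial n k
    binomial-absorb zero zero    = refl
    binomial-absorb zero (suc k) = trans (ℚₚ.*-zeroʳ (natℚ (suc (suc k)))) (sym (ℚₚ.*-zeroʳ (natℚ 0 - natℚ (suc k))))
    binomial-absorb (suc n) zero = begin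
      1ℚ * binomial (suc n) 1
        ≡⟨ cong (1ℚ *_) (binomial-pascal n 0) ⟩
      1ℚ * (binomial n 0 + binomial n 1)
        ≡⟨ ℚₚ.*-distribˡ-+ 1ℚ (binomial n 0) (binomial n 1) ⟩
      1ℚ * binomial n 0 + 1ℚ * binomial n 1
        ≡⟨ cong (1ℚ * binomial n 0 +_) (binomial-absorb n 0) ⟩
      1ℚ * binomial n 0 + (natℚ n - natℚ 0) * binomial n 0
        ≡⟨ cong (λ b → 1ℚ * b + (natℚ n - natℚ 0) * b) (binomial-zero n) ⟩
      1ℚ * 1ℚ + (natℚ n - natℚ 0) * 1ℚ
        ≡⟨ solve 1 (λ n → con 1ℚ :* con 1ℚ :+ (n :- con 0ℚ) :* con 1ℚ := ((con 1ℚ :+ n) :- con 0ℚ) :* con 1ℚ) refl (natℚ n) ⟩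
      ((1ℚ + natℚ n) - natℚ 0) * 1ℚ
        ≡⟨ cong₂ (λ m b → (m - natℚ 0) * b) (sym (natℚ-suc n)) (sym (binomial-zero (suc n))) ⟩
      (natℚ (suc n) - natℚ 0) * binomial (suc n) 0 ∎
      where open ≡-Reasoning
    binomial-absorb (suc n) (suc k) = begin
      natℚ (suc (suc k)) * binomial (suc n) (suc (suc k))
        ≡⟨ cong (natℚ (suc (suc k)) *_) (binomial-pascal n (suc k)) ⟩
      natℚ (suc (suc k)) * (b₁ + binomial n (suc (suc k)))
        ≡⟨ ℚₚ.*-distribˡ-+ (natℚ (suc (suc k))) b₁ (binomial n (suc (suc k))) ⟩
      natℚ (suc (suc k)) * b₁ + natℚ (suc (suc k)) * binomial n (suc (suc k))
        ≡⟨ cong (natℚ (suc (suc k)) * b₁ +_) (binomial-absorb n (suc k)) ⟩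
      natℚ (suc (suc k)) * b₁ + (natℚ n - natℚ (suc k)) * b₁
        ≡⟨ cong (λ m → m * b₁ + (natℚ n - natℚ (suc k)) * b₁) (natℚ-suc (suc k)) ⟩
      (1ℚ + natℚ (suc k)) * b₁ + (natℚ n - natℚ (suc k)) * b₁
        ≡⟨ solve 4 (λ n k k′ b → (con 1ℚ :+ k′) :* b :+ (n :- k′) :* b
             := k′ :* b :+ ((con 1ℚ :+ n) :- k′) :* b) refl (natℚ n) (natℚ k) (natℚ (suc k)) b₁ ⟩
      natℚ (suc k) * b₁ + ((1ℚ + natℚ n) - natℚ (suc k)) * b₁
        ≡⟨ cong (_+ ((1ℚ + natℚ n) - natℚ (suc k)) * b₁) (binomial-absorb n k) ⟩
      (natℚ n - natℚ k) * b₀ + ((1ℚ + natℚ n) - natℚ (suc k)) * b₁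
        ≡⟨ cong (λ m → (natℚ n - natℚ k) * b₀ + ((1ℚ + natℚ n) - m) * b₁) (natℚ-suc k) ⟩
      (natℚ n - natℚ k) * b₀ + ((1ℚ + natℚ n) - (1ℚ + natℚ k)) * b₁
        ≡⟨ solve 4 (λ n k b₀ b₁ → (n :- k) :* b₀ :+ ((con 1ℚ :+ n) :- (con 1ℚ :+ k)) :* b₁
             := ((con 1ℚ :+ n) :- (con 1ℚ :+ k)) :* (b₀ :+ b₁)) refl (natℚ n) (natℚ k) b₀ b₁ ⟩
      ((1ℚ + natℚ n) - (1ℚ + natℚ k)) * (b₀ + b₁)
        ≡⟨ cong₂ (λ m l → (m - l) * (b₀ + b₁)) (sym (natℚ-suc n)) (sym (natℚ-suc k)) ⟩
      (natℚ (suc n) - natℚ (suc k)) * (b₀ + b₁)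
        ≡⟨ cong ((natℚ (suc n) - natℚ (suc k)) *_) (sym (binomial-pascal n k)) ⟩
      (natℚ (suc n) - natℚ (suc k)) * binomial (suc n) (suc k) ∎
      where
      open ≡-Reasoning
      b₀ b₁ : ℚ
      b₀ = binomial n k
      b₁ = binomial n (suc k)

    binomial-sum : ∀ n → ∑< (suc n) (binomial n) ≡ 2ℚ ^ℚ n
    binomial-sum zero    = refl
    binomial-sum (suc n) = begin
      binomial (suc n) 0 + ∑< (suc n) (binomial (suc n) ∘ suc)
        ≡⟨ cong₂ _+_ (trans (binomial-zero (suc n)) (sym (binomial-zero n)))
             (∑<-cong (suc n) (λ k _ → binomial-pascal n k)) ⟩
      binomial n 0 + ∑< (suc n) (λ k → binomial n k + binomial n (suc k))
        ≡⟨ cong (binomial n 0 +_) (∑<-+ (suc n) (binomial n) (binomial n ∘ suc)) ⟩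
      binomial n 0 + (s + ∑< (suc n) (binomial n ∘ suc))
        ≡⟨ solve 3 (λ b s t → b :+ (s :+ t) := s :+ (b :+ t)) refl
             (binomial n 0) s (∑< (suc n) (binomial n ∘ suc)) ⟩
      s + ∑< (suc (suc n)) (binomial n)
        ≡⟨ cong (s +_) (trans (∑<-last (suc n) (binomial n)) (cong (s +_) (binomial-vanishes n))) ⟩
      s + (s + 0ℚ)
        ≡⟨ solve 1 (λ s → s :+ (s :+ con 0ℚ) := con 2ℚ :* s) refl s ⟩
      2ℚ * s
        ≡⟨ cong (2ℚ *_) (binomial-sum n) ⟩
      2ℚ * (2ℚ ^ℚ n) ∎
      where
      open ≡-Reasoning
      s : ℚ
      s = ∑< (suc n) (binomial n)

    half-power : ∀ n → (½ ^ℚ n) * (2ℚ ^ℚ n) ≡ 1ℚ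
    half-power zero    = refl
    half-power (suc n) = begin
      ½ * (½ ^ℚ n) * (2ℚ * (2ℚ ^ℚ n))
        ≡⟨ solve 2 (λ h t → con ½ :* h :* (con 2ℚ :* t) := h :* t) refl (½ ^ℚ n) (2ℚ ^ℚ n) ⟩
      (½ ^ℚ n) * (2ℚ ^ℚ n)
        ≡⟨ half-power n ⟩
      1ℚ ∎
      where open ≡-Reasoning

    -- The adjoint of the recurrence in i fixes the row of binomial coefficients,
    -- which therefore pairs to zero with every j-th eigenvector other than j = 0.
    ₂F₁-orthogonality : ∀ d j → suc j ℕ.≤ d → ∑< (suc d) (λ i → binomial d i * ₂F₁ i (suc j) d) ≡ 0ℚ
    ₂F₁-orthogonality d j′ j≤d = *-cancelˡ-≢0 (natℚ j) (natℚ-suc≢0 j′) (trans scaled (sym (ℚₚ.*-zeroʳ (natℚ j))))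
      where
      open ≡-Reasoning
      j N : ℕ
      j = suc j′
      N = suc d
      F f g₁ g₂ : ℕ → ℚ
      F i = ₂F₁ i j d
      f i = natℚ i * binomial d i * F i
      g₁ i = natℚ i * binomial d i * F (ℕ.pred i)
      g₂ i = (natℚ d - natℚ i) * binomial d i * F i
      G : ℚ
      G = ∑< N (λ i → binomial d i * F i)
      recurrence : ∀ i → (natℚ d - 2ℚ * natℚ j) * (binomial d i * F i) ≡ g₁ i + f (suc i)
      recurrence i = begin
        (natℚ d - 2ℚ * natℚ j) * (binomial d i * F i)
          ≡⟨ cong (λ x → (natℚ d - 2ℚ * natℚ j) * (binomial d i * x)) (₂F₁-sym d i j) ⟩
        (natℚ d - 2ℚ * natℚ j) * (binomial d i * ₂F₁ j i d)
          ≡⟨ solve 3 (λ a b c → a :* (b :* c) := b :* (a :* c)) refl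
               (natℚ d - 2ℚ * natℚ j) (binomial d i) (₂F₁ j i d) ⟩
        binomial d i * ((natℚ d - 2ℚ * natℚ j) * ₂F₁ j i d)
          ≡⟨ cong (binomial d i *_) (₂F₁-recurrence d j i j≤d) ⟩
        binomial d i * (natℚ i * ₂F₁ j (ℕ.pred i) d + (natℚ d - natℚ i) * ₂F₁ j (suc i) d)
          ≡⟨ cong₂ (λ x y → binomial d i * (natℚ i * x + (natℚ d - natℚ i) * y))
               (₂F₁-sym d j (ℕ.pred i)) (₂F₁-sym d j (suc i)) ⟩
        binomial d i * (natℚ i * F (ℕ.pred i) + (natℚ d - natℚ i) * F (suc i))
          ≡⟨ solve 5 (λ b i u d v → b :* (i :* u :+ (d :- i) :* v) := i :* b :* u :+ ((d :- i) :* b) :* v) refl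
               (binomial d i) (natℚ i) (F (ℕ.pred i)) (natℚ d) (F (suc i)) ⟩
        g₁ i + (natℚ d - natℚ i) * binomial d i * F (suc i)
          ≡⟨ cong (λ b → g₁ i + b * F (suc i)) (sym (binomial-absorb d i)) ⟩
        g₁ i + f (suc i) ∎
      ends-at-N : ∀ x → natℚ N * binomial d N * x ≡ 0ℚ
      ends-at-N x = trans (cong (λ b → natℚ N * b * x) (binomial-vanishes d))
        (solve 2 (λ n x → n :* con 0ℚ :* x := con 0ℚ) refl (natℚ N) x)
      starts-at-0 : ∀ x → natℚ 0 * binomial d 0 * x ≡ 0ℚ
      starts-at-0 x = solve 2 (λ b x → con 0ℚ :* b :* x := con 0ℚ) refl (binomial d 0) x
      -- Shifting `g₁` up and `f` down gives the `i`-th term the coefficients `d - i` and `i`, which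
      -- add up to `d`. Thus `(d - 2j) G = d G`, and `G` vanishes because `j` is nonzero.
      sums : (natℚ d - 2ℚ * natℚ j) * G ≡ natℚ d * G
      sums = begin
        (natℚ d - 2ℚ * natℚ j) * G
          ≡⟨ sym (∑<-*ˡ N (natℚ d - 2ℚ * natℚ j) (λ i → binomial d i * F i)) ⟩
        ∑< N (λ i → (natℚ d - 2ℚ * natℚ j) * (binomial d i * F i))
          ≡⟨ ∑<-cong N (λ i _ → recurrence i) ⟩
        ∑< N (λ i → g₁ i + f (suc i))
          ≡⟨ ∑<-+ N g₁ (f ∘ suc) ⟩
        ∑< N g₁ + ∑< N (f ∘ suc)
          ≡⟨ cong₂ _+_ (sym (∑<-shift N g₁ (starts-at-0 (F 0)) (ends-at-N (F d))))
               (∑<-shift N f (starts-at-0 (F 0)) (ends-at-N (F N))) ⟩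
        ∑< N (g₁ ∘ suc) + ∑< N f
          ≡⟨ cong (_+ ∑< N f) (∑<-cong N (λ i _ → cong (_* F i) (binomial-absorb d i))) ⟩
        ∑< N g₂ + ∑< N f
          ≡⟨ sym (∑<-+ N g₂ f) ⟩
        ∑< N (λ i → g₂ i + f i)
          ≡⟨ ∑<-cong N (λ i _ → solve 4 (λ d i b x → (d :- i) :* b :* x :+ i :* b :* x := d :* (b :* x)) refl
               (natℚ d) (natℚ i) (binomial d i) (F i)) ⟩
        ∑< N (λ i → natℚ d * (binomial d i * F i))
          ≡⟨ ∑<-*ˡ N (natℚ d) (λ i → binomial d i * F i) ⟩
        natℚ d * G ∎
      scaled : natℚ j * G ≡ 0ℚ
      scaled = begin
        natℚ j * G
          ≡⟨ solve 3 (λ j g d → j :* g := con ½ :* (d :* g :- (d :- con 2ℚ :* j) :* g)) refl (natℚ j) G (natℚ d) ⟩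
        ½ * (natℚ d * G - (natℚ d - 2ℚ * natℚ j) * G)
          ≡⟨ cong (λ x → ½ * (natℚ d * G - x)) sums ⟩
        ½ * (natℚ d * G - natℚ d * G)
          ≡⟨ solve 1 (λ x → con ½ :* (x :- x) := con 0ℚ) refl (natℚ d * G) ⟩
        0ℚ ∎

    ₂F₁-total : ∀ d → ∑< (suc d) (λ i → binomial d i * ₂F₁ i 0 d) ≡ 2ℚ ^ℚ d
    ₂F₁-total d = trans
      (∑<-cong (suc d) (λ i _ → trans (cong (binomial d i *_) (₂F₁-zeroʳ d i)) (ℚₚ.*-identityʳ (binomial d i))))
      (binomial-sum d)

open KrawtchoukSums

-- Scalars

-- gauss embeds ℚ(𝐢), whose elements are the coefficients of the ring solver.
record Scalars : Set₁ where
  field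
    commutativeRing : CommutativeRing 0ℓ 0ℓ
  open CommutativeRing commutativeRing public hiding (zero)
  field
    gauss     : ℚ × ℚ → Carrier
    gauss-+   : ∀ p q r s → gauss (p ℚ.+ r , q ℚ.+ s) ≈ gauss (p , q) + gauss (r , s)
    gauss-*   : ∀ p q r s →
      gauss (p ℚ.* r ℚ.- q ℚ.* s , p ℚ.* s ℚ.+ q ℚ.* r) ≈ gauss (p , q) * gauss (r , s)
    gauss-neg : ∀ p q → gauss (ℚ.- p , ℚ.- q) ≈ - gauss (p , q)
    gauss-0   : gauss (0ℚ , 0ℚ) ≈ 0#
    gauss-1   : gauss (1ℚ , 0ℚ) ≈ 1#
    conj       : Carrier → Carrier
    conj-cong  : ∀ {x y} → x ≈ y → conj x ≈ conj y
    conj-+     : ∀ x y → conj (x + y) ≈ conj x + conj y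
    conj-*     : ∀ x y → conj (x * y) ≈ conj x * conj y
    conj-conj  : ∀ x → conj (conj x) ≈ x
    conj-gauss : ∀ p q → conj (gauss (p , q)) ≈ gauss (p , ℚ.- q)

module ScalarTheory (K : Scalars) where
  open Scalars K public
  open RangeSum commutativeRing public
  open import Algebra.Properties.Semiring.Exp semiring public using (_^_)
  open import Relation.Binary.Reasoning.Setoid setoid

  gaussianRationals : RawRing 0ℓ 0ℓ
  gaussianRationals = record
    { Carrier = ℚ × ℚ ; _≈_ = _≡_
    ; _+_ = λ (p , q) (r , s) → p ℚ.+ r , q ℚ.+ s
    ; _*_ = λ (p , q) (r , s) → p ℚ.* r ℚ.- q ℚ.* s , p ℚ.* s ℚ.+ q ℚ.* r
    ; -_  = λ (p , q) → ℚ.- p , ℚ.- q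
    ; 0#  = 0ℚ , 0ℚ ; 1# = 1ℚ , 0ℚ }

  gauss-morphism : gaussianRationals -Raw-AlmostCommutative⟶ fromCommutativeRing commutativeRing
  gauss-morphism = record
    { ⟦_⟧ = gauss
    ; +-homo = λ (p , q) (r , s) → gauss-+ p q r s
    ; *-homo = λ (p , q) (r , s) → gauss-* p q r s
    ; -‿homo = λ (p , q) → gauss-neg p q
    ; 0-homo = gauss-0
    ; 1-homo = gauss-1 }

  gauss≟ : ∀ x y → Maybe (gauss x ≈ gauss y)
  gauss≟ x y = Maybe.map (λ x≡y → reflexive (≡.cong gauss x≡y)) (dec⇒maybe (×-≡-dec ℚₚ._≟_ ℚₚ._≟_ x y))

  open RingSolver gaussianRationals (fromCommutativeRing commutativeRing) gauss-morphism gauss≟ public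
    using (Polynomial; solve; con; _:=_; _:+_; _:*_; _:-_; :-_)

  :-½𝐢 :-𝐢 :-2 :½ :½𝐢 :𝐢 :1 :0 :2 :2𝐢 : ∀ {n} → Polynomial n
  :-½𝐢 = con (0ℚ , ℚ.- ½)
  :-𝐢  = con (0ℚ , ℚ.- 1ℚ)
  :-2  = con (ℚ.- 2ℚ , 0ℚ)
  :½   = con (½ , 0ℚ)
  :½𝐢  = con (0ℚ , ½)
  :𝐢   = con (0ℚ , 1ℚ)
  :1   = con (1ℚ , 0ℚ)
  :0   = con (0ℚ , 0ℚ)
  :2   = con (2ℚ , 0ℚ)
  :2𝐢  = con (0ℚ , 2ℚ)

  ι : ℚ → Carrier
  ι q = gauss (q , 0ℚ)

  𝐢 : Carrier
  𝐢 = gauss (0ℚ , 1ℚ)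

  nat : ℕ → Carrier
  nat n = ι (natℚ n)

  -- Kept abstract, since comparing products of concrete complex numbers by
  -- unfolding them is exponential in the number of factors.
  abstract
    product₆ : (p q r s t u : Carrier) → Carrier
    product₆ p q r s t u = p * q * r * s * t * u

    product₆-def : ∀ p q r s t u → product₆ p q r s t u ≈ p * q * r * s * t * u
    product₆-def p q r s t u = refl

  ½ₖ ½𝐢 -½𝐢 2𝐢 -2ₖ 2ₖ -𝐢 : Carrier
  ½ₖ  = gauss (½ , 0ℚ)
  ½𝐢  = gauss (0ℚ , ½)
  -½𝐢 = gauss (0ℚ , ℚ.- ½)
  2𝐢  = gauss (0ℚ , 2ℚ)
  2ₖ  = gauss (2ℚ , 0ℚ)
  -2ₖ = gauss (ℚ.- 2ℚ , 0ℚ)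
  -𝐢  = gauss (0ℚ , ℚ.- 1ℚ)

  ι-cong : ∀ {p q} → p ≡ q → ι p ≈ ι q
  ι-cong p≡q = reflexive (≡.cong ι p≡q)

  ι-+ : ∀ p q → ι (p ℚ.+ q) ≈ ι p + ι q
  ι-+ p q = gauss-+ p 0ℚ q 0ℚ

  ι-* : ∀ p q → ι (p ℚ.* q) ≈ ι p * ι q
  ι-* p q = trans
    (reflexive (≡.cong₂ (λ a b → gauss (a , b))
      (≡.sym (≡.trans (≡.cong (λ x → p ℚ.* q ℚ.- x) (ℚₚ.*-zeroˡ 0ℚ)) (ℚₚ.+-identityʳ (p ℚ.* q))))
      (≡.sym (≡.trans (≡.cong₂ ℚ._+_ (ℚₚ.*-zeroʳ p) (ℚₚ.*-zeroˡ q)) ≡.refl))))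
    (gauss-* p 0ℚ q 0ℚ)

  ι-neg : ∀ p → ι (ℚ.- p) ≈ - ι p
  ι-neg p = gauss-neg p 0ℚ

  ι-sub : ∀ p q → ι (p ℚ.- q) ≈ ι p - ι q
  ι-sub p q = trans (ι-+ p (ℚ.- q)) (+-congˡ (ι-neg q))

  ι-∑< : ∀ n f → ι (∑<ℚ n f) ≈ ∑< n (ι ∘ f)
  ι-∑< zero    f = gauss-0
  ι-∑< (suc n) f = trans (ι-+ (f 0) (∑<ℚ n (f ∘ suc))) (+-congˡ (ι-∑< n (f ∘ suc)))

  conj-ι : ∀ q → conj (ι q) ≈ ι q
  conj-ι q = conj-gauss q 0ℚ

  conj-0 : conj 0# ≈ 0#
  conj-0 = trans (conj-cong (sym gauss-0)) (trans (conj-ι 0ℚ) gauss-0)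

  nat-suc : ∀ n → nat (suc n) ≈ 1# + nat n
  nat-suc n = trans (ι-cong (natℚ-suc n)) (trans (ι-+ 1ℚ (natℚ n)) (+-congʳ gauss-1))

  nat-0 : nat 0 ≈ 0#
  nat-0 = gauss-0

  ι-inverse : ∀ q → q ≢ 0ℚ → ι (1ℚ ÷₀ q) * ι q ≈ 1#
  ι-inverse q q≢0 = trans (sym (ι-* (1ℚ ÷₀ q) q)) (trans (ι-cong (÷₀-inverse q q≢0)) gauss-1)

  -- A nonzero rational has an inverse within ℚ, which `ι` carries over; the scalars themselves
  -- provide no division.
  cancel-ι : ∀ q → q ≢ 0ℚ → ∀ {x y} → ι q * x ≈ ι q * y → x ≈ y
  cancel-ι q q≢0 {x} {y} h = begin
    x                         ≈⟨ *-identityˡ x ⟨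
    1# * x                    ≈⟨ *-congʳ (ι-inverse q q≢0) ⟨
    ι (1ℚ ÷₀ q) * ι q * x     ≈⟨ *-assoc _ _ _ ⟩
    ι (1ℚ ÷₀ q) * (ι q * x)   ≈⟨ *-congˡ h ⟩
    ι (1ℚ ÷₀ q) * (ι q * y)   ≈⟨ *-assoc _ _ _ ⟨
    ι (1ℚ ÷₀ q) * ι q * y     ≈⟨ *-congʳ (ι-inverse q q≢0) ⟩
    1# * y                    ≈⟨ *-identityˡ y ⟩
    y                         ∎

  cancel-ι-0 : ∀ q → q ≢ 0ℚ → ∀ {x} → ι q * x ≈ 0# → x ≈ 0#
  cancel-ι-0 q q≢0 h = cancel-ι q q≢0 (trans h (sym (zeroʳ (ι q))))

-- Arithmetic of the eigenvalues `θ`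

module Eigenvalues where
  open ≡ using (refl; sym; trans; cong; cong₂)
  open +-*-Solver using (solve; _:=_; _:+_; _:*_; _:-_; con)
  abstract
    θ-formula : ∀ D n → θ D n ≡ natℚ D ℚ.- 2ℚ ℚ.* natℚ n
    θ-formula D n = trans (intℚ-+ (ℤ.+ D) (ℤ.- (ℤ.+ (2 ℕ.* n))))
      (cong (natℚ D ℚ.+_) (trans (intℚ-neg (ℤ.+ (2 ℕ.* n))) (cong ℚ.-_ (natℚ-* 2 n))))

    θ-sucˡ : ∀ D n → θ (suc D) n ≡ θ D n ℚ.+ 1ℚ
    θ-sucˡ D n = trans (θ-formula (suc D) n) (trans (cong (ℚ._- 2ℚ ℚ.* natℚ n) (natℚ-suc D))
      (trans (solve 2 (λ d n → (con 1ℚ :+ d) :- n := (d :- n) :+ con 1ℚ) refl (natℚ D) (2ℚ ℚ.* natℚ n))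
        (cong (ℚ._+ 1ℚ) (sym (θ-formula D n)))))

    θ-sucʳ : ∀ D n → θ (suc D) (suc n) ≡ θ D n ℚ.- 1ℚ
    θ-sucʳ D n = trans (θ-formula (suc D) (suc n)) (trans
      (cong₂ (λ d m → d ℚ.- 2ℚ ℚ.* m) (natℚ-suc D) (natℚ-suc n))
      (trans (solve 2 (λ d n → (con 1ℚ :+ d) :- con 2ℚ :* (con 1ℚ :+ n) := (d :- con 2ℚ :* n) :- con 1ℚ) refl
          (natℚ D) (natℚ n))
        (cong (ℚ._- 1ℚ) (sym (θ-formula D n)))))

    θ-+ : ∀ D r k → θ D (r ℕ.+ k) ≡ θ D r ℚ.+ ℚ.- 2ℚ ℚ.* natℚ k
    θ-+ D r k = trans (θ-formula D (r ℕ.+ k)) (trans (cong (λ a → natℚ D ℚ.- 2ℚ ℚ.* a) (natℚ-+ r k)) (trans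
      (solve 3 (λ d r k → d :- con 2ℚ :* (r :+ k) := (d :- con 2ℚ :* r) :+ con (ℚ.- 2ℚ) :* k) refl
        (natℚ D) (natℚ r) (natℚ k))
      (cong (ℚ._+ ℚ.- 2ℚ ℚ.* natℚ k) (sym (θ-formula D r)))))

    natℚ-2r+ : ∀ r k → natℚ (r ℕ.+ r ℕ.+ k) ≡ natℚ r ℚ.+ natℚ r ℚ.+ natℚ k
    natℚ-2r+ r k = trans (natℚ-+ (r ℕ.+ r) k) (cong (ℚ._+ natℚ k) (natℚ-+ r r))

    -- The right side is the factor `δ - k` of a lowering step for `δ = θ D r`. As a difference of
    -- two naturals, it is nonzero as soon as these are distinct.
    θ-minus : ∀ D r k → natℚ D ℚ.- natℚ (r ℕ.+ r ℕ.+ k) ≡ θ D r ℚ.- natℚ k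
    θ-minus D r k = trans (cong (λ x → natℚ D ℚ.- x) (natℚ-2r+ r k)) (trans
      (solve 3 (λ d r k → d :- ((r :+ r) :+ k) := (d :- con 2ℚ :* r) :- k) refl (natℚ D) (natℚ r) (natℚ k))
      (cong (ℚ._- natℚ k) (sym (θ-formula D r))))

    θ-top : ∀ r d → θ (r ℕ.+ r ℕ.+ d) r ≡ natℚ d
    θ-top r d = trans (θ-formula (r ℕ.+ r ℕ.+ d) r) (trans (cong (ℚ._- 2ℚ ℚ.* natℚ r) (natℚ-2r+ r d))
      (solve 2 (λ r d → ((r :+ r) :+ d) :- con 2ℚ :* r := d) refl (natℚ r) (natℚ d)))

    -- `L` raises the eigenvalue of `A*` by 2. The gap between the resulting value and the
    -- eigenvalue at distance `n` closes only for `suc n = r`.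
    θ-gap : ∀ D r n → 2ℚ ℚ.* (natℚ r ℚ.- natℚ (suc n)) ≡ θ D n ℚ.- (θ D r ℚ.+ 2ℚ)
    θ-gap D r n = trans (cong (λ m → 2ℚ ℚ.* (natℚ r ℚ.- m)) (natℚ-suc n)) (trans
      (solve 3 (λ d r n → con 2ℚ :* (r :- (con 1ℚ :+ n))
         := (d :- con 2ℚ :* n) :- ((d :- con 2ℚ :* r) :+ con 2ℚ)) refl (natℚ D) (natℚ r) (natℚ n))
      (cong₂ (λ a b → a ℚ.- (b ℚ.+ 2ℚ)) (sym (θ-formula D n)) (sym (θ-formula D r))))

    θ-sub≢0 : ∀ D {m n} → m ≢ n → θ D m ℚ.- θ D n ≢ 0ℚ
    θ-sub≢0 D {m} {n} m≢n h = *-≢0 {2ℚ} {natℚ n ℚ.- natℚ m} (natℚ-suc≢0 1) (natℚ-sub≢0 (m≢n ∘ sym)) (trans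
      (solve 3 (λ d m n → con 2ℚ :* (n :- m) := (d :- con 2ℚ :* m) :- (d :- con 2ℚ :* n)) refl
        (natℚ D) (natℚ m) (natℚ n))
      (trans (cong₂ ℚ._-_ (sym (θ-formula D m)) (sym (θ-formula D n))) h))

open Eigenvalues

-- Operators on spaces of functions, and triples with the sl₂ relations

module Vectors (K : Scalars) (Y : Set) where
  open ScalarTheory K
  open import Relation.Binary.Reasoning.Setoid setoid

  Vect : Set
  Vect = Y → Carrier

  infix 4 _≈ᵛ_
  _≈ᵛ_ : Vect → Vect → Set
  v ≈ᵛ w = ∀ y → v y ≈ w y

  infixr 7 _•_
  _•_ : Carrier → Vect → Vect
  (c • v) y = c * v y

  0ᵛ : Vect
  0ᵛ _ = 0#

  record Linear : Set where
    field
      fun    : Vect → Vect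
      fcong  : ∀ {v w} → v ≈ᵛ w → fun v ≈ᵛ fun w
      linear : ∀ a b v w → fun (λ y → a * v y + b * w y) ≈ᵛ λ y → a * fun v y + b * fun w y

    scale : ∀ a v → fun (a • v) ≈ᵛ a • fun v
    scale a v y = begin
      fun (a • v) y                       ≈⟨ fcong (λ z → solve 2 (λ a x → a :* x := a :* x :+ :0 :* x) refl a (v z)) y ⟩
      fun (λ z → a * v z + gauss (0ℚ , 0ℚ) * v z) y  ≈⟨ linear a (gauss (0ℚ , 0ℚ)) v v y ⟩
      a * fun v y + gauss (0ℚ , 0ℚ) * fun v y        ≈⟨ solve 2 (λ a x → a :* x :+ :0 :* x := a :* x) refl a (fun v y) ⟩
      a * fun v y                         ∎

    zeroᵛ : ∀ {v} → v ≈ᵛ 0ᵛ → fun v ≈ᵛ 0ᵛ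
    zeroᵛ {v} v≈0 y = begin
      fun v y          ≈⟨ fcong (λ z → trans (v≈0 z) (sym (zeroˡ (v z)))) y ⟩
      fun (0# • v) y   ≈⟨ scale 0# v y ⟩
      0# * fun v y     ≈⟨ zeroˡ _ ⟩
      0#               ∎

    affine : ∀ a b u v w → fun (λ y → u y + (a * v y + b * w y)) ≈ᵛ λ y → fun u y + (a * fun v y + b * fun w y)
    affine a b u v w y = begin
      fun (λ y → u y + (a * v y + b * w y)) y
        ≈⟨ fcong (λ y → sym (+-cong (*-identityˡ (u y)) (*-identityˡ (a * v y + b * w y)))) y ⟩
      fun (λ y → 1# * u y + 1# * (a * v y + b * w y)) y
        ≈⟨ linear 1# 1# u (λ y → a * v y + b * w y) y ⟩
      1# * fun u y + 1# * fun (λ y → a * v y + b * w y) y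
        ≈⟨ +-cong (*-identityˡ _) (trans (*-identityˡ _) (linear a b v w y)) ⟩
      fun u y + (a * fun v y + b * fun w y) ∎

    sums : ∀ n (c : ℕ → Carrier) (v : ℕ → Vect) →
      fun (λ y → ∑< n (λ k → c k * v k y)) ≈ᵛ λ y → ∑< n (λ k → c k * fun (v k) y)
    sums zero    c v y = zeroᵛ (λ _ → refl) y
    sums (suc n) c v y = begin
      fun (λ z → c 0 * v 0 z + rest z) y
        ≈⟨ fcong (λ z → +-congˡ (sym (*-identityˡ (rest z)))) y ⟩
      fun (λ z → c 0 * v 0 z + 1# * rest z) y
        ≈⟨ linear (c 0) 1# (v 0) rest y ⟩
      c 0 * fun (v 0) y + 1# * fun rest y
        ≈⟨ +-congˡ (trans (*-identityˡ _) (sums n (c ∘ suc) (v ∘ suc) y)) ⟩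
      c 0 * fun (v 0) y + ∑< n (λ k → c (suc k) * fun (v (suc k)) y) ∎
      where
      rest : Vect
      rest z = ∑< n (λ k → c (suc k) * v (suc k) z)
  open Linear public

  combine : Carrier → Linear → Carrier → Linear → Linear
  combine a F b G = record
    { fun    = λ v y → a * fun F v y + b * fun G v y
    ; fcong  = λ v≈w y → +-cong (*-congˡ (fcong F v≈w y)) (*-congˡ (fcong G v≈w y))
    ; linear = λ c d v w y → trans
        (+-cong (*-congˡ (linear F c d v w y)) (*-congˡ (linear G c d v w y)))
        (solve 8 (λ a b c d x y z u → a :* (c :* x :+ d :* y) :+ b :* (c :* z :+ d :* u)
           := c :* (a :* x :+ b :* z) :+ d :* (a :* y :+ b :* u)) refl
           a b c d (fun F v y) (fun F w y) (fun G v y) (fun G w y)) }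

  record Form : Set where
    field
      ⟪_,_⟫     : Vect → Vect → Carrier
      ⟪⟫-cong   : ∀ {v v′ w w′} → v ≈ᵛ v′ → w ≈ᵛ w′ → ⟪ v , w ⟫ ≈ ⟪ v′ , w′ ⟫
      ⟪⟫-linear : ∀ a b v w x → ⟪ (λ y → a * v y + b * w y) , x ⟫ ≈ a * ⟪ v , x ⟫ + b * ⟪ w , x ⟫
      hermitian : ∀ v w → ⟪ v , w ⟫ ≈ conj ⟪ w , v ⟫

    ⟪⟫-linearʳ : ∀ a b v w x → ⟪ x , (λ y → a * v y + b * w y) ⟫ ≈ conj a * ⟪ x , v ⟫ + conj b * ⟪ x , w ⟫
    ⟪⟫-linearʳ a b v w x = begin
      ⟪ x , (λ y → a * v y + b * w y) ⟫                  ≈⟨ hermitian _ _ ⟩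
      conj ⟪ (λ y → a * v y + b * w y) , x ⟫             ≈⟨ conj-cong (⟪⟫-linear a b v w x) ⟩
      conj (a * ⟪ v , x ⟫ + b * ⟪ w , x ⟫)               ≈⟨ trans (conj-+ _ _) (+-cong (conj-* _ _) (conj-* _ _)) ⟩
      conj a * conj ⟪ v , x ⟫ + conj b * conj ⟪ w , x ⟫  ≈⟨ +-cong (*-congˡ (sym (hermitian x v))) (*-congˡ (sym (hermitian x w))) ⟩
      conj a * ⟪ x , v ⟫ + conj b * ⟪ x , w ⟫            ∎

    ⟪⟫-affine : ∀ a b u v w x →
      ⟪ (λ y → u y + (a * v y + b * w y)) , x ⟫ ≈ ⟪ u , x ⟫ + (a * ⟪ v , x ⟫ + b * ⟪ w , x ⟫)
    ⟪⟫-affine a b u v w x = begin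
      ⟪ (λ y → u y + (a * v y + b * w y)) , x ⟫
        ≈⟨ ⟪⟫-cong (λ y → sym (+-cong (*-identityˡ (u y)) (*-identityˡ (a * v y + b * w y)))) (λ _ → refl) ⟩
      ⟪ (λ y → 1# * u y + 1# * (a * v y + b * w y)) , x ⟫
        ≈⟨ ⟪⟫-linear 1# 1# u (λ y → a * v y + b * w y) x ⟩
      1# * ⟪ u , x ⟫ + 1# * ⟪ (λ y → a * v y + b * w y) , x ⟫
        ≈⟨ +-cong (*-identityˡ _) (trans (*-identityˡ _) (⟪⟫-linear a b v w x)) ⟩
      ⟪ u , x ⟫ + (a * ⟪ v , x ⟫ + b * ⟪ w , x ⟫) ∎

    ⟪⟫-affineʳ : ∀ a b u v w x →
      ⟪ x , (λ y → u y + (a * v y + b * w y)) ⟫ ≈ ⟪ x , u ⟫ + (conj a * ⟪ x , v ⟫ + conj b * ⟪ x , w ⟫)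
    ⟪⟫-affineʳ a b u v w x = begin
      ⟪ x , (λ y → u y + (a * v y + b * w y)) ⟫
        ≈⟨ hermitian _ _ ⟩
      conj ⟪ (λ y → u y + (a * v y + b * w y)) , x ⟫
        ≈⟨ conj-cong (⟪⟫-affine a b u v w x) ⟩
      conj (⟪ u , x ⟫ + (a * ⟪ v , x ⟫ + b * ⟪ w , x ⟫))
        ≈⟨ trans (conj-+ _ _) (+-congˡ (trans (conj-+ _ _) (+-cong (conj-* _ _) (conj-* _ _)))) ⟩
      conj ⟪ u , x ⟫ + (conj a * conj ⟪ v , x ⟫ + conj b * conj ⟪ w , x ⟫)
        ≈⟨ +-cong (hermitian x u) (+-cong (*-congˡ (hermitian x v)) (*-congˡ (hermitian x w))) ⟨
      ⟪ x , u ⟫ + (conj a * ⟪ x , v ⟫ + conj b * ⟪ x , w ⟫) ∎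

    ⟪⟫-functional : ∀ x n (c : ℕ → Carrier) (v : ℕ → Vect) →
      ⟪ (λ y → ∑< n (λ k → c k * v k y)) , x ⟫ ≈ ∑< n (λ k → c k * ⟪ v k , x ⟫)
    ⟪⟫-functional x zero c v = begin
      ⟪ 0ᵛ , x ⟫                                    ≈⟨ ⟪⟫-cong (λ y → sym (trans (+-cong (zeroˡ _) (zeroˡ _)) (+-identityˡ 0#))) (λ _ → refl) ⟩
      ⟪ (λ y → 0# * 0# + 0# * 0#) , x ⟫            ≈⟨ ⟪⟫-linear 0# 0# 0ᵛ 0ᵛ x ⟩
      0# * ⟪ 0ᵛ , x ⟫ + 0# * ⟪ 0ᵛ , x ⟫            ≈⟨ trans (+-cong (zeroˡ _) (zeroˡ _)) (+-identityˡ 0#) ⟩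
      0#                                            ∎
    ⟪⟫-functional x (suc n) c v = begin
      ⟪ (λ z → c 0 * v 0 z + rest z) , x ⟫
        ≈⟨ ⟪⟫-cong (λ z → +-congˡ (sym (*-identityˡ (rest z)))) (λ _ → refl) ⟩
      ⟪ (λ z → c 0 * v 0 z + 1# * rest z) , x ⟫
        ≈⟨ ⟪⟫-linear (c 0) 1# (v 0) rest x ⟩
      c 0 * ⟪ v 0 , x ⟫ + 1# * ⟪ rest , x ⟫
        ≈⟨ +-congˡ (trans (*-identityˡ _) (⟪⟫-functional x n (c ∘ suc) (v ∘ suc))) ⟩
      c 0 * ⟪ v 0 , x ⟫ + ∑< n (λ k → c (suc k) * ⟪ v (suc k) , x ⟫) ∎
      where
      rest : Vect
      rest z = ∑< n (λ k → c (suc k) * v (suc k) z)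

    ⟪⟫-scaleˡ : ∀ a v x → ⟪ a • v , x ⟫ ≈ a * ⟪ v , x ⟫
    ⟪⟫-scaleˡ a v x = begin
      ⟪ a • v , x ⟫                   ≈⟨ ⟪⟫-cong (λ y → sym (trans (+-congˡ (zeroˡ _)) (+-identityʳ _))) (λ _ → refl) ⟩
      ⟪ (λ y → a * v y + 0# * v y) , x ⟫  ≈⟨ ⟪⟫-linear a 0# v v x ⟩
      a * ⟪ v , x ⟫ + 0# * ⟪ v , x ⟫  ≈⟨ trans (+-congˡ (zeroˡ _)) (+-identityʳ _) ⟩
      a * ⟪ v , x ⟫                   ∎

    ⟪⟫-scaleʳ : ∀ a v x → ⟪ x , a • v ⟫ ≈ conj a * ⟪ x , v ⟫
    ⟪⟫-scaleʳ a v x = begin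
      ⟪ x , a • v ⟫              ≈⟨ hermitian _ _ ⟩
      conj ⟪ a • v , x ⟫         ≈⟨ conj-cong (⟪⟫-scaleˡ a v x) ⟩
      conj (a * ⟪ v , x ⟫)       ≈⟨ conj-* _ _ ⟩
      conj a * conj ⟪ v , x ⟫    ≈⟨ *-congˡ (hermitian x v) ⟨
      conj a * ⟪ x , v ⟫         ∎

    ⟪0,⟫ : ∀ {v} x → v ≈ᵛ 0ᵛ → ⟪ v , x ⟫ ≈ 0#
    ⟪0,⟫ {v} x v≈0 = begin
      ⟪ v , x ⟫        ≈⟨ ⟪⟫-cong (λ y → trans (v≈0 y) (sym (zeroˡ (v y)))) (λ _ → refl) ⟩
      ⟪ 0# • v , x ⟫   ≈⟨ ⟪⟫-scaleˡ 0# v x ⟩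
      0# * ⟪ v , x ⟫   ≈⟨ zeroˡ _ ⟩
      0#               ∎

    SelfAdjoint : Linear → Set
    SelfAdjoint F = ∀ v w → ⟪ fun F v , w ⟫ ≈ ⟪ v , fun F w ⟫

  -- Modelled on (A, A*, Aε); the cyclic symmetry of the relations gives rotate.
  record Triple (form : Form) : Set where
    open Form form
    field
      A₁ A₂ A₃ : Linear
      comm₁₂ : ∀ v y → fun A₁ (fun A₂ v) y ≈ fun A₂ (fun A₁ v) y + 2𝐢 * fun A₃ v y
      comm₂₃ : ∀ v y → fun A₂ (fun A₃ v) y ≈ fun A₃ (fun A₂ v) y + 2𝐢 * fun A₁ v y
      comm₃₁ : ∀ v y → fun A₃ (fun A₁ v) y ≈ fun A₁ (fun A₃ v) y + 2𝐢 * fun A₂ v y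
      adj₁   : SelfAdjoint A₁
      adj₂   : SelfAdjoint A₂
      adj₃   : SelfAdjoint A₃

  rotate : ∀ {form} → Triple form → Triple form
  rotate t = record
    { A₁ = A₂ ; A₂ = A₃ ; A₃ = A₁ ; comm₁₂ = comm₂₃ ; comm₂₃ = comm₃₁ ; comm₃₁ = comm₁₂
    ; adj₁ = adj₂ ; adj₂ = adj₃ ; adj₃ = adj₁ }
    where open Triple t

  -- Raising and lowering operators and their strings

  module Ladder (form : Form) (t : Triple form) where
    open Form form
    open Triple t

    R L : Linear
    R = combine ½ₖ A₁ ½𝐢 A₃
    L = combine ½ₖ A₁ -½𝐢 A₃

    A₁-ladder : ∀ v y → fun A₁ v y ≈ fun R v y + fun L v y
    A₁-ladder v y = solve 2 (λ a c → a := (:½ :* a :+ :½𝐢 :* c)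
      :+ (:½ :* a :+ :-½𝐢 :* c)) refl (fun A₁ v y) (fun A₃ v y)

    A₃-ladder : ∀ v y → fun A₃ v y ≈ -𝐢 * fun R v y + 𝐢 * fun L v y
    A₃-ladder v y = solve 2 (λ a c → c :=
      :-𝐢 :* (:½ :* a :+ :½𝐢 :* c)
      :+ :𝐢 :* (:½ :* a :+ :-½𝐢 :* c)) refl (fun A₁ v y) (fun A₃ v y)

    -- `A₁` and `A₃` are self-adjoint, and conjugating the coefficient `½𝐢` of `A₃` turns `R` into
    -- `L`.
    adjR : ∀ v w → ⟪ v , fun R w ⟫ ≈ ⟪ fun L v , w ⟫
    adjR v w = begin
      ⟪ v , fun R w ⟫
        ≈⟨ ⟪⟫-linearʳ ½ₖ ½𝐢 (fun A₁ w) (fun A₃ w) v ⟩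
      conj ½ₖ * ⟪ v , fun A₁ w ⟫ + conj ½𝐢 * ⟪ v , fun A₃ w ⟫
        ≈⟨ +-cong (*-cong (conj-gauss ½ 0ℚ) (sym (adj₁ v w))) (*-cong (conj-gauss 0ℚ ½) (sym (adj₃ v w))) ⟩
      ½ₖ * ⟪ fun A₁ v , w ⟫ + -½𝐢 * ⟪ fun A₃ v , w ⟫
        ≈⟨ ⟪⟫-linear ½ₖ -½𝐢 (fun A₁ v) (fun A₃ v) w ⟨
      ⟪ fun L v , w ⟫ ∎

    A₂-R : ∀ v y → fun A₂ (fun R v) y ≈ fun R (fun A₂ v) y + -2ₖ * fun R v y
    A₂-R v y = begin
      fun A₂ (fun R v) y
        ≈⟨ linear A₂ ½ₖ ½𝐢 (fun A₁ v) (fun A₃ v) y ⟩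
      ½ₖ * a₂a₁ + ½𝐢 * fun A₂ (fun A₃ v) y
        ≈⟨ +-congˡ (*-congˡ (comm₂₃ v y)) ⟩
      ½ₖ * a₂a₁ + ½𝐢 * (a₃a₂ + 2𝐢 * a₁)
        ≈⟨ solve 4 (λ p q a c → :½ :* p :+ :½𝐢 :* (q :+ :2𝐢 :* a)
             := :½ :* (p :+ :2𝐢 :* c) :+ :½𝐢 :* q
                :+ :-2 :* (:½ :* a :+ :½𝐢 :* c)) refl
             a₂a₁ a₃a₂ a₁ a₃ ⟩
      ½ₖ * (a₂a₁ + 2𝐢 * a₃) + ½𝐢 * a₃a₂ + -2ₖ * fun R v y
        ≈⟨ +-congʳ (+-congʳ (*-congˡ (sym (comm₁₂ v y)))) ⟩
      fun R (fun A₂ v) y + -2ₖ * fun R v y ∎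
      where
      a₁ a₃ a₂a₁ a₃a₂ : Carrier
      a₁ = fun A₁ v y
      a₃ = fun A₃ v y
      a₂a₁ = fun A₂ (fun A₁ v) y
      a₃a₂ = fun A₃ (fun A₂ v) y

    A₂-L : ∀ v y → fun A₂ (fun L v) y ≈ fun L (fun A₂ v) y + 2ₖ * fun L v y
    A₂-L v y = begin
      fun A₂ (fun L v) y
        ≈⟨ linear A₂ ½ₖ -½𝐢 (fun A₁ v) (fun A₃ v) y ⟩
      ½ₖ * a₂a₁ + -½𝐢 * fun A₂ (fun A₃ v) y
        ≈⟨ +-congˡ (*-congˡ (comm₂₃ v y)) ⟩
      ½ₖ * a₂a₁ + -½𝐢 * (a₃a₂ + 2𝐢 * a₁)
        ≈⟨ solve 4 (λ p q a c → :½ :* p :+ :-½𝐢 :* (q :+ :2𝐢 :* a)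
             := :½ :* (p :+ :2𝐢 :* c) :+ :-½𝐢 :* q
                :+ :2 :* (:½ :* a :+ :-½𝐢 :* c)) refl
             a₂a₁ a₃a₂ a₁ a₃ ⟩
      ½ₖ * (a₂a₁ + 2𝐢 * a₃) + -½𝐢 * a₃a₂ + 2ₖ * fun L v y
        ≈⟨ +-congʳ (+-congʳ (*-congˡ (sym (comm₁₂ v y)))) ⟩
      fun L (fun A₂ v) y + 2ₖ * fun L v y ∎
      where
      a₁ a₃ a₂a₁ a₃a₂ : Carrier
      a₁ = fun A₁ v y
      a₃ = fun A₃ v y
      a₂a₁ = fun A₂ (fun A₁ v) y
      a₃a₂ = fun A₃ (fun A₂ v) y

    -- The squares of `A₁` and `A₃` cancel in the commutator, and the mixed terms leave a multiple
    -- of the commutator of `A₃` and `A₁`, hence of `A₂`. With `A₂-R` and `A₂-L` these are the sl₂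
    -- relations with Cartan element `A₂`.
    L-R : ∀ v y → fun L (fun R v) y ≈ fun R (fun L v) y + fun A₂ v y
    L-R v y = begin
      fun L (fun R v) y
        ≈⟨ +-cong (*-congˡ (linear A₁ ½ₖ ½𝐢 (fun A₁ v) (fun A₃ v) y))
                  (*-congˡ (linear A₃ ½ₖ ½𝐢 (fun A₁ v) (fun A₃ v) y)) ⟩
      ½ₖ * (½ₖ * a₁a₁ + ½𝐢 * a₁a₃) + -½𝐢 * (½ₖ * fun A₃ (fun A₁ v) y + ½𝐢 * a₃a₃)
        ≈⟨ +-congˡ (*-congˡ (+-congʳ (*-congˡ (comm₃₁ v y)))) ⟩
      ½ₖ * (½ₖ * a₁a₁ + ½𝐢 * a₁a₃) + -½𝐢 * (½ₖ * (a₁a₃ + 2𝐢 * a₂) + ½𝐢 * a₃a₃)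
        ≈⟨ solve 4 (λ p q r b →
             :½ :* (:½ :* p :+ :½𝐢 :* q)
               :+ :-½𝐢 :* (:½ :* (q :+ :2𝐢 :* b) :+ :½𝐢 :* r)
             := :½ :* (:½ :* p :+ :-½𝐢 :* q)
               :+ :½𝐢 :* (:½ :* (q :+ :2𝐢 :* b) :+ :-½𝐢 :* r)
               :+ b) refl a₁a₁ a₁a₃ a₃a₃ a₂ ⟩
      ½ₖ * (½ₖ * a₁a₁ + -½𝐢 * a₁a₃) + ½𝐢 * (½ₖ * (a₁a₃ + 2𝐢 * a₂) + -½𝐢 * a₃a₃) + a₂
        ≈⟨ +-congʳ (+-congˡ (*-congˡ (+-congʳ (*-congˡ (comm₃₁ v y))))) ⟨
      ½ₖ * (½ₖ * a₁a₁ + -½𝐢 * a₁a₃) + ½𝐢 * (½ₖ * fun A₃ (fun A₁ v) y + -½𝐢 * a₃a₃) + a₂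
        ≈⟨ +-congʳ (+-cong (*-congˡ (linear A₁ ½ₖ -½𝐢 (fun A₁ v) (fun A₃ v) y))
                           (*-congˡ (linear A₃ ½ₖ -½𝐢 (fun A₁ v) (fun A₃ v) y))) ⟨
      fun R (fun L v) y + a₂ ∎
      where
      a₂ a₁a₁ a₁a₃ a₃a₃ : Carrier
      a₂ = fun A₂ v y
      a₁a₁ = fun A₁ (fun A₁ v) y
      a₁a₃ = fun A₁ (fun A₃ v) y
      a₃a₃ = fun A₃ (fun A₃ v) y

    -- The weight `δ` is an arbitrary scalar because the inequality `2r ≤ D` is itself read off from
    -- such a string, before `δ` is known to be a natural number.
    module String (δ : Carrier) (u : Vect) (weight-u : fun A₂ u ≈ᵛ δ • u) (highest-u : fun L u ≈ᵛ 0ᵛ) where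

      inv : ℕ → Carrier
      inv k = ι (1ℚ ÷₀ natℚ (suc k))

      inv-nat : ∀ k → inv k * nat (suc k) ≈ 1#
      inv-nat k = ι-inverse (natℚ (suc k)) (natℚ-suc≢0 k)

      inv-cancel : ∀ k x → inv k * (nat (suc k) * x) ≈ x
      inv-cancel k x = trans (sym (*-assoc _ _ _)) (trans (*-congʳ (inv-nat k)) (*-identityˡ x))

      nat-cancel : ∀ k x → nat (suc k) * (inv k * x) ≈ x
      nat-cancel k x = trans (sym (*-assoc _ _ _)) (trans (*-congʳ (trans (*-comm _ _) (inv-nat k))) (*-identityˡ x))

      v : ℕ → Vect
      v zero    = u
      v (suc k) = inv k • fun R (v k)

      R-v : ∀ k y → fun R (v k) y ≈ nat (suc k) * v (suc k) y
      R-v k y = sym (nat-cancel k (fun R (v k) y))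

      A₂-v : ∀ k y → fun A₂ (v k) y ≈ (δ + -2ₖ * nat k) * v k y
      A₂-v zero y = trans (weight-u y) (*-congʳ (trans
        (solve 1 (λ δ → δ := δ :+ :-2 :* :0) refl δ) refl))
      A₂-v (suc k) y = begin
        fun A₂ (inv k • fun R (v k)) y
          ≈⟨ scale A₂ (inv k) (fun R (v k)) y ⟩
        inv k * fun A₂ (fun R (v k)) y
          ≈⟨ *-congˡ (A₂-R (v k) y) ⟩
        inv k * (fun R (fun A₂ (v k)) y + -2ₖ * r)
          ≈⟨ *-congˡ (+-congʳ (trans (fcong R (A₂-v k) y) (scale R (δ + -2ₖ * nat k) (v k) y))) ⟩
        inv k * ((δ + -2ₖ * nat k) * r + -2ₖ * r)
          ≈⟨ solve 4 (λ i δ k r → i :* ((δ :+ :-2 :* k) :* r :+ :-2 :* r)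
               := (δ :+ :-2 :* (:1 :+ k)) :* (i :* r)) refl (inv k) δ (nat k) r ⟩
        (δ + -2ₖ * (gauss (1ℚ , 0ℚ) + nat k)) * (inv k * r)
          ≈⟨ *-congʳ (+-congˡ (*-congˡ (trans (+-congʳ gauss-1) (sym (nat-suc k))))) ⟩
        (δ + -2ₖ * nat (suc k)) * (inv k * r) ∎
        where
        r : Carrier
        r = fun R (v k) y

      -- Proved jointly with `L-v`: `LR = RL + A₂` reduces `L` on `v (suc k)` to `RL` on `v k`, and
      -- there `RL` is `R` applied to the preceding instance of `L-v`.
      R-L-v : ∀ k y → fun R (fun L (v k)) y ≈ nat k * (δ - nat k + 1#) * v k y
      L-v   : ∀ k y → fun L (v (suc k)) y ≈ (δ - nat k) * v k y

      R-L-v zero y = trans (zeroᵛ R highest-u y)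
        (sym (trans (*-congʳ (trans (*-congʳ nat-0) (zeroˡ _))) (zeroˡ _)))
      R-L-v (suc k) y = begin
        fun R (fun L (v (suc k))) y
          ≈⟨ trans (fcong R (L-v k) y) (scale R (δ - nat k) (v k) y) ⟩
        (δ - nat k) * fun R (v k) y
          ≈⟨ *-congˡ (R-v k y) ⟩
        (δ - nat k) * (nat (suc k) * v (suc k) y)
          ≈⟨ solve 4 (λ δ k k′ x → (δ :- k) :* (k′ :* x)
               := k′ :* (δ :- (:1 :+ k) :+ :1) :* x) refl
               δ (nat k) (nat (suc k)) (v (suc k) y) ⟩
        nat (suc k) * (δ - (gauss (1ℚ , 0ℚ) + nat k) + gauss (1ℚ , 0ℚ)) * v (suc k) y
          ≈⟨ *-congʳ (*-congˡ (+-cong (+-congˡ (-‿cong (trans (+-congʳ gauss-1) (sym (nat-suc k))))) gauss-1)) ⟩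
        nat (suc k) * (δ - nat (suc k) + 1#) * v (suc k) y ∎
      L-v k y = begin
        fun L (inv k • fun R (v k)) y
          ≈⟨ scale L (inv k) (fun R (v k)) y ⟩
        inv k * fun L (fun R (v k)) y
          ≈⟨ *-congˡ (L-R (v k) y) ⟩
        inv k * (fun R (fun L (v k)) y + fun A₂ (v k) y)
          ≈⟨ *-congˡ (+-cong (R-L-v k y) (A₂-v k y)) ⟩
        inv k * (nat k * (δ - nat k + 1#) * v k y + (δ + -2ₖ * nat k) * v k y)
          ≈⟨ *-congˡ (+-congʳ (*-congʳ (*-congˡ (+-congˡ (sym gauss-1))))) ⟩
        inv k * (nat k * (δ - nat k + gauss (1ℚ , 0ℚ)) * v k y + (δ + -2ₖ * nat k) * v k y)
          ≈⟨ *-congˡ (solve 3 (λ k δ x → k :* (δ :- k :+ :1) :* x :+ (δ :+ :-2 :* k) :* x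
               := (:1 :+ k) :* ((δ :- k) :* x)) refl (nat k) δ (v k y)) ⟩
        inv k * ((gauss (1ℚ , 0ℚ) + nat k) * ((δ - nat k) * v k y))
          ≈⟨ *-congˡ (*-congʳ (trans (+-congʳ gauss-1) (sym (nat-suc k)))) ⟩
        inv k * (nat (suc k) * ((δ - nat k) * v k y))
          ≈⟨ inv-cancel k _ ⟩
        (δ - nat k) * v k y ∎

      -- Applying `L` to `v (suc k)` returns `δ - k` times `v k`, so a zero in the string spreads
      -- downwards until `k = δ`.
      descend : ∀ k q → ι q ≈ δ - nat k → q ≢ 0ℚ → v (suc k) ≈ᵛ 0ᵛ → v k ≈ᵛ 0ᵛ
      descend k q q≈ q≢0 v≈0 y = cancel-ι-0 q q≢0 (begin
        ι q * v k y             ≈⟨ *-congʳ q≈ ⟩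
        (δ - nat k) * v k y     ≈⟨ L-v k y ⟨
        fun L (v (suc k)) y     ≈⟨ zeroᵛ L v≈0 y ⟩
        0#                      ∎)

      -- The descent from any later zero reaches `suc d` and no further, because the next factor
      -- `δ - d` is 0.
      ends-early : ∀ d n → δ ≈ nat d → v (suc d ℕ.+ n) ≈ᵛ 0ᵛ → v (suc d) ≈ᵛ 0ᵛ
      ends-early d zero    δ≈d v≈0 = ≡.subst (λ m → v m ≈ᵛ 0ᵛ) (ℕₚ.+-identityʳ (suc d)) v≈0
      ends-early d (suc n) δ≈d v≈0 = ends-early d n δ≈d
        (descend (suc d ℕ.+ n) (natℚ d ℚ.- natℚ (suc d ℕ.+ n))
          (trans (ι-sub (natℚ d) (natℚ (suc d ℕ.+ n))) (+-congʳ (sym δ≈d)))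
          (natℚ-sub≢0 (ℕₚ.<⇒≢ (ℕₚ.m≤m+n (suc d) n)))
          (≡.subst (λ m → v m ≈ᵛ 0ᵛ) (ℕₚ.+-suc (suc d) n) v≈0))

    -- Termination of the string is a field because it comes from the spectrum of `A₂` on the cube,
    -- not from the relations of the triple.
    record HighestWeight (d : ℕ) (u : Vect) : Set where
      field
        weight-u  : fun A₂ u ≈ᵛ nat d • u
        highest-u : fun L u ≈ᵛ 0ᵛ
      open String (nat d) u weight-u highest-u public
      field
        v-ends : v (suc d) ≈ᵛ 0ᵛ

  -- The projections of one of the three operators, indexed along a string: `proj k` belongs to the
  -- eigenvalue `d - 2k`. Only their effect on eigenvectors is recorded, which makes the same
  -- argument available for each rotation.
  record Axis (F : Linear) (d : ℕ) : Set where
    field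
      proj   : ℕ → Linear
      select : ∀ w k → k ℕ.≤ d → fun F w ≈ᵛ (nat d + -2ₖ * nat k) • w → fun (proj k) w ≈ᵛ w
      reject : ∀ w k l → k ℕ.≤ d → l ℕ.≤ d → k ≢ l →
        fun F w ≈ᵛ (nat d + -2ₖ * nat k) • w → fun (proj l) w ≈ᵛ 0ᵛ

  -- Calculations in the span of a finite string

  module FiniteString (form : Form) (t : Triple form) (d : ℕ) (u : Vect)
                      (hw : Ladder.HighestWeight form t d u) where
    open Form form
    open Triple t
    open Ladder form t
    open HighestWeight hw

    comb : (ℕ → Carrier) → Vect
    comb c y = ∑< (suc d) (λ k → c k * v k y)

    comb-cong : ∀ {c e : ℕ → Carrier} → (∀ k → k ℕ.≤ d → c k ≈ e k) → comb c ≈ᵛ comb e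
    comb-cong c≈e y = ∑<-cong (suc d) λ k k<1+d → *-cong (c≈e k (ℕₚ.≤-pred k<1+d)) (refl {v k y})

    comb-0 : comb (λ _ → 0#) ≈ᵛ 0ᵛ
    comb-0 y = ∑<-zero (suc d) λ k _ → zeroˡ (v k y)

    comb-linear : ∀ a b (c e : ℕ → Carrier) y → a * comb c y + b * comb e y ≈ comb (λ k → a * c k + b * e k) y
    comb-linear a b c e y = begin
      a * comb c y + b * comb e y
        ≈⟨ +-cong (∑<-*ˡ (suc d) a (λ k → c k * v k y)) (∑<-*ˡ (suc d) b (λ k → e k * v k y)) ⟨
      ∑< (suc d) (λ k → a * (c k * v k y)) + ∑< (suc d) (λ k → b * (e k * v k y))
        ≈⟨ ∑<-+ (suc d) (λ k → a * (c k * v k y)) (λ k → b * (e k * v k y)) ⟨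
      ∑< (suc d) (λ k → a * (c k * v k y) + b * (e k * v k y))
        ≈⟨ ∑<-cong (suc d) (λ k _ → solve 5 (λ a b c e x → a :* (c :* x) :+ b :* (e :* x) := (a :* c :+ b :* e) :* x) refl
             a b (c k) (e k) (v k y)) ⟩
      comb (λ k → a * c k + b * e k) y ∎

    comb-scale : ∀ a (c : ℕ → Carrier) y → a * comb c y ≈ comb (λ k → a * c k) y
    comb-scale a c y = trans (sym (∑<-*ˡ (suc d) a (λ k → c k * v k y))) (∑<-cong (suc d) λ k _ → sym (*-assoc a (c k) (v k y)))

    comb-u : ∀ (c : ℕ → Carrier) → c 0 ≈ 1# → (∀ k → suc k ℕ.≤ d → c (suc k) ≈ 0#) → comb c ≈ᵛ u
    comb-u c c₀ c₊ y = begin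
      c 0 * u y + ∑< d (λ k → c (suc k) * v (suc k) y)
        ≈⟨ +-cong (trans (*-congʳ c₀) (*-identityˡ (u y)))
             (∑<-zero d λ k k<d → trans (*-congʳ (c₊ k k<d)) (zeroˡ (v (suc k) y))) ⟩
      u y + 0#  ≈⟨ +-identityʳ (u y) ⟩
      u y       ∎

    -- The coefficients of `R (comb c)` and `L (comb c)`. Spurious values of `c` enter only with the
    -- factor 0: `c (pred 0)` at `k = 0` and `c (suc d)` at `k = d`.
    raised lowered : (ℕ → Carrier) → ℕ → Carrier
    raised c k  = nat k * c (ℕ.pred k)
    lowered c k = (nat d - nat k) * c (suc k)

    R-comb : ∀ (c : ℕ → Carrier) → fun R (comb c) ≈ᵛ comb (raised c)
    R-comb c y = begin
      fun R (comb c) y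
        ≈⟨ sums R (suc d) c v y ⟩
      ∑< (suc d) (λ k → c k * fun R (v k) y)
        ≈⟨ ∑<-cong (suc d) (λ k _ → trans (*-congˡ (R-v k y))
             (solve 3 (λ c n x → c :* (n :* x) := n :* c :* x) refl (c k) (nat (suc k)) (v (suc k) y))) ⟩
      ∑< (suc d) (λ k → nat (suc k) * c k * v (suc k) y)
        ≈⟨ ∑<-shift (suc d) (λ k → raised c k * v k y)
             (trans (*-congʳ (trans (*-congʳ nat-0) (zeroˡ _))) (zeroˡ _))
             (trans (*-congˡ (v-ends y)) (zeroʳ _)) ⟩
      comb (raised c) y ∎

    L-comb : ∀ (c : ℕ → Carrier) → fun L (comb c) ≈ᵛ comb (lowered c)
    L-comb c y = begin
      fun L (comb c) y
        ≈⟨ sums L (suc d) c v y ⟩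
      ∑< (suc d) g
        ≈⟨ ∑<-shift (suc d) g (trans (*-congˡ (highest-u y)) (zeroʳ _))
             (trans (*-congˡ (trans (L-v d y) (trans (*-congʳ (-‿inverseʳ (nat d))) (zeroˡ _)))) (zeroʳ _)) ⟨
      ∑< (suc d) (g ∘ suc)
        ≈⟨ ∑<-cong (suc d) (λ k _ → trans (*-congˡ (L-v k y))
             (solve 3 (λ c n x → c :* (n :* x) := n :* c :* x) refl (c (suc k)) (nat d - nat k) (v k y))) ⟩
      comb (lowered c) y ∎
      where
      g : ℕ → Carrier
      g k = c k * fun L (v k) y

    A₁-comb : ∀ (c : ℕ → Carrier) → fun A₁ (comb c) ≈ᵛ comb (λ k → raised c k + lowered c k)
    A₁-comb c y = begin
      fun A₁ (comb c) y
        ≈⟨ A₁-ladder (comb c) y ⟩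
      fun R (comb c) y + fun L (comb c) y
        ≈⟨ +-cong (R-comb c y) (L-comb c y) ⟩
      comb (raised c) y + comb (lowered c) y
        ≈⟨ ∑<-+ (suc d) (λ k → raised c k * v k y) (λ k → lowered c k * v k y) ⟨
      ∑< (suc d) (λ k → raised c k * v k y + lowered c k * v k y)
        ≈⟨ ∑<-cong (suc d) (λ k _ → sym (distribʳ (v k y) (raised c k) (lowered c k))) ⟩
      comb (λ k → raised c k + lowered c k) y ∎

    A₂-comb : ∀ (c : ℕ → Carrier) → fun A₂ (comb c) ≈ᵛ comb (λ k → (nat d + -2ₖ * nat k) * c k)
    A₂-comb c y = trans (sums A₂ (suc d) c v y) (∑<-cong (suc d) λ k _ → trans (*-congˡ (A₂-v k y))
      (solve 3 (λ c n x → c :* (n :* x) := n :* c :* x) refl (c k) (nat d + -2ₖ * nat k) (v k y)))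

    A₃-comb : ∀ (c : ℕ → Carrier) → fun A₃ (comb c) ≈ᵛ comb (λ k → -𝐢 * raised c k + 𝐢 * lowered c k)
    A₃-comb c y = begin
      fun A₃ (comb c) y
        ≈⟨ A₃-ladder (comb c) y ⟩
      -𝐢 * fun R (comb c) y + 𝐢 * fun L (comb c) y
        ≈⟨ +-cong (*-congˡ (R-comb c y)) (*-congˡ (L-comb c y)) ⟩
      -𝐢 * comb (raised c) y + 𝐢 * comb (lowered c) y
        ≈⟨ comb-linear -𝐢 𝐢 (raised c) (lowered c) y ⟩
      comb (λ k → -𝐢 * raised c k + 𝐢 * lowered c k) y ∎

    -- The coefficients of exp(-𝐢 R) u.
    phase : ℕ → Carrier
    phase k = -𝐢 ^ k

    -- Uses `phase (pred k) = 𝐢 * phase k`; at `k = 0`, where this fails, the factor `nat 0` makes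
    -- both sides vanish.
    raised-phase : ∀ k → raised phase k ≈ nat k * (𝐢 * phase k)
    raised-phase zero    = trans (trans (*-congʳ nat-0) (zeroˡ _)) (sym (trans (*-congʳ nat-0) (zeroˡ _)))
    raised-phase (suc k) = *-congˡ (solve 1 (λ p → p := :𝐢 :* (:-𝐢 :* p)) refl (phase k))

    -- L of the rotated triple kills exp(-𝐢 R) u, which is therefore a highest
    -- weight vector for it.
    phase-highest : fun (Ladder.L form (rotate t)) (comb phase) ≈ᵛ 0ᵛ
    phase-highest y = begin
      ½ₖ * fun A₂ (comb phase) y + -½𝐢 * fun A₁ (comb phase) y
        ≈⟨ +-cong (*-congˡ (A₂-comb phase y)) (*-congˡ (A₁-comb phase y)) ⟩
      ½ₖ * comb (λ k → (nat d + -2ₖ * nat k) * phase k) y + -½𝐢 * comb (λ k → raised phase k + lowered phase k) y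
        ≈⟨ comb-linear ½ₖ -½𝐢 (λ k → (nat d + -2ₖ * nat k) * phase k) (λ k → raised phase k + lowered phase k) y ⟩
      comb (λ k → ½ₖ * ((nat d + -2ₖ * nat k) * phase k) + -½𝐢 * (raised phase k + lowered phase k)) y
        ≈⟨ comb-cong {e = λ _ → 0#} (λ k _ → trans (+-congˡ (*-congˡ (+-congʳ (raised-phase k))))
             (trans (solve 3 (λ d k p →
               :½ :* ((d :+ :-2 :* k) :* p)
                 :+ :-½𝐢 :* (k :* (:𝐢 :* p) :+ (d :- k) :* (:-𝐢 :* p))
               := :0) refl (nat d) (nat k) (phase k)) gauss-0)) y ⟩
      comb (λ _ → 0#) y
        ≈⟨ comb-0 y ⟩
      0# ∎

    -- A nonzero vector cannot be cancelled over the abstract scalars, so coefficients are compared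
    -- only as multiples of `v k`. Applying `R` carries such a comparison one step up the string.
    ray-raise : ∀ k x z → (∀ y → x * v k y ≈ z * v k y) → ∀ y → x * v (suc k) y ≈ z * v (suc k) y
    ray-raise k x z h y = begin
      x * (inv k * fun R (v k) y)   ≈⟨ solve 3 (λ x i r → x :* (i :* r) := i :* (x :* r)) refl x (inv k) (fun R (v k) y) ⟩
      inv k * (x * fun R (v k) y)   ≈⟨ *-congˡ (trans (sym (scale R x (v k) y)) (trans (fcong R h y) (scale R z (v k) y))) ⟩
      inv k * (z * fun R (v k) y)   ≈⟨ solve 3 (λ x i r → i :* (x :* r) := x :* (i :* r)) refl z (inv k) (fun R (v k) y) ⟩
      z * (inv k * fun R (v k) y)   ∎

    module _ (axis₂ : Axis A₂ d) where
      open Axis axis₂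

      -- The string vectors have distinct `A₂`-eigenvalues, so one projection isolates one term.
      -- This does the work of linear independence: an equation between combinations splits into one
      -- equation for each `k`.
      proj-comb : ∀ k → k ℕ.≤ d → (c : ℕ → Carrier) → fun (proj k) (comb c) ≈ᵛ c k • v k
      proj-comb k k≤d c y = begin
        fun (proj k) (comb c) y
          ≈⟨ sums (proj k) (suc d) c v y ⟩
        ∑< (suc d) (λ l → c l * fun (proj k) (v l) y)
          ≈⟨ ∑<-single (suc d) k (s≤s k≤d) (λ l l<1+d l≢k → trans
               (*-congˡ (reject (v l) l k (ℕₚ.≤-pred l<1+d) k≤d l≢k (A₂-v l) y)) (zeroʳ (c l))) ⟩
        c k * fun (proj k) (v k) y
          ≈⟨ *-congˡ (select (v k) k k≤d (A₂-v k) y) ⟩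
        c k * v k y ∎

      module _ (c : ℕ → Carrier) (eigen : fun A₃ (comb c) ≈ᵛ nat d • comb c) where

        component : ∀ k → k ℕ.≤ d → ∀ y → (-𝐢 * raised c k + 𝐢 * lowered c k) * v k y ≈ nat d * (c k * v k y)
        component k k≤d y = begin
          (-𝐢 * raised c k + 𝐢 * lowered c k) * v k y
            ≈⟨ proj-comb k k≤d (λ k → -𝐢 * raised c k + 𝐢 * lowered c k) y ⟨
          fun (proj k) (comb (λ k → -𝐢 * raised c k + 𝐢 * lowered c k)) y
            ≈⟨ fcong (proj k) (A₃-comb c) y ⟨
          fun (proj k) (fun A₃ (comb c)) y
            ≈⟨ trans (fcong (proj k) eigen y) (scale (proj k) (nat d) (comb c) y) ⟩
          nat d * fun (proj k) (comb c) y
            ≈⟨ *-congˡ (proj-comb k k≤d c y) ⟩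
          nat d * (c k * v k y) ∎

        raised-component : ∀ k → (∀ y → c (ℕ.pred k) * v (ℕ.pred k) y ≈ c 0 * phase (ℕ.pred k) * v (ℕ.pred k) y) →
          ∀ y → raised c k * v k y ≈ nat k * (c 0 * (𝐢 * phase k)) * v k y
        raised-component zero    _  y =
          *-congʳ (trans (trans (*-congʳ nat-0) (zeroˡ _)) (sym (trans (*-congʳ nat-0) (zeroˡ _))))
        raised-component (suc k) ih y = begin
          nat (suc k) * c k * v (suc k) y
            ≈⟨ *-assoc _ _ _ ⟩
          nat (suc k) * (c k * v (suc k) y)
            ≈⟨ *-congˡ (ray-raise k (c k) (c 0 * phase k) ih y) ⟩
          nat (suc k) * (c 0 * phase k * v (suc k) y)
            ≈⟨ solve 4 (λ n c p x → n :* (c :* p :* x)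
                 := n :* (c :* (:𝐢 :* (:-𝐢 :* p))) :* x) refl
                 (nat (suc k)) (c 0) (phase k) (v (suc k) y) ⟩
          nat (suc k) * (c 0 * (𝐢 * phase (suc k))) * v (suc k) y ∎

        -- The `k`-th component of the eigenvector equation is a three-term recurrence. Since
        -- `d - k` is nonzero it determines the coefficient at `suc k`, and the multiples of `phase`
        -- solve it. The component gives the equality on `v k`; `ray-raise` moves it to `v (suc k)`.
        phase-step : ∀ k → suc k ℕ.≤ d →
          (∀ y → raised c k * v k y ≈ nat k * (c 0 * (𝐢 * phase k)) * v k y) →
          (∀ y → c k * v k y ≈ c 0 * phase k * v k y) →
          ∀ y → c (suc k) * v (suc k) y ≈ c 0 * phase (suc k) * v (suc k) y
        phase-step k k<d raised-k ray-k = ray-raise k (c (suc k)) (c 0 * phase (suc k)) λ y →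
          cancel-ι (natℚ d ℚ.- natℚ k) (natℚ-sub≢0 (ℕₚ.<⇒≢ k<d ∘ ≡.sym)) (begin
            ι (natℚ d ℚ.- natℚ k) * (c (suc k) * v k y)
              ≈⟨ *-congʳ (ι-sub (natℚ d) (natℚ k)) ⟩
            (nat d - nat k) * (c (suc k) * v k y)
              ≈⟨ solve 5 (λ d k c r x → (d :- k) :* (c :* x)
                   := :-𝐢 :* ((:-𝐢 :* r :+ :𝐢 :* ((d :- k) :* c)) :* x)
                      :+ r :* x) refl
                   (nat d) (nat k) (c (suc k)) (raised c k) (v k y) ⟩
            -𝐢 * ((-𝐢 * raised c k + 𝐢 * lowered c k) * v k y) + raised c k * v k y
              ≈⟨ +-cong (*-congˡ (trans (component k (ℕₚ.<⇒≤ k<d) y) (*-congˡ (ray-k y)))) (raised-k y) ⟩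
            -𝐢 * (nat d * (c 0 * phase k * v k y)) + nat k * (c 0 * (𝐢 * phase k)) * v k y
              ≈⟨ solve 5 (λ d k c p x →
                   :-𝐢 :* (d :* (c :* p :* x)) :+ k :* (c :* (:𝐢 :* p)) :* x
                   := (d :- k) :* (c :* (:-𝐢 :* p) :* x)) refl
                   (nat d) (nat k) (c 0) (phase k) (v k y) ⟩
            (nat d - nat k) * (c 0 * phase (suc k) * v k y)
              ≈⟨ *-congʳ (ι-sub (natℚ d) (natℚ k)) ⟨
            ι (natℚ d ℚ.- natℚ k) * (c 0 * phase (suc k) * v k y) ∎)

        phase-ray : ∀ k → k ℕ.≤ d → ∀ y → c k * v k y ≈ c 0 * phase k * v k y
        phase-ray zero          _   y = *-congʳ (sym (*-identityʳ (c 0)))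
        -- The recurrence has order two, so index 1 is a second base case; there the lower neighbour
        -- comes with the coefficient 0.
        phase-ray (suc zero)    k<d = phase-step 0 k<d
          (raised-component 0 (phase-ray 0 z≤n)) (phase-ray 0 z≤n)
        phase-ray (suc (suc k)) k<d = phase-step (suc k) k<d
          (raised-component (suc k) (phase-ray k (ℕₚ.≤-trans (ℕₚ.n≤1+n k) (ℕₚ.<⇒≤ k<d))))
          (phase-ray (suc k) (ℕₚ.<⇒≤ k<d))

        phase-comb : comb c ≈ᵛ c 0 • comb phase
        phase-comb y = begin
          comb c y
            ≈⟨ ∑<-cong (suc d) (λ k k<1+d → trans (phase-ray k (ℕₚ.≤-pred k<1+d) y) (*-assoc (c 0) (phase k) (v k y))) ⟩
          ∑< (suc d) (λ k → c 0 * (phase k * v k y))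
            ≈⟨ ∑<-*ˡ (suc d) (c 0) (λ k → phase k * v k y) ⟩
          c 0 * comb phase y ∎

    -- For `k > 0`, moving the outermost `R` of `v k` to the other side turns it into `L`, which
    -- kills `u`.
    pairing-u : ∀ c → ⟪ comb c , u ⟫ ≈ c 0 * ⟪ u , u ⟫
    pairing-u c = begin
      ⟪ comb c , u ⟫
        ≈⟨ ⟪⟫-functional u (suc d) c v ⟩
      ∑< (suc d) (λ k → c k * ⟪ v k , u ⟫)
        ≈⟨ ∑<-single (suc d) 0 {λ k → c k * ⟪ v k , u ⟫} (s≤s z≤n) vanishes ⟩
      c 0 * ⟪ u , u ⟫ ∎
      where
      vanishes : ∀ k → k ℕ.< suc d → k ≢ 0 → c k * ⟪ v k , u ⟫ ≈ 0#
      vanishes zero    _ k≢0 = contradiction ≡.refl k≢0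
      vanishes (suc k) _ _   = trans (*-congˡ (begin
        ⟪ v (suc k) , u ⟫              ≈⟨ hermitian (v (suc k)) u ⟩
        conj ⟪ u , v (suc k) ⟫         ≈⟨ conj-cong (⟪⟫-scaleʳ (inv k) (fun R (v k)) u) ⟩
        conj (conj (inv k) * ⟪ u , fun R (v k) ⟫)
          ≈⟨ conj-cong (*-congˡ (trans (adjR u (v k)) (⟪0,⟫ (v k) highest-u))) ⟩
        conj (conj (inv k) * 0#)       ≈⟨ conj-cong (zeroʳ _) ⟩
        conj 0#                        ≈⟨ conj-0 ⟩
        0#                             ∎)) (zeroʳ (c (suc k)))

    -- The induction on `j` runs over all coefficient sequences at once: moving one `R` across the
    -- form replaces `c` by `lowered c`. The factor `d - j` so produced is absorbed into the
    -- binomial coefficient.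
    pairing : ∀ j c → ⟪ comb c , v j ⟫ ≈ ι (binomial d j) * c j * ⟪ u , u ⟫
    pairing zero c = trans (pairing-u c)
      (*-congʳ (sym (trans (*-congʳ (trans (ι-cong (binomial-zero d)) gauss-1)) (*-identityˡ (c 0)))))
    pairing (suc j) c = begin
      ⟪ comb c , inv j • fun R (v j) ⟫
        ≈⟨ ⟪⟫-scaleʳ (inv j) (fun R (v j)) (comb c) ⟩
      conj (inv j) * ⟪ comb c , fun R (v j) ⟫
        ≈⟨ *-cong (conj-ι (1ℚ ÷₀ natℚ (suc j))) (trans (adjR (comb c) (v j)) (⟪⟫-cong (L-comb c) (λ _ → refl))) ⟩
      inv j * ⟪ comb (lowered c) , v j ⟫
        ≈⟨ *-congˡ (pairing j (lowered c)) ⟩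
      inv j * (ι (binomial d j) * ((nat d - nat j) * c (suc j)) * N)
        ≈⟨ *-congˡ (solve 5 (λ b d j c n → b :* ((d :- j) :* c) :* n := (d :- j) :* b :* (c :* n)) refl
             (ι (binomial d j)) (nat d) (nat j) (c (suc j)) N) ⟩
      inv j * ((nat d - nat j) * ι (binomial d j) * (c (suc j) * N))
        ≈⟨ *-congˡ (*-congʳ absorb) ⟩
      inv j * (nat (suc j) * ι (binomial d (suc j)) * (c (suc j) * N))
        ≈⟨ *-congˡ (*-assoc _ _ _) ⟩
      inv j * (nat (suc j) * (ι (binomial d (suc j)) * (c (suc j) * N)))
        ≈⟨ inv-cancel j _ ⟩
      ι (binomial d (suc j)) * (c (suc j) * N)
        ≈⟨ *-assoc _ _ _ ⟨
      ι (binomial d (suc j)) * c (suc j) * N ∎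
      where
      N : Carrier
      N = ⟪ u , u ⟫
      absorb : (nat d - nat j) * ι (binomial d j) ≈ nat (suc j) * ι (binomial d (suc j))
      absorb = begin
        (nat d - nat j) * ι (binomial d j)          ≈⟨ *-congʳ (ι-sub (natℚ d) (natℚ j)) ⟨
        ι (natℚ d ℚ.- natℚ j) * ι (binomial d j)    ≈⟨ ι-* (natℚ d ℚ.- natℚ j) (binomial d j) ⟨
        ι ((natℚ d ℚ.- natℚ j) ℚ.* binomial d j)    ≈⟨ ι-cong (≡.sym (binomial-absorb d j)) ⟩
        ι (natℚ (suc j) ℚ.* binomial d (suc j))     ≈⟨ ι-* (natℚ (suc j)) (binomial d (suc j)) ⟩
        nat (suc j) * ι (binomial d (suc j))        ∎

    -- The coefficients, as functions of `j`, are the Krawtchouk polynomials with parameter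
    -- `p = 1/2`, normalised to 1 at `j = 0`.
    krawtchouk : ℕ → Vect
    krawtchouk i = comb (λ j → ι (₂F₁ i j d))

    krawtchouk-eigen : ∀ i → i ℕ.≤ d → fun A₁ (krawtchouk i) ≈ᵛ (nat d + -2ₖ * nat i) • krawtchouk i
    krawtchouk-eigen i i≤d y = begin
      fun A₁ (krawtchouk i) y
        ≈⟨ A₁-comb F y ⟩
      comb (λ j → raised F j + lowered F j) y
        ≈⟨ comb-cong {λ j → raised F j + lowered F j} {λ j → (nat d + -2ₖ * nat i) * F j} (λ j _ → recurrence j) y ⟩
      comb (λ j → (nat d + -2ₖ * nat i) * F j) y
        ≈⟨ comb-scale (nat d + -2ₖ * nat i) F y ⟨
      (nat d + -2ₖ * nat i) * krawtchouk i y ∎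
      where
      F : ℕ → Carrier
      F j = ι (₂F₁ i j d)
      recurrence : ∀ j → raised F j + lowered F j ≈ (nat d + -2ₖ * nat i) * F j
      recurrence j = begin
        nat j * F (ℕ.pred j) + (nat d - nat j) * F (suc j)
          ≈⟨ +-cong (sym (ι-* (natℚ j) (₂F₁ i (ℕ.pred j) d)))
               (trans (*-congʳ (sym (ι-sub (natℚ d) (natℚ j)))) (sym (ι-* (natℚ d ℚ.- natℚ j) (₂F₁ i (suc j) d)))) ⟩
        ι (natℚ j ℚ.* ₂F₁ i (ℕ.pred j) d) + ι ((natℚ d ℚ.- natℚ j) ℚ.* ₂F₁ i (suc j) d)
          ≈⟨ ι-+ (natℚ j ℚ.* ₂F₁ i (ℕ.pred j) d) ((natℚ d ℚ.- natℚ j) ℚ.* ₂F₁ i (suc j) d) ⟨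
        ι (natℚ j ℚ.* ₂F₁ i (ℕ.pred j) d ℚ.+ (natℚ d ℚ.- natℚ j) ℚ.* ₂F₁ i (suc j) d)
          ≈⟨ ι-cong (≡.sym (₂F₁-recurrence d i j i≤d)) ⟩
        ι ((natℚ d ℚ.- 2ℚ ℚ.* natℚ i) ℚ.* ₂F₁ i j d)
          ≈⟨ ι-* (natℚ d ℚ.- 2ℚ ℚ.* natℚ i) (₂F₁ i j d) ⟩
        ι (natℚ d ℚ.- 2ℚ ℚ.* natℚ i) * F j
          ≈⟨ *-congʳ (trans (ι-sub (natℚ d) (2ℚ ℚ.* natℚ i)) (+-congˡ (-‿cong (ι-* 2ℚ (natℚ i))))) ⟩
        (nat d - 2ₖ * nat i) * F j
          ≈⟨ solve 3 (λ d i f → (d :- :2 :* i) :* f := (d :+ :-2 :* i) :* f) refl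
               (nat d) (nat i) (F j) ⟩
        (nat d + -2ₖ * nat i) * F j ∎

    -- The coordinates of `u` with respect to the `A₁`-eigenvectors `krawtchouk i`. The power of `½`
    -- compensates for the total `2ᵈ` of the binomial coefficients, which is the coefficient of
    -- `v 0` in the unscaled sum.
    κ : ℕ → Carrier
    κ i = ι (½ ^ℚ d) * ι (binomial d i)

    u-krawtchouk : ∀ y → ∑< (suc d) (λ i → κ i * krawtchouk i y) ≈ u y
    u-krawtchouk y = begin
      ∑< (suc d) (λ i → κ i * krawtchouk i y)
        ≈⟨ ∑<-cong (suc d) (λ i _ → comb-scale (κ i) (F i) y) ⟩
      ∑< (suc d) (λ i → ∑< (suc d) (λ j → κ i * F i j * v j y))
        ≈⟨ ∑<-comm (suc d) (suc d) (λ i j → κ i * F i j * v j y) ⟩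
      ∑< (suc d) (λ j → ∑< (suc d) (λ i → κ i * F i j * v j y))
        ≈⟨ ∑<-cong (suc d) (λ j _ → collect j) ⟩
      comb (λ j → ι ((½ ^ℚ d) ℚ.* S j)) y
        ≈⟨ comb-u (λ j → ι ((½ ^ℚ d) ℚ.* S j))
             (trans (ι-cong (≡.trans (≡.cong ((½ ^ℚ d) ℚ.*_) (₂F₁-total d)) (half-power d))) gauss-1)
             (λ j j<d → trans (ι-cong (≡.trans (≡.cong ((½ ^ℚ d) ℚ.*_) (₂F₁-orthogonality d j j<d)) (ℚₚ.*-zeroʳ (½ ^ℚ d))))
                gauss-0) y ⟩
      u y ∎
      where
      F : ℕ → ℕ → Carrier
      F i j = ι (₂F₁ i j d)
      S : ℕ → ℚ
      S j = ∑<ℚ (suc d) (λ i → binomial d i ℚ.* ₂F₁ i j d)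
      collect : ∀ j → ∑< (suc d) (λ i → κ i * F i j * v j y) ≈ ι ((½ ^ℚ d) ℚ.* S j) * v j y
      collect j = begin
        ∑< (suc d) (λ i → κ i * F i j * v j y)
          ≈⟨ ∑<-cong (suc d) (λ i _ → trans
               (solve 4 (λ h b f x → h :* b :* f :* x := h :* x :* (b :* f)) refl (ι (½ ^ℚ d)) (ι (binomial d i)) (F i j) (v j y))
               (*-congˡ (sym (ι-* (binomial d i) (₂F₁ i j d))))) ⟩
        ∑< (suc d) (λ i → ι (½ ^ℚ d) * v j y * ι (binomial d i ℚ.* ₂F₁ i j d))
          ≈⟨ ∑<-*ˡ (suc d) (ι (½ ^ℚ d) * v j y) (λ i → ι (binomial d i ℚ.* ₂F₁ i j d)) ⟩
        ι (½ ^ℚ d) * v j y * ∑< (suc d) (λ i → ι (binomial d i ℚ.* ₂F₁ i j d))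
          ≈⟨ *-congˡ (ι-∑< (suc d) (λ i → binomial d i ℚ.* ₂F₁ i j d)) ⟨
        ι (½ ^ℚ d) * v j y * ι (S j)
          ≈⟨ solve 3 (λ h x s → h :* x :* s := h :* s :* x) refl (ι (½ ^ℚ d)) (v j y) (ι (S j)) ⟩
        ι (½ ^ℚ d) * ι (S j) * v j y
          ≈⟨ *-congʳ (ι-* (½ ^ℚ d) (S j)) ⟨
        ι ((½ ^ℚ d) ℚ.* S j) * v j y ∎

    module _ (axis₁ : Axis A₁ d) where
      open Axis axis₁

      proj-u : ∀ i → i ℕ.≤ d → fun (proj i) u ≈ᵛ κ i • krawtchouk i
      proj-u i i≤d y = begin
        fun (proj i) u y
          ≈⟨ fcong (proj i) (λ y → sym (u-krawtchouk y)) y ⟩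
        fun (proj i) (λ y → ∑< (suc d) (λ l → κ l * krawtchouk l y)) y
          ≈⟨ sums (proj i) (suc d) κ krawtchouk y ⟩
        ∑< (suc d) (λ l → κ l * fun (proj i) (krawtchouk l) y)
          ≈⟨ ∑<-single (suc d) i (s≤s i≤d) (λ l l<1+d l≢i → trans
               (*-congˡ (reject (krawtchouk l) l i (ℕₚ.≤-pred l<1+d) i≤d l≢i (krawtchouk-eigen l (ℕₚ.≤-pred l<1+d)) y))
               (zeroʳ (κ l))) ⟩
        κ i * fun (proj i) (krawtchouk i) y
          ≈⟨ *-congˡ (select (krawtchouk i) i i≤d (krawtchouk-eigen i i≤d) y) ⟩
        κ i * krawtchouk i y ∎

    conj-phase : ∀ j → conj (phase j) ≈ 𝐢 ^ j
    conj-phase zero    = trans (conj-cong (sym gauss-1)) (trans (conj-ι 1ℚ) gauss-1)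
    conj-phase (suc j) = trans (conj-* -𝐢 (phase j)) (*-cong (conj-gauss 0ℚ (ℚ.- 1ℚ)) (conj-phase j))

    -- The projections are explicit: a multiple of `krawtchouk i` on the left and of `v j` on the
    -- right, so `pairing` evaluates the form. Conjugation in the second argument turns the phase
    -- `(-𝐢)ʲ` of `w` into `𝐢ʲ`.
    inner-product-formula : (axis₁ : Axis A₁ d) (axis₂ : Axis A₂ d) →
      ∀ w (c : ℕ → Carrier) → w ≈ᵛ comb c → fun A₃ w ≈ᵛ nat d • w →
      ∀ i j → i ℕ.≤ d → j ℕ.≤ d →
      ⟪ fun (Axis.proj axis₁ i) u , fun (Axis.proj axis₂ j) w ⟫
        ≈ 𝐢 ^ j * ι (½ ^ℚ d) * ⟪ u , w ⟫ * ι (binomial d i) * ι (binomial d j) * ι (₂F₁ i j d)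
    inner-product-formula axis₁ axis₂ w c w≈ w-eigen i j i≤d j≤d = begin
      ⟪ fun (Axis.proj axis₁ i) u , fun (Axis.proj axis₂ j) w ⟫
        ≈⟨ ⟪⟫-cong (proj-u axis₁ i i≤d) proj-w ⟩
      ⟪ κ i • krawtchouk i , (c 0 * phase j) • v j ⟫
        ≈⟨ trans (⟪⟫-scaleˡ (κ i) (krawtchouk i) ((c 0 * phase j) • v j)) (*-congˡ (⟪⟫-scaleʳ (c 0 * phase j) (v j) (krawtchouk i))) ⟩
      κ i * (conj (c 0 * phase j) * ⟪ krawtchouk i , v j ⟫)
        ≈⟨ *-congˡ (*-cong (trans (conj-* (c 0) (phase j)) (*-congˡ (conj-phase j))) (pairing j (λ j → ι (₂F₁ i j d)))) ⟩
      κ i * ((conj (c 0) * 𝐢 ^ j) * (ι (binomial d j) * ι (₂F₁ i j d) * ⟪ u , u ⟫))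
        ≈⟨ solve 7 (λ h bi c p bj f n → h :* bi :* ((c :* p) :* (bj :* f :* n)) := p :* h :* (c :* n) :* bi :* bj :* f) refl
             (ι (½ ^ℚ d)) (ι (binomial d i)) (conj (c 0)) (𝐢 ^ j) (ι (binomial d j)) (ι (₂F₁ i j d)) ⟪ u , u ⟫ ⟩
      𝐢 ^ j * ι (½ ^ℚ d) * (conj (c 0) * ⟪ u , u ⟫) * ι (binomial d i) * ι (binomial d j) * ι (₂F₁ i j d)
        ≈⟨ *-congʳ (*-congʳ (*-congʳ (*-congˡ (sym ⟪u,w⟫)))) ⟩
      𝐢 ^ j * ι (½ ^ℚ d) * ⟪ u , w ⟫ * ι (binomial d i) * ι (binomial d j) * ι (₂F₁ i j d) ∎
      where
      eigen : fun A₃ (comb c) ≈ᵛ nat d • comb c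
      eigen y = trans (sym (fcong A₃ w≈ y)) (trans (w-eigen y) (*-congˡ (w≈ y)))
      proj-w : fun (Axis.proj axis₂ j) w ≈ᵛ (c 0 * phase j) • v j
      proj-w y = trans (fcong (Axis.proj axis₂ j) w≈ y)
        (trans (proj-comb axis₂ j j≤d c y) (phase-ray axis₂ c eigen j j≤d y))
      -- Since `u` is orthogonal to every other string vector, only the leading coefficient of `w`
      -- is seen; this eliminates the unknown `c 0` in favour of `⟪ u , w ⟫`.
      ⟪u,w⟫ : ⟪ u , w ⟫ ≈ conj (c 0) * ⟪ u , u ⟫
      ⟪u,w⟫ = begin
        ⟪ u , w ⟫                             ≈⟨ ⟪⟫-cong (λ _ → refl) (λ y → trans (w≈ y) (phase-comb axis₂ c eigen y)) ⟩
        ⟪ u , c 0 • comb phase ⟫              ≈⟨ ⟪⟫-scaleʳ (c 0) (comb phase) u ⟩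
        conj (c 0) * ⟪ u , comb phase ⟫       ≈⟨ *-congˡ (hermitian u (comb phase)) ⟩
        conj (c 0) * conj ⟪ comb phase , u ⟫  ≈⟨ *-congˡ (conj-cong (trans (pairing-u phase) (*-identityˡ ⟪ u , u ⟫))) ⟩
        conj (c 0) * conj ⟪ u , u ⟫           ≈⟨ *-congˡ (hermitian u u) ⟨
        conj (c 0) * ⟪ u , u ⟫                ∎

    rotated-highest : Axis A₂ d → ∀ w (c : ℕ → Carrier) → w ≈ᵛ comb c → fun A₃ w ≈ᵛ nat d • w →
      fun (Ladder.L form (rotate t)) w ≈ᵛ 0ᵛ
    rotated-highest axis₂ w c w≈ w-eigen y = begin
      fun L′ w y                        ≈⟨ fcong L′ (λ y → trans (w≈ y) (phase-comb axis₂ c eigen y)) y ⟩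
      fun L′ (c 0 • comb phase) y       ≈⟨ scale L′ (c 0) (comb phase) y ⟩
      c 0 * fun L′ (comb phase) y       ≈⟨ *-congˡ (phase-highest y) ⟩
      c 0 * 0#                          ≈⟨ zeroʳ (c 0) ⟩
      0#                                ∎
      where
      L′ : Linear
      L′ = Ladder.L form (rotate t)
      eigen : fun A₃ (comb c) ≈ᵛ nat d • comb c
      eigen y = trans (sym (fcong A₃ w≈ y)) (trans (w-eigen y) (*-congˡ (w≈ y)))

-- The D-cube

hamming-refl : ∀ {D} (y : X D) → hamming y y ≡ 0
hamming-refl []             = ≡.refl
hamming-refl (zero ∷ y)     = hamming-refl y
hamming-refl (1F ∷ y) = hamming-refl y

hamming≡0 : ∀ {D} (y z : X D) → hamming y z ≡ 0 → y ≡ z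
hamming≡0 []             []             _ = ≡.refl
hamming≡0 (zero ∷ y)     (zero ∷ z)     h = ≡.cong (zero ∷_) (hamming≡0 y z h)
hamming≡0 (1F ∷ y) (1F ∷ z) h = ≡.cong (1F ∷_) (hamming≡0 y z h)

weight≤ : ∀ {D} (y : X D) → ∂ (origin D) y ℕ.≤ D
weight≤ []             = z≤n
weight≤ (zero ∷ y)     = ℕₚ.m≤n⇒m≤1+n (weight≤ y)
weight≤ (1F ∷ y) = s≤s (weight≤ y)

-- The sum enters through its recursion alone, which keeps the concrete summation of complex numbers
-- opaque in what follows.
record CubeSum (K : Scalars) : Set where
  open Scalars K
  field
    ∑      : ∀ {D} → (X D → Carrier) → Carrier
    ∑-nil  : ∀ (f : X 0 → Carrier) → ∑ f ≈ f []
    ∑-cons : ∀ {D} (f : X (suc D) → Carrier) → ∑ f ≈ ∑ (f ∘ (zero ∷_)) + ∑ (f ∘ (1F ∷_))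

module CubeTheory (K : Scalars) (S : CubeSum K) where
  open ScalarTheory K
  open CubeSum S
  open import Data.List.Membership.Propositional using (_∈_)
  open import Data.List.Membership.Propositional.Properties using (∈-filter⁺; ∈-upTo⁺)
  open import Data.List.Relation.Unary.All using (All; []; _∷_)
  open import Data.List.Relation.Unary.All.Properties using (all-filter)
  open import Data.List.Relation.Unary.Any using (here; there)
  open import Relation.Binary.Reasoning.Setoid setoid

  ∑-cong : ∀ {D} {f g : X D → Carrier} → (∀ y → f y ≈ g y) → ∑ f ≈ ∑ g
  ∑-cong {zero}  {f} {g} h = trans (∑-nil f) (trans (h []) (sym (∑-nil g)))
  ∑-cong {suc D} {f} {g} h = trans (∑-cons f)
    (trans (+-cong (∑-cong (h ∘ (zero ∷_))) (∑-cong (h ∘ (1F ∷_)))) (sym (∑-cons g)))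

  ∑-linear : ∀ {D} a b (f g : X D → Carrier) → ∑ (λ y → a * f y + b * g y) ≈ a * ∑ f + b * ∑ g
  ∑-linear {zero}  a b f g = trans (∑-nil _) (+-cong (*-congˡ (sym (∑-nil f))) (*-congˡ (sym (∑-nil g))))
  ∑-linear {suc D} a b f g = begin
    ∑ (λ y → a * f y + b * g y)
      ≈⟨ ∑-cons _ ⟩
    ∑ (λ y → a * f (zero ∷ y) + b * g (zero ∷ y)) + ∑ (λ y → a * f (1F ∷ y) + b * g (1F ∷ y))
      ≈⟨ +-cong (∑-linear a b f₀ g₀) (∑-linear a b f₁ g₁) ⟩
    (a * ∑ f₀ + b * ∑ g₀) + (a * ∑ f₁ + b * ∑ g₁)
      ≈⟨ solve 6 (λ a b x y z u → (a :* x :+ b :* y) :+ (a :* z :+ b :* u) := a :* (x :+ z) :+ b :* (y :+ u)) refl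
           a b (∑ f₀) (∑ g₀) (∑ f₁) (∑ g₁) ⟩
    a * (∑ f₀ + ∑ f₁) + b * (∑ g₀ + ∑ g₁)
      ≈⟨ +-cong (*-congˡ (∑-cons f)) (*-congˡ (∑-cons g)) ⟨
    a * ∑ f + b * ∑ g ∎
    where
    f₀ f₁ g₀ g₁ : X D → Carrier
    f₀ = f ∘ (zero ∷_)
    f₁ = f ∘ (1F ∷_)
    g₀ = g ∘ (zero ∷_)
    g₁ = g ∘ (1F ∷_)

  ∑-*ˡ : ∀ {D} a (f : X D → Carrier) → ∑ (λ y → a * f y) ≈ a * ∑ f
  ∑-*ˡ a f = trans (∑-cong (λ y → solve 2 (λ a x → a :* x := a :* x :+ :0 :* x) refl a (f y)))
    (trans (∑-linear a (gauss (0ℚ , 0ℚ)) f f)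
      (solve 2 (λ a x → a :* x :+ :0 :* x := a :* x) refl a (∑ f)))

  ∑-+ : ∀ {D} (f g : X D → Carrier) → ∑ (λ y → f y + g y) ≈ ∑ f + ∑ g
  ∑-+ f g = trans (∑-cong (λ y → sym (+-cong (*-identityˡ (f y)) (*-identityˡ (g y)))))
    (trans (∑-linear 1# 1# f g) (+-cong (*-identityˡ (∑ f)) (*-identityˡ (∑ g))))

  ∑-zero : ∀ {D} {f : X D → Carrier} → (∀ y → f y ≈ 0#) → ∑ f ≈ 0#
  ∑-zero {D} {f} h = trans (∑-cong (λ y → trans (h y) (sym (zeroˡ (f y))))) (trans (∑-*ˡ 0# f) (zeroˡ (∑ f)))

  ∑-single : ∀ {D} y (f : X D → Carrier) → (∀ z → z ≢ y → f z ≈ 0#) → ∑ f ≈ f y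
  ∑-single []             f h = ∑-nil f
  ∑-single (zero ∷ y)     f h = trans (∑-cons f) (trans
    (+-cong (∑-single y (f ∘ (zero ∷_)) (λ z z≢y → h (zero ∷ z) λ { ≡.refl → z≢y ≡.refl }))
            (∑-zero (λ z → h (1F ∷ z) λ ()))) (+-identityʳ _))
  ∑-single (1F ∷ y) f h = trans (∑-cons f) (trans
    (+-cong (∑-zero (λ z → h (zero ∷ z) λ ()))
            (∑-single y (f ∘ (1F ∷_)) (λ z z≢y → h (1F ∷ z) λ { ≡.refl → z≢y ≡.refl }))) (+-identityˡ _))

  ∑-comm : ∀ {D D′} (f : X D → X D′ → Carrier) → ∑ (λ y → ∑ (f y)) ≈ ∑ (λ z → ∑ (λ y → f y z))
  ∑-comm {zero}  f = trans (∑-nil _) (∑-cong (λ z → sym (∑-nil _)))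
  ∑-comm {suc D} f = begin
    ∑ (λ y → ∑ (f y))
      ≈⟨ ∑-cons _ ⟩
    ∑ (λ y → ∑ (f (zero ∷ y))) + ∑ (λ y → ∑ (f (1F ∷ y)))
      ≈⟨ +-cong (∑-comm (f ∘ (zero ∷_))) (∑-comm (f ∘ (1F ∷_))) ⟩
    ∑ (λ z → ∑ (λ y → f (zero ∷ y) z)) + ∑ (λ z → ∑ (λ y → f (1F ∷ y) z))
      ≈⟨ ∑-+ _ _ ⟨
    ∑ (λ z → ∑ (λ y → f (zero ∷ y) z) + ∑ (λ y → f (1F ∷ y) z))
      ≈⟨ ∑-cong (λ z → sym (∑-cons (λ y → f y z))) ⟩
    ∑ (λ z → ∑ (λ y → f y z)) ∎

  conj-∑ : ∀ {D} (f : X D → Carrier) → conj (∑ f) ≈ ∑ (λ y → conj (f y))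
  conj-∑ {zero}  f = trans (conj-cong (∑-nil f)) (sym (∑-nil _))
  conj-∑ {suc D} f = trans (conj-cong (∑-cons f)) (trans (conj-+ _ _)
    (trans (+-cong (conj-∑ (f ∘ (zero ∷_))) (conj-∑ (f ∘ (1F ∷_)))) (sym (∑-cons _))))

  open Vectors using (Linear; Form; Triple; fun; fcong; linear; affine)

  cubeForm : ∀ D → Form K (X D)
  cubeForm D = record
    { ⟪_,_⟫     = λ v w → ∑ (λ y → v y * conj (w y))
    ; ⟪⟫-cong   = λ p q → ∑-cong (λ y → *-cong (p y) (conj-cong (q y)))
    ; ⟪⟫-linear = λ a b v w x → trans
        (∑-cong (λ y → solve 5 (λ a b v w x → (a :* v :+ b :* w) :* x := a :* (v :* x) :+ b :* (w :* x)) refl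
          a b (v y) (w y) (conj (x y))))
        (∑-linear a b (λ y → v y * conj (x y)) (λ y → w y * conj (x y)))
    ; hermitian = λ v w → sym (trans (conj-∑ _) (∑-cong (λ y →
        trans (conj-* _ _) (trans (*-congˡ (conj-conj (v y))) (*-comm _ _)))))
    }

  ⟪_,_⟫ : ∀ {D} → (X D → Carrier) → (X D → Carrier) → Carrier
  ⟪_,_⟫ {D} = Form.⟪_,_⟫ (cubeForm D)

  -- Operators built from 2×2 matrices on the tensor factors

  M₂ : Set
  M₂ = Fin 2 → Fin 2 → Carrier

  infixl 7 _⊗_
  -- Despite the symbol, this is the ordinary product of 2×2 matrices, not a tensor product.
  _⊗_ : M₂ → M₂ → M₂
  (m ⊗ n) a b = m a 0F * n 0F b + m a 1F * n 1F b

  -- der m = Σₖ 1 ⊗ ⋯ ⊗ m ⊗ ⋯ ⊗ 1, with m in the k-th of the D tensor factors,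
  -- and kron p = p ⊗ ⋯ ⊗ p.
  der : M₂ → ∀ {D} → (X D → Carrier) → X D → Carrier
  der m v []      = 0#
  der m v (a ∷ y) = der m (v ∘ (a ∷_)) y + (m a 0F * v (0F ∷ y) + m a 1F * v (1F ∷ y))

  kron : M₂ → ∀ {D} → (X D → Carrier) → X D → Carrier
  kron p v []      = v []
  kron p v (a ∷ y) = p a 0F * kron p (v ∘ (0F ∷_)) y + p a 1F * kron p (v ∘ (1F ∷_)) y

  derᴸ : M₂ → ∀ D → Linear K (X D)
  derᴸ m D = record { fun = der m ; fcong = cong ; linear = lin }
    where
    cong : ∀ {D} {v w : X D → Carrier} → (∀ y → v y ≈ w y) → ∀ y → der m v y ≈ der m w y
    cong v≈w []      = refl
    cong v≈w (a ∷ y) = +-cong (cong (v≈w ∘ (a ∷_)) y) (+-cong (*-congˡ (v≈w _)) (*-congˡ (v≈w _)))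
    lin : ∀ {D} a b (v w : X D → Carrier) y → der m (λ y → a * v y + b * w y) y ≈ a * der m v y + b * der m w y
    lin a b v w []      = sym (trans (+-cong (zeroʳ a) (zeroʳ b)) (+-identityˡ 0#))
    lin a b v w (c ∷ y) = trans (+-congʳ (lin a b (v ∘ (c ∷_)) (w ∘ (c ∷_)) y))
      (solve 10 (λ a b p q v w v₀ v₁ w₀ w₁ →
        (a :* v :+ b :* w) :+ (p :* (a :* v₀ :+ b :* w₀) :+ q :* (a :* v₁ :+ b :* w₁))
        := a :* (v :+ (p :* v₀ :+ q :* v₁)) :+ b :* (w :+ (p :* w₀ :+ q :* w₁))) refl
        a b (m c 0F) (m c 1F) (der m (v ∘ (c ∷_)) y) (der m (w ∘ (c ∷_)) y)
        (v (0F ∷ y)) (v (1F ∷ y)) (w (0F ∷ y)) (w (1F ∷ y)))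

  kronᴸ : M₂ → ∀ D → Linear K (X D)
  kronᴸ p D = record { fun = kron p ; fcong = cong ; linear = lin }
    where
    cong : ∀ {D} {v w : X D → Carrier} → (∀ y → v y ≈ w y) → ∀ y → kron p v y ≈ kron p w y
    cong v≈w []      = v≈w []
    cong v≈w (a ∷ y) = +-cong (*-congˡ (cong (v≈w ∘ (0F ∷_)) y)) (*-congˡ (cong (v≈w ∘ (1F ∷_)) y))
    lin : ∀ {D} a b (v w : X D → Carrier) y → kron p (λ y → a * v y + b * w y) y ≈ a * kron p v y + b * kron p w y
    lin a b v w []      = refl
    lin a b v w (c ∷ y) = trans
      (+-cong (*-congˡ (lin a b (v ∘ (0F ∷_)) (w ∘ (0F ∷_)) y)) (*-congˡ (lin a b (v ∘ (1F ∷_)) (w ∘ (1F ∷_)) y)))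
      (solve 8 (λ a b p q v₀ v₁ w₀ w₁ →
        p :* (a :* v₀ :+ b :* w₀) :+ q :* (a :* v₁ :+ b :* w₁)
        := a :* (p :* v₀ :+ q :* v₁) :+ b :* (p :* w₀ :+ q :* w₁)) refl
        a b (p c 0F) (p c 1F) (kron p (v ∘ (0F ∷_)) y) (kron p (v ∘ (1F ∷_)) y)
        (kron p (w ∘ (0F ∷_)) y) (kron p (w ∘ (1F ∷_)) y))

  -- Matrices in different tensor factors commute, so only commutators within one factor survive. In
  -- the induction, `cross n m` collects the terms with `n` in the first factor and `m` in another
  -- one; together with `cross m n` it is symmetric and drops out.
  der-commutator : ∀ m n q s → (∀ a b → (m ⊗ n) a b ≈ (n ⊗ m) a b + s * q a b) →
    ∀ {D} (v : X D → Carrier) y → der m (der n v) y ≈ der n (der m v) y + s * der q v y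
  der-commutator m n q s h v []      = sym (trans (+-identityˡ _) (zeroʳ s))
  der-commutator m n q s h {suc D} v (a ∷ y) = begin
    der m (λ y → der n vₐ y + (n a 0F * v₀ y + n a 1F * v₁ y)) y
      + (m a 0F * (der n v₀ y + (n 0F 0F * x₀ + n 0F 1F * x₁))
        + m a 1F * (der n v₁ y + (n 1F 0F * x₀ + n 1F 1F * x₁)))
      ≈⟨ +-congʳ (affine (derᴸ m D) (n a 0F) (n a 1F) (der n vₐ) v₀ v₁ y) ⟩
    (der m (der n vₐ) y + cross n m)
      + (m a 0F * (der n v₀ y + (n 0F 0F * x₀ + n 0F 1F * x₁))
        + m a 1F * (der n v₁ y + (n 1F 0F * x₀ + n 1F 1F * x₁)))
      ≈⟨ regroup (der m (der n vₐ) y) (cross n m) (m a 0F) (m a 1F) (der n v₀ y) (der n v₁ y)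
           (n 0F 0F) (n 0F 1F) (n 1F 0F) (n 1F 1F) x₀ x₁ ⟩
    (der m (der n vₐ) y + (cross n m + cross m n)) + ((m ⊗ n) a 0F * x₀ + (m ⊗ n) a 1F * x₁)
      ≈⟨ +-cong (+-congʳ (der-commutator m n q s h vₐ y)) (+-cong (*-congʳ (h a 0F)) (*-congʳ (h a 1F))) ⟩
    ((der n (der m vₐ) y + s * der q vₐ y) + (cross n m + cross m n))
      + (((n ⊗ m) a 0F + s * q a 0F) * x₀ + ((n ⊗ m) a 1F + s * q a 1F) * x₁)
      ≈⟨ solve 11 (λ dd s dq c c′ k₀ k₁ q₀ q₁ x₀ x₁ →
           ((dd :+ s :* dq) :+ (c :+ c′)) :+ ((k₀ :+ s :* q₀) :* x₀ :+ (k₁ :+ s :* q₁) :* x₁)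
           := ((dd :+ (c′ :+ c)) :+ (k₀ :* x₀ :+ k₁ :* x₁)) :+ s :* (dq :+ (q₀ :* x₀ :+ q₁ :* x₁))) refl
           (der n (der m vₐ) y) s (der q vₐ y) (cross n m) (cross m n) ((n ⊗ m) a 0F) ((n ⊗ m) a 1F)
           (q a 0F) (q a 1F) x₀ x₁ ⟩
    ((der n (der m vₐ) y + (cross m n + cross n m)) + ((n ⊗ m) a 0F * x₀ + (n ⊗ m) a 1F * x₁))
      + s * der q v (a ∷ y)
      ≈⟨ +-congʳ (regroup (der n (der m vₐ) y) (cross m n) (n a 0F) (n a 1F) (der m v₀ y) (der m v₁ y)
           (m 0F 0F) (m 0F 1F) (m 1F 0F) (m 1F 1F) x₀ x₁) ⟨
    (der n (der m vₐ) y + cross m n)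
      + (n a 0F * (der m v₀ y + (m 0F 0F * x₀ + m 0F 1F * x₁))
        + n a 1F * (der m v₁ y + (m 1F 0F * x₀ + m 1F 1F * x₁)))
      + s * der q v (a ∷ y)
      ≈⟨ +-congʳ (+-congʳ (affine (derᴸ n D) (m a 0F) (m a 1F) (der m vₐ) v₀ v₁ y)) ⟨
    der n (der m v) (a ∷ y) + s * der q v (a ∷ y) ∎
    where
    v₀ v₁ vₐ : X D → Carrier
    v₀ = v ∘ (0F ∷_)
    v₁ = v ∘ (1F ∷_)
    vₐ = v ∘ (a ∷_)
    x₀ x₁ : Carrier
    x₀ = v₀ y
    x₁ = v₁ y
    cross : M₂ → M₂ → Carrier
    cross n m = n a 0F * der m v₀ y + n a 1F * der m v₁ y
    regroup : ∀ dd c m₀ m₁ d₀ d₁ n₀₀ n₀₁ n₁₀ n₁₁ x₀ x₁ →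
      (dd + c) + (m₀ * (d₀ + (n₀₀ * x₀ + n₀₁ * x₁)) + m₁ * (d₁ + (n₁₀ * x₀ + n₁₁ * x₁)))
      ≈ (dd + (c + (m₀ * d₀ + m₁ * d₁))) + ((m₀ * n₀₀ + m₁ * n₁₀) * x₀ + (m₀ * n₀₁ + m₁ * n₁₁) * x₁)
    regroup = solve 12 (λ dd c m₀ m₁ d₀ d₁ n₀₀ n₀₁ n₁₀ n₁₁ x₀ x₁ →
      (dd :+ c) :+ (m₀ :* (d₀ :+ (n₀₀ :* x₀ :+ n₀₁ :* x₁)) :+ m₁ :* (d₁ :+ (n₁₀ :* x₀ :+ n₁₁ :* x₁)))
      := (dd :+ (c :+ (m₀ :* d₀ :+ m₁ :* d₁))) :+ ((m₀ :* n₀₀ :+ m₁ :* n₁₀) :* x₀ :+ (m₀ :* n₀₁ :+ m₁ :* n₁₁) :* x₁)) refl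

  -- Passing a matrix in one position through `p ⊗ ⋯ ⊗ p` affects only the copy of `p` in that
  -- position.
  der-kron : ∀ m p m′ → (∀ a b → (m ⊗ p) a b ≈ (p ⊗ m′) a b) →
    ∀ {D} (v : X D → Carrier) y → der m (kron p v) y ≈ kron p (der m′ v) y
  der-kron m p m′ h v []      = refl
  der-kron m p m′ h {suc D} v (a ∷ y) = begin
    der m (λ y → p a 0F * kron p v₀ y + p a 1F * kron p v₁ y) y
      + (m a 0F * (p 0F 0F * x₀ + p 0F 1F * x₁)
        + m a 1F * (p 1F 0F * x₀ + p 1F 1F * x₁))
      ≈⟨ +-cong (linear (derᴸ m D) (p a 0F) (p a 1F) (kron p v₀) (kron p v₁) y)
           (expand (m a 0F) (m a 1F) (p 0F 0F) (p 0F 1F) (p 1F 0F) (p 1F 1F) x₀ x₁) ⟩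
    (p a 0F * der m (kron p v₀) y + p a 1F * der m (kron p v₁) y)
      + ((m ⊗ p) a 0F * x₀ + (m ⊗ p) a 1F * x₁)
      ≈⟨ +-cong (+-cong (*-congˡ (der-kron m p m′ h v₀ y)) (*-congˡ (der-kron m p m′ h v₁ y)))
           (+-cong (*-congʳ (h a 0F)) (*-congʳ (h a 1F))) ⟩
    (p a 0F * kron p (der m′ v₀) y + p a 1F * kron p (der m′ v₁) y)
      + ((p ⊗ m′) a 0F * x₀ + (p ⊗ m′) a 1F * x₁)
      ≈⟨ +-congˡ (expand (p a 0F) (p a 1F) (m′ 0F 0F) (m′ 0F 1F) (m′ 1F 0F) (m′ 1F 1F) x₀ x₁) ⟨
    (p a 0F * kron p (der m′ v₀) y + p a 1F * kron p (der m′ v₁) y)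
      + (p a 0F * (m′ 0F 0F * x₀ + m′ 0F 1F * x₁)
        + p a 1F * (m′ 1F 0F * x₀ + m′ 1F 1F * x₁))
      ≈⟨ solve 6 (λ p q d e f g → (p :* d :+ q :* e) :+ (p :* f :+ q :* g) := p :* (d :+ f) :+ q :* (e :+ g)) refl
           (p a 0F) (p a 1F) (kron p (der m′ v₀) y) (kron p (der m′ v₁) y)
           (m′ 0F 0F * x₀ + m′ 0F 1F * x₁) (m′ 1F 0F * x₀ + m′ 1F 1F * x₁) ⟩
    p a 0F * (kron p (der m′ v₀) y + (m′ 0F 0F * x₀ + m′ 0F 1F * x₁))
      + p a 1F * (kron p (der m′ v₁) y + (m′ 1F 0F * x₀ + m′ 1F 1F * x₁))
      ≈⟨ +-cong (*-congˡ (sym (affine (kronᴸ p D) (m′ 0F 0F) (m′ 0F 1F) (der m′ v₀) v₀ v₁ y)))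
                (*-congˡ (sym (affine (kronᴸ p D) (m′ 1F 0F) (m′ 1F 1F) (der m′ v₁) v₀ v₁ y))) ⟩
    kron p (der m′ v) (a ∷ y) ∎
    where
    v₀ v₁ : X D → Carrier
    v₀ = v ∘ (0F ∷_)
    v₁ = v ∘ (1F ∷_)
    x₀ x₁ : Carrier
    x₀ = kron p v₀ y
    x₁ = kron p v₁ y
    expand : ∀ m₀ m₁ p₀₀ p₀₁ p₁₀ p₁₁ x₀ x₁ →
      m₀ * (p₀₀ * x₀ + p₀₁ * x₁) + m₁ * (p₁₀ * x₀ + p₁₁ * x₁)
      ≈ (m₀ * p₀₀ + m₁ * p₁₀) * x₀ + (m₀ * p₀₁ + m₁ * p₁₁) * x₁
    expand = solve 8 (λ m₀ m₁ p₀₀ p₀₁ p₁₀ p₁₁ x₀ x₁ →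
      m₀ :* (p₀₀ :* x₀ :+ p₀₁ :* x₁) :+ m₁ :* (p₁₀ :* x₀ :+ p₁₁ :* x₁)
      := (m₀ :* p₀₀ :+ m₁ :* p₁₀) :* x₀ :+ (m₀ :* p₀₁ :+ m₁ :* p₁₁) :* x₁) refl

  der-selfAdjoint : ∀ m → (∀ a b → conj (m a b) ≈ m b a) →
    ∀ {D} (v w : X D → Carrier) → ⟪ der m v , w ⟫ ≈ ⟪ v , der m w ⟫
  der-selfAdjoint m h {zero} v w = trans (∑-nil _) (trans (zeroˡ _)
    (sym (trans (∑-nil _) (trans (*-congˡ conj-0) (zeroʳ _)))))
  der-selfAdjoint m h {suc D} v w = begin
    ⟪ der m v , w ⟫
      ≈⟨ ∑-cons _ ⟩
    ⟪ (λ y → der m v₀ y + (m 0F 0F * v₀ y + m 0F 1F * v₁ y)) , w₀ ⟫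
      + ⟪ (λ y → der m v₁ y + (m 1F 0F * v₀ y + m 1F 1F * v₁ y)) , w₁ ⟫
      ≈⟨ +-cong (F.⟪⟫-affine (m 0F 0F) (m 0F 1F) (der m v₀) v₀ v₁ w₀)
                (F.⟪⟫-affine (m 1F 0F) (m 1F 1F) (der m v₁) v₀ v₁ w₁) ⟩
    (⟪ der m v₀ , w₀ ⟫ + (m 0F 0F * ⟪ v₀ , w₀ ⟫ + m 0F 1F * ⟪ v₁ , w₀ ⟫))
      + (⟪ der m v₁ , w₁ ⟫ + (m 1F 0F * ⟪ v₀ , w₁ ⟫ + m 1F 1F * ⟪ v₁ , w₁ ⟫))
      ≈⟨ +-cong (+-cong (der-selfAdjoint m h v₀ w₀) (+-cong (*-congʳ (sym (h 0F 0F))) (*-congʳ (sym (h 1F 0F)))))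
                (+-cong (der-selfAdjoint m h v₁ w₁) (+-cong (*-congʳ (sym (h 0F 1F))) (*-congʳ (sym (h 1F 1F))))) ⟩
    (⟪ v₀ , der m w₀ ⟫ + (conj (m 0F 0F) * ⟪ v₀ , w₀ ⟫ + conj (m 1F 0F) * ⟪ v₁ , w₀ ⟫))
      + (⟪ v₁ , der m w₁ ⟫ + (conj (m 0F 1F) * ⟪ v₀ , w₁ ⟫ + conj (m 1F 1F) * ⟪ v₁ , w₁ ⟫))
      ≈⟨ solve 6 (λ a b c d e f → (a :+ (b :+ c)) :+ (d :+ (e :+ f)) := (a :+ (b :+ e)) :+ (d :+ (c :+ f))) refl _ _ _ _ _ _ ⟩
    (⟪ v₀ , der m w₀ ⟫ + (conj (m 0F 0F) * ⟪ v₀ , w₀ ⟫ + conj (m 0F 1F) * ⟪ v₀ , w₁ ⟫))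
      + (⟪ v₁ , der m w₁ ⟫ + (conj (m 1F 0F) * ⟪ v₁ , w₀ ⟫ + conj (m 1F 1F) * ⟪ v₁ , w₁ ⟫))
      ≈⟨ +-cong (F.⟪⟫-affineʳ (m 0F 0F) (m 0F 1F) (der m w₀) w₀ w₁ v₀)
                (F.⟪⟫-affineʳ (m 1F 0F) (m 1F 1F) (der m w₁) w₀ w₁ v₁) ⟨
    ⟪ v₀ , (λ y → der m w₀ y + (m 0F 0F * w₀ y + m 0F 1F * w₁ y)) ⟫
      + ⟪ v₁ , (λ y → der m w₁ y + (m 1F 0F * w₀ y + m 1F 1F * w₁ y)) ⟫
      ≈⟨ ∑-cons _ ⟨
    ⟪ v , der m w ⟫ ∎
    where
    module F = Form (cubeForm D)
    v₀ v₁ w₀ w₁ : X D → Carrier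
    v₀ = v ∘ (0F ∷_)
    v₁ = v ∘ (1F ∷_)
    w₀ = w ∘ (0F ∷_)
    w₁ = w ∘ (1F ∷_)

  module G = RawRing gaussianRationals

  infixl 7 _⊗ᴳ_
  _⊗ᴳ_ : (m n : Fin 2 → Fin 2 → ℚ × ℚ) → Fin 2 → Fin 2 → ℚ × ℚ
  (m ⊗ᴳ n) a b = (m a 0F G.* n 0F b) G.+ (m a 1F G.* n 1F b)

  ⟦_⟧ᴳ : (Fin 2 → Fin 2 → ℚ × ℚ) → M₂
  ⟦ m ⟧ᴳ a b = gauss (m a b)

  ⊗-gauss : ∀ m n a b → (⟦ m ⟧ᴳ ⊗ ⟦ n ⟧ᴳ) a b ≈ ⟦ m ⊗ᴳ n ⟧ᴳ a b
  ⊗-gauss m n a b = sym (trans (gauss-+ _ _ _ _) (+-cong (gauss-* _ _ _ _) (gauss-* _ _ _ _)))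

  -- Relations between the concrete matrices over `ℚ(𝐢)` have four decidable entries, so `from-yes`
  -- proves them by evaluation.
  _≟ᴳ_ : ∀ (m n : Fin 2 → Fin 2 → ℚ × ℚ) → Dec (∀ a b → m a b ≡ n a b)
  m ≟ᴳ n = Finₚ.all? λ a → Finₚ.all? λ b → ×-≡-dec ℚₚ._≟_ ℚₚ._≟_ (m a b) (n a b)

  -- sy is minus the customary Pauli matrix.
  sx sy sz p₁ : Fin 2 → Fin 2 → ℚ × ℚ
  sx 0F       0F       = 0ℚ , 0ℚ
  sx 0F       1F = 1ℚ , 0ℚ
  sx 1F 0F       = 1ℚ , 0ℚ
  sx 1F 1F = 0ℚ , 0ℚ
  sy 0F       0F       = 0ℚ , 0ℚ
  sy 0F       1F = 0ℚ , 1ℚ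
  sy 1F 0F       = 0ℚ , ℚ.- 1ℚ
  sy 1F 1F = 0ℚ , 0ℚ
  sz 0F       0F       = 1ℚ , 0ℚ
  sz 0F       1F = 0ℚ , 0ℚ
  sz 1F 0F       = 0ℚ , 0ℚ
  sz 1F 1F = ℚ.- 1ℚ , 0ℚ
  p₁ 0F       0F       = 1ℚ , 0ℚ
  p₁ 0F       1F = 1ℚ , 0ℚ
  p₁ 1F 0F       = 0ℚ , ℚ.- 1ℚ
  p₁ 1F 1F = 0ℚ , 1ℚ

  σx σy σz : M₂
  σx = ⟦ sx ⟧ᴳ
  σy = ⟦ sy ⟧ᴳ
  σz = ⟦ sz ⟧ᴳ

  2iᴳ : ℚ × ℚ
  2iᴳ = 0ℚ , 2ℚ

  commutator-relation : ∀ m n q → (∀ a b → (m ⊗ᴳ n) a b ≡ (n ⊗ᴳ m) a b G.+ 2iᴳ G.* q a b) →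
    ∀ {D} (v : X D → Carrier) y → der ⟦ m ⟧ᴳ (der ⟦ n ⟧ᴳ v) y ≈ der ⟦ n ⟧ᴳ (der ⟦ m ⟧ᴳ v) y + 2𝐢 * der ⟦ q ⟧ᴳ v y
  commutator-relation m n q h = der-commutator ⟦ m ⟧ᴳ ⟦ n ⟧ᴳ ⟦ q ⟧ᴳ 2𝐢 λ a b → trans (⊗-gauss m n a b)
    (trans (reflexive (≡.cong gauss (h a b))) (trans (gauss-+ _ _ _ _)
      (+-cong (sym (⊗-gauss n m a b)) (gauss-* _ _ _ _))))

  hermitian-relation : ∀ m → (∀ a b → (proj₁ (m a b) , ℚ.- proj₂ (m a b)) ≡ m b a) →
    ∀ {D} (v w : X D → Carrier) → ⟪ der ⟦ m ⟧ᴳ v , w ⟫ ≈ ⟪ v , der ⟦ m ⟧ᴳ w ⟫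
  hermitian-relation m h = der-selfAdjoint ⟦ m ⟧ᴳ λ a b →
    trans (conj-gauss _ _) (reflexive (≡.cong gauss (h a b)))

  intertwining-relation : ∀ m p n → (∀ a b → (m ⊗ᴳ p) a b ≡ (p ⊗ᴳ n) a b) →
    ∀ {D} (v : X D → Carrier) y → der ⟦ m ⟧ᴳ (kron ⟦ p ⟧ᴳ v) y ≈ kron ⟦ p ⟧ᴳ (der ⟦ n ⟧ᴳ v) y
  intertwining-relation m p n h = der-kron ⟦ m ⟧ᴳ ⟦ p ⟧ᴳ ⟦ n ⟧ᴳ λ a b →
    trans (⊗-gauss m p a b) (trans (reflexive (≡.cong gauss (h a b))) (sym (⊗-gauss p n a b)))

  -- That is, `A* P = P A`, while `σx-kron` is `A P = P Aε`. Conjugation by `P` thus realises the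
  -- cyclic rotation of the triple and carries spectral information from `A*` to `A` to `Aε`.
  σz-kron : ∀ {D} (v : X D → Carrier) y → der σz (kron ⟦ p₁ ⟧ᴳ v) y ≈ kron ⟦ p₁ ⟧ᴳ (der σx v) y
  σz-kron = intertwining-relation sz p₁ sx (from-yes ((sz ⊗ᴳ p₁) ≟ᴳ (p₁ ⊗ᴳ sx)))

  σx-kron : ∀ {D} (v : X D → Carrier) y → der σx (kron ⟦ p₁ ⟧ᴳ v) y ≈ kron ⟦ p₁ ⟧ᴳ (der σy v) y
  σx-kron = intertwining-relation sx p₁ sy (from-yes ((sx ⊗ᴳ p₁) ≟ᴳ (p₁ ⊗ᴳ sy)))

  cubeTriple : ∀ D → Triple K (X D) (cubeForm D)
  cubeTriple D = record
    { A₁ = derᴸ σx D ; A₂ = derᴸ σz D ; A₃ = derᴸ σy D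
    ; comm₁₂ = commutator-relation sx sz sy (from-yes ((sx ⊗ᴳ sz) ≟ᴳ λ a b → (sz ⊗ᴳ sx) a b G.+ 2iᴳ G.* sy a b))
    ; comm₂₃ = commutator-relation sz sy sx (from-yes ((sz ⊗ᴳ sy) ≟ᴳ λ a b → (sy ⊗ᴳ sz) a b G.+ 2iᴳ G.* sx a b))
    ; comm₃₁ = commutator-relation sy sx sz (from-yes ((sy ⊗ᴳ sx) ≟ᴳ λ a b → (sx ⊗ᴳ sy) a b G.+ 2iᴳ G.* sz a b))
    ; adj₁ = hermitian-relation sx (from-yes ((λ a b → proj₁ (sx a b) , ℚ.- proj₂ (sx a b)) ≟ᴳ λ a b → sx b a))
    ; adj₂ = hermitian-relation sz (from-yes ((λ a b → proj₁ (sz a b) , ℚ.- proj₂ (sz a b)) ≟ᴳ λ a b → sz b a))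
    ; adj₃ = hermitian-relation sy (from-yes ((λ a b → proj₁ (sy a b) , ℚ.- proj₂ (sy a b)) ≟ᴳ λ a b → sy b a)) }

  gauss-0* : ∀ x → gauss (0ℚ , 0ℚ) * x ≈ 0#
  gauss-0* x = trans (*-congʳ gauss-0) (zeroˡ x)

  gauss-1* : ∀ x → gauss (1ℚ , 0ℚ) * x ≈ x
  gauss-1* x = trans (*-congʳ gauss-1) (*-identityˡ x)

  -- The matrices of the cube as operators

  infixr 8 _▹_
  _▹_ : ∀ {D} → (X D → X D → Carrier) → (X D → Carrier) → X D → Carrier
  (M ▹ v) y = ∑ (λ z → M y z * v z)

  matᴸ : ∀ {D} → (X D → X D → Carrier) → Linear K (X D)
  matᴸ M = record
    { fun    = M ▹_
    ; fcong  = λ v≈w y → ∑-cong (λ z → *-congˡ (v≈w z))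
    ; linear = λ a b v w y → trans
        (∑-cong (λ z → solve 5 (λ m a b v w → m :* (a :* v :+ b :* w) := a :* (m :* v) :+ b :* (m :* w)) refl
          (M y z) a b (v z) (w z)))
        (∑-linear a b (λ z → M y z * v z) (λ z → M y z * w z)) }

  ▹-* : ∀ {D} (M N : X D → X D → Carrier) v y →
    ((λ y z → ∑ (λ w → M y w * N w z)) ▹ v) y ≈ (M ▹ N ▹ v) y
  ▹-* M N v y = begin
    ∑ (λ z → ∑ (λ w → M y w * N w z) * v z)
      ≈⟨ ∑-cong (λ z → trans (*-comm _ (v z)) (sym (∑-*ˡ (v z) (λ w → M y w * N w z)))) ⟩
    ∑ (λ z → ∑ (λ w → v z * (M y w * N w z)))
      ≈⟨ ∑-comm (λ z w → v z * (M y w * N w z)) ⟩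
    ∑ (λ w → ∑ (λ z → v z * (M y w * N w z)))
      ≈⟨ ∑-cong (λ w → trans
           (∑-cong (λ z → solve 3 (λ v m n → v :* (m :* n) := m :* (n :* v)) refl (v z) (M y w) (N w z)))
           (∑-*ˡ (M y w) (λ z → N w z * v z))) ⟩
    ∑ (λ w → M y w * ∑ (λ z → N w z * v z)) ∎

  ▹-+ : ∀ {D} (M N : X D → X D → Carrier) v y → ((λ y z → M y z + N y z) ▹ v) y ≈ (M ▹ v) y + (N ▹ v) y
  ▹-+ M N v y = trans (∑-cong (λ z → distribʳ (v z) (M y z) (N y z))) (∑-+ (λ z → M y z * v z) (λ z → N y z * v z))

  ▹-• : ∀ {D} c (M : X D → X D → Carrier) v y → ((λ y z → c * M y z) ▹ v) y ≈ c * (M ▹ v) y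
  ▹-• c M v y = trans (∑-cong (λ z → *-assoc c (M y z) (v z))) (∑-*ˡ c (λ z → M y z * v z))

  ▹-congˡ : ∀ {D} {M N : X D → X D → Carrier} → (∀ y z → M y z ≈ N y z) → ∀ v y → (M ▹ v) y ≈ (N ▹ v) y
  ▹-congˡ M≈N v y = ∑-cong (λ z → *-congʳ (M≈N y z))

  if-true : ∀ {P : Set} (p? : Dec P) {a b : Carrier} → P → (if does p? then a else b) ≈ a
  if-true (yes _) _ = refl
  if-true (no ¬p) p = contradiction p ¬p

  if-false : ∀ {P : Set} (p? : Dec P) {a b : Carrier} → ¬ P → (if does p? then a else b) ≈ b
  if-false (yes p) ¬p = contradiction p ¬p
  if-false (no _)  _  = refl

  ▹-diag : ∀ {D} (f : X D → Carrier) v y →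
    ((λ y z → if does (≡-dec Finₚ._≟_ y z) then f y else 0#) ▹ v) y ≈ f y * v y
  ▹-diag f v y = trans
    (∑-single y _ (λ z z≢y → trans (*-congʳ (if-false (≡-dec Finₚ._≟_ y z) (z≢y ∘ ≡.sym))) (zeroˡ (v z))))
    (*-congʳ (if-true (≡-dec Finₚ._≟_ y y) ≡.refl))

  adjacency : ∀ {D} → X D → X D → Carrier
  adjacency y z = if does (hamming y z ℕₚ.≟ 1) then 1# else 0#

  -- Accounts for the edges along the first coordinate: the other coordinates then have to agree,
  -- which leaves a single term.
  neighbour : ∀ {D} (y : X D) (v : X D → Carrier) →
    ∑ (λ z → (if does (suc (hamming y z) ℕₚ.≟ 1) then 1# else 0#) * v z) ≈ v y
  neighbour y v = trans
    (∑-single y _ (λ z z≢y → trans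
      (*-congʳ (if-false (suc (hamming y z) ℕₚ.≟ 1) (λ h → z≢y (≡.sym (hamming≡0 y z (ℕₚ.suc-injective h))))))
      (zeroˡ (v z))))
    (trans (*-congʳ (if-true (suc (hamming y y) ℕₚ.≟ 1) (≡.cong suc (hamming-refl y)))) (*-identityˡ (v y)))

  adjacency-der : ∀ {D} (v : X D → Carrier) y → (adjacency ▹ v) y ≈ der σx v y
  adjacency-der v []             = trans (∑-nil _) (zeroˡ (v []))
  adjacency-der v (zero ∷ y)     = trans (∑-cons _) (+-cong (adjacency-der (v ∘ (zero ∷_)) y) (trans
    (neighbour y (v ∘ (1F ∷_)))
    (sym (trans (+-cong (gauss-0* _) (gauss-1* _)) (+-identityˡ _)))))
  adjacency-der v (1F ∷ y) = trans (∑-cons _) (trans (+-comm _ _)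
    (+-cong (adjacency-der (v ∘ (1F ∷_)) y) (trans
      (neighbour y (v ∘ (zero ∷_)))
      (sym (trans (+-cong (gauss-1* _) (gauss-0* _)) (+-identityʳ _))))))

  -- A leading 0 adds 1 to `D - 2∂` and a leading 1 subtracts 1; these are the diagonal entries of
  -- `σz`.
  weight-der : ∀ {D} (v : X D → Carrier) y → ι (θ D (∂ (origin D) y)) * v y ≈ der σz v y
  weight-der v []             = trans (*-congʳ gauss-0) (zeroˡ (v []))
  weight-der {suc D} v (zero ∷ y)     = begin
    ι (θ (suc D) n) * x        ≈⟨ *-congʳ (trans (ι-cong (θ-sucˡ D n)) (trans (ι-+ (θ D n) 1ℚ) (+-congˡ gauss-1))) ⟩
    (ι (θ D n) + 1#) * x       ≈⟨ distribʳ x (ι (θ D n)) 1# ⟩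
    ι (θ D n) * x + 1# * x     ≈⟨ +-cong (weight-der (v ∘ (zero ∷_)) y) (sym (trans (+-cong (*-congʳ gauss-1) (gauss-0* _)) (+-identityʳ _))) ⟩
    der σz v (zero ∷ y)        ∎
    where
    n : ℕ
    n = ∂ (origin D) y
    x : Carrier
    x = v (zero ∷ y)
  weight-der {suc D} v (1F ∷ y) = begin
    ι (θ (suc D) (suc n)) * x   ≈⟨ *-congʳ (trans (ι-cong (θ-sucʳ D n)) (trans (ι-sub (θ D n) 1ℚ) (+-congˡ (-‿cong gauss-1)))) ⟩
    (ι (θ D n) - 1#) * x        ≈⟨ distribʳ x (ι (θ D n)) (- 1#) ⟩
    ι (θ D n) * x + - 1# * x    ≈⟨ +-cong (weight-der (v ∘ (1F ∷_)) y) (sym (trans (+-cong (gauss-0* _) (*-congʳ (trans (gauss-neg 1ℚ 0ℚ) (-‿cong gauss-1)))) (+-identityˡ _))) ⟩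
    der σz v (1F ∷ y)     ∎
    where
    n : ℕ
    n = ∂ (origin D) y
    x : Carrier
    x = v (1F ∷ y)

  module _ (p : M₂) (P : ∀ {D} → X D → X D → Carrier) (P-nil : P [] [] ≈ 1#)
           (P-cons : ∀ {D} a b (y z : X D) → P (a ∷ y) (b ∷ z) ≈ p a b * P y z) where
    kronecker-power : ∀ {D} (v : X D → Carrier) y → (P ▹ v) y ≈ kron p v y
    kronecker-power v []      = trans (∑-nil _) (trans (*-congʳ P-nil) (*-identityˡ (v [])))
    kronecker-power v (a ∷ y) = trans (∑-cons _) (+-cong (half zero) (half 1F))
      where
      half : ∀ b → ∑ (λ z → P (a ∷ y) (b ∷ z) * v (b ∷ z)) ≈ p a b * kron p (v ∘ (b ∷_)) y
      half b = begin
        ∑ (λ z → P (a ∷ y) (b ∷ z) * v (b ∷ z))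
          ≈⟨ ∑-cong (λ z → trans (*-congʳ (P-cons a b y z)) (*-assoc _ _ _)) ⟩
        ∑ (λ z → p a b * (P y z * v (b ∷ z)))
          ≈⟨ ∑-*ˡ (p a b) (λ z → P y z * v (b ∷ z)) ⟩
        p a b * (P ▹ (v ∘ (b ∷_))) y
          ≈⟨ *-congˡ (kronecker-power (v ∘ (b ∷_)) y) ⟩
        p a b * kron p (v ∘ (b ∷_)) y ∎

  -- Spectral resolutions and Lagrange interpolation

  -- A resolution of the identity into eigenprojections. The field `extinct`, the absence of the
  -- eigenvalues `θ D k` with `k > D`, is what makes strings terminate.
  record Spectral {D} (F : Linear K (X D)) (E : ℕ → Linear K (X D)) : Set where
    field
      select   : ∀ k w → (∀ y → fun F w y ≈ ι (θ D k) * w y) → ∀ y → fun (E k) w y ≈ w y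
      reject   : ∀ k l w → k ℕ.≤ D → k ≢ l → (∀ y → fun F w y ≈ ι (θ D k) * w y) → ∀ y → fun (E l) w y ≈ 0#
      extinct  : ∀ k w → D ℕ.< k → (∀ y → fun F w y ≈ ι (θ D k) * w y) → ∀ y → w y ≈ 0#
      eigen    : ∀ k v → k ℕ.≤ D → ∀ y → fun F (fun (E k) v) y ≈ ι (θ D k) * fun (E k) v y
      complete : ∀ v y → ∑< (suc D) (λ k → fun (E k) v y) ≈ v y

  identity : ∀ {D} → X D → X D → Carrier
  identity y z = if does (≡-dec Finₚ._≟_ y z) then 1# else 0#

  identity-▹ : ∀ {D} (v : X D → Carrier) y → (identity ▹ v) y ≈ v y
  identity-▹ v y = trans (▹-diag (λ _ → 1#) v y) (*-identityˡ (v y))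

  module _ {D : ℕ} where

    indicator : ℕ → X D → Carrier
    indicator k y = if does (∂ (origin D) y ℕₚ.≟ k) then 1# else 0#

    sphere : ℕ → X D → X D → Carrier
    sphere k y z = if does (≡-dec Finₚ._≟_ y z) then indicator k y else 0#

    sphere-on : ∀ k v y → ∂ (origin D) y ≡ k → (sphere k ▹ v) y ≈ v y
    sphere-on k v y h = trans (▹-diag (indicator k) v y) (trans (*-congʳ (if-true (∂ (origin D) y ℕₚ.≟ k) h)) (*-identityˡ (v y)))

    sphere-off : ∀ k v y → ∂ (origin D) y ≢ k → (sphere k ▹ v) y ≈ 0#
    sphere-off k v y h = trans (▹-diag (indicator k) v y) (trans (*-congʳ (if-false (∂ (origin D) y ℕₚ.≟ k) h)) (zeroˡ (v y)))

    -- As `σz` acts diagonally, the eigenvector equation at `y` compares `θ` at the distance of `y`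
    -- with `θ D k`, and distinct indices have distinct `θ`.
    weight-support : ∀ k (w : X D → Carrier) → (∀ y → der σz w y ≈ ι (θ D k) * w y) →
      ∀ y → ∂ (origin D) y ≢ k → w y ≈ 0#
    weight-support k w h y y≢k = cancel-ι-0 (θ D n ℚ.- θ D k) θ≢0 (begin
      ι (θ D n ℚ.- θ D k) * w y            ≈⟨ *-congʳ (ι-sub (θ D n) (θ D k)) ⟩
      (ι (θ D n) - ι (θ D k)) * w y        ≈⟨ solve 3 (λ a b x → (a :- b) :* x := a :* x :- b :* x) refl (ι (θ D n)) (ι (θ D k)) (w y) ⟩
      ι (θ D n) * w y - ι (θ D k) * w y    ≈⟨ +-congʳ (trans (weight-der w y) (h y)) ⟩
      ι (θ D k) * w y - ι (θ D k) * w y    ≈⟨ -‿inverseʳ _ ⟩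
      0#                                   ∎)
      where
      n : ℕ
      n = ∂ (origin D) y
      θ≢0 : θ D n ℚ.- θ D k ≢ 0ℚ
      θ≢0 = θ-sub≢0 D y≢k

    σz-spectral : Spectral (derᴸ σz D) (λ k → matᴸ (sphere k))
    σz-spectral = record
      { select = λ k w h y → selectᶻ k w h y (∂ (origin D) y ℕₚ.≟ k)
      ; reject = λ k l w _ k≢l h y → rejectᶻ k l w k≢l h y (∂ (origin D) y ℕₚ.≟ l)
      ; extinct = λ k w D<k h y → weight-support k w h y (λ e → ℕₚ.<⇒≱ D<k (≡.subst (ℕ._≤ D) e (weight≤ y)))
      ; eigen = λ k v _ y → trans (sym (weight-der (sphere k ▹ v) y)) (eigenᶻ k v y (∂ (origin D) y ℕₚ.≟ k))
      ; complete = λ v y → trans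
          (∑<-single (suc D) (∂ (origin D) y) (s≤s (weight≤ y)) (λ k _ k≢ → sphere-off k v y (k≢ ∘ ≡.sym)))
          (sphere-on (∂ (origin D) y) v y ≡.refl) }
      where
      selectᶻ : ∀ k w → (∀ y → der σz w y ≈ ι (θ D k) * w y) → ∀ y → Dec (∂ (origin D) y ≡ k) → (sphere k ▹ w) y ≈ w y
      selectᶻ k w h y (yes e) = sphere-on k w y e
      selectᶻ k w h y (no ¬e) = trans (sphere-off k w y ¬e) (sym (weight-support k w h y ¬e))
      rejectᶻ : ∀ k l w → k ≢ l → (∀ y → der σz w y ≈ ι (θ D k) * w y) → ∀ y → Dec (∂ (origin D) y ≡ l) → (sphere l ▹ w) y ≈ 0#
      rejectᶻ k l w k≢l h y (yes e) = trans (sphere-on l w y e) (weight-support k w h y (λ e′ → k≢l (≡.trans (≡.sym e′) e)))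
      rejectᶻ k l w k≢l h y (no ¬e) = sphere-off l w y ¬e
      eigenᶻ : ∀ k v y → Dec (∂ (origin D) y ≡ k) →
        ι (θ D (∂ (origin D) y)) * (sphere k ▹ v) y ≈ ι (θ D k) * (sphere k ▹ v) y
      eigenᶻ k v y (yes e) = *-congʳ (ι-cong (≡.cong (θ D) e))
      eigenᶻ k v y (no ¬e) = trans (trans (*-congˡ (sphere-off k v y ¬e)) (zeroʳ _))
        (sym (trans (*-congˡ (sphere-off k v y ¬e)) (zeroʳ _)))

    module Conjugate (U U⁻¹ : Linear K (X D))
      (U-U⁻¹ : ∀ v y → fun U (fun U⁻¹ v) y ≈ v y) (U⁻¹-U : ∀ v y → fun U⁻¹ (fun U v) y ≈ v y)
      (F G : Linear K (X D)) (F-U : ∀ v y → fun F (fun U v) y ≈ fun U (fun G v) y) where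

      conjugate : Linear K (X D) → Linear K (X D)
      conjugate E = record
        { fun    = λ v → fun U⁻¹ (fun E (fun U v))
        ; fcong  = λ h → fcong U⁻¹ (fcong E (fcong U h))
        ; linear = λ a b v w y → trans
            (fcong U⁻¹ (λ y → trans (fcong E (linear U a b v w) y) (linear E a b (fun U v) (fun U w) y)) y)
            (linear U⁻¹ a b (fun E (fun U v)) (fun E (fun U w)) y) }

      U-eigen : ∀ q w → (∀ y → fun G w y ≈ q * w y) → ∀ y → fun F (fun U w) y ≈ q * fun U w y
      U-eigen q w h y = trans (F-U w y) (trans (fcong U h y) (Vectors.scale U q w y))

      U⁻¹-eigen : ∀ q w → (∀ y → fun F w y ≈ q * w y) → ∀ y → fun G (fun U⁻¹ w) y ≈ q * fun U⁻¹ w y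
      U⁻¹-eigen q w h y = begin
        fun G (fun U⁻¹ w) y                    ≈⟨ U⁻¹-U (fun G (fun U⁻¹ w)) y ⟨
        fun U⁻¹ (fun U (fun G (fun U⁻¹ w))) y  ≈⟨ fcong U⁻¹ (F-U (fun U⁻¹ w)) y ⟨
        fun U⁻¹ (fun F (fun U (fun U⁻¹ w))) y  ≈⟨ fcong U⁻¹ (λ y → trans (fcong F (U-U⁻¹ w) y) (h y)) y ⟩
        fun U⁻¹ (λ y → q * w y) y              ≈⟨ Vectors.scale U⁻¹ q w y ⟩
        q * fun U⁻¹ w y                        ∎

      U-zero : ∀ w → (∀ y → fun U w y ≈ 0#) → ∀ y → w y ≈ 0#
      U-zero w h y = trans (sym (U⁻¹-U w y)) (Vectors.zeroᵛ U⁻¹ h y)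

      spectral : ∀ {E} → Spectral F E → Spectral G (conjugate ∘ E)
      spectral {E} s = record
        { select = λ k w h y → trans (fcong U⁻¹ (S.select k (fun U w) (U-eigen (ι (θ D k)) w h)) y) (U⁻¹-U w y)
        ; reject = λ k l w k≤D k≢l h y → Vectors.zeroᵛ U⁻¹ (S.reject k l (fun U w) k≤D k≢l (U-eigen (ι (θ D k)) w h)) y
        ; extinct = λ k w D<k h → U-zero w (S.extinct k (fun U w) D<k (U-eigen (ι (θ D k)) w h))
        ; eigen = λ k v k≤D → U⁻¹-eigen (ι (θ D k)) (fun (E k) (fun U v)) (S.eigen k (fun U v) k≤D)
        ; complete = λ v y → begin
            ∑< (suc D) (λ k → fun U⁻¹ (fun (E k) (fun U v)) y)
              ≈⟨ ∑<-cong (suc D) (λ k _ → *-identityˡ (fun U⁻¹ (fun (E k) (fun U v)) y)) ⟨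
            ∑< (suc D) (λ k → 1# * fun U⁻¹ (fun (E k) (fun U v)) y)
              ≈⟨ Vectors.sums U⁻¹ (suc D) (λ _ → 1#) (λ k → fun (E k) (fun U v)) y ⟨
            fun U⁻¹ (λ y → ∑< (suc D) (λ k → 1# * fun (E k) (fun U v) y)) y
              ≈⟨ fcong U⁻¹ (λ y → trans (∑<-cong (suc D) (λ k _ → *-identityˡ (fun (E k) (fun U v) y))) (S.complete (fun U v) y)) y ⟩
            fun U⁻¹ (fun U v) y
              ≈⟨ U⁻¹-U v y ⟩
            v y ∎ }
        where module S = Spectral s

    module _ {F : Linear K (X D)} {E E′ : ℕ → Linear K (X D)} (s : Spectral F E)
      (select′ : ∀ k w → (∀ y → fun F w y ≈ ι (θ D k) * w y) → ∀ y → fun (E′ k) w y ≈ w y)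
      (reject′ : ∀ k l w → k ℕ.≤ D → k ≢ l → (∀ y → fun F w y ≈ ι (θ D k) * w y) → ∀ y → fun (E′ l) w y ≈ 0#) where
      private module S = Spectral s

      -- By `complete` every vector is a sum of eigenvectors, and on these `select′` and `reject′`
      -- prescribe the value.
      projections-unique : ∀ l → l ℕ.≤ D → ∀ v y → fun (E′ l) v y ≈ fun (E l) v y
      projections-unique l l≤D v y = begin
        fun (E′ l) v y
          ≈⟨ fcong (E′ l) (λ y → trans (sym (S.complete v y)) (sym (∑<-cong (suc D) (λ k _ → *-identityˡ (fun (E k) v y))))) y ⟩
        fun (E′ l) (λ y → ∑< (suc D) (λ k → 1# * fun (E k) v y)) y
          ≈⟨ Vectors.sums (E′ l) (suc D) (λ _ → 1#) (λ k → fun (E k) v) y ⟩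
        ∑< (suc D) (λ k → 1# * fun (E′ l) (fun (E k) v) y)
          ≈⟨ ∑<-single (suc D) l (s≤s l≤D) (λ k k<1+D k≢l → trans
               (*-congˡ (reject′ k l (fun (E k) v) (ℕₚ.≤-pred k<1+D) k≢l (S.eigen k v (ℕₚ.≤-pred k<1+D)) y)) (zeroʳ 1#)) ⟩
        1# * fun (E′ l) (fun (E l) v) y
          ≈⟨ *-identityˡ _ ⟩
        fun (E′ l) (fun (E l) v) y
          ≈⟨ select′ l (fun (E l) v) (S.eigen l v l≤D) y ⟩
        fun (E l) v y ∎

      spectral-unique : Spectral F E′
      spectral-unique = record
        { select   = select′
        ; reject   = reject′
        ; extinct  = S.extinct
        ; eigen    = λ k v k≤D y → trans (fcong F (projections-unique k k≤D v) y)
            (trans (S.eigen k v k≤D y) (*-congˡ (sym (projections-unique k k≤D v y))))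
        ; complete = λ v y → trans (∑<-cong (suc D) (λ k k<1+D → projections-unique k (ℕₚ.≤-pred k<1+D) v y)) (S.complete v y) }

    others : ℕ → List ℕ
    others i = filter (λ j → ¬? (j ℕₚ.≟ i)) (upTo (suc D))

    -- interpolant is the product over j ≠ i of (F - θⱼ) / (θᵢ - θⱼ).
    module Interpolation (F : Linear K (X D)) (i : ℕ) where

      scaling : ℕ → Carrier
      scaling j = ι (1ℚ ÷₀ (θ D i ℚ.- θ D j))

      step : ℕ → (X D → Carrier) → X D → Carrier
      step j v y = scaling j * (fun F v y + (- ι (θ D j)) * v y)

      steps : List ℕ → (X D → Carrier) → X D → Carrier
      steps []       v = v
      steps (j ∷ js) v = step j (steps js v)

      steps-cong : ∀ js {v w : X D → Carrier} → (∀ y → v y ≈ w y) → ∀ y → steps js v y ≈ steps js w y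
      steps-cong []       h y = h y
      steps-cong (j ∷ js) h y = *-congˡ (+-cong (fcong F (steps-cong js h) y) (*-congˡ (steps-cong js h y)))

      steps-linear : ∀ js a b (v w : X D → Carrier) y →
        steps js (λ y → a * v y + b * w y) y ≈ a * steps js v y + b * steps js w y
      steps-linear []       a b v w y = refl
      steps-linear (j ∷ js) a b v w y = trans
        (*-congˡ (+-cong (trans (fcong F (steps-linear js a b v w) y) (linear F a b (steps js v) (steps js w) y))
                         (*-congˡ (steps-linear js a b v w y))))
        (solve 8 (λ c t a b fv fw v w → c :* ((a :* fv :+ b :* fw) :+ t :* (a :* v :+ b :* w))
           := a :* (c :* (fv :+ t :* v)) :+ b :* (c :* (fw :+ t :* w))) refl
           (scaling j) (- ι (θ D j)) a b (fun F (steps js v) y) (fun F (steps js w) y) (steps js v y) (steps js w y))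

      interpolant : Linear K (X D)
      interpolant = record
        { fun = steps (others i) ; fcong = steps-cong (others i) ; linear = steps-linear (others i) }

      module _ (k : ℕ) (w : X D → Carrier) (w-eigen : ∀ y → fun F w y ≈ ι (θ D k) * w y) where

        root : ℕ → Carrier
        root j = scaling j * (ι (θ D k) - ι (θ D j))

        roots : List ℕ → Carrier
        roots = List.foldr (λ j x → root j * x) 1#

        steps-eigen : ∀ js y → steps js w y ≈ roots js * w y
        steps-eigen []       y = sym (*-identityˡ (w y))
        steps-eigen (j ∷ js) y = begin
          scaling j * (fun F (steps js w) y + (- ι (θ D j)) * steps js w y)
            ≈⟨ *-congˡ (+-cong
                 (trans (fcong F (steps-eigen js) y) (trans (Vectors.scale F (roots js) w y) (*-congˡ (w-eigen y))))
                 (*-congˡ (steps-eigen js y))) ⟩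
          scaling j * (roots js * (ι (θ D k) * w y) + (- ι (θ D j)) * (roots js * w y))
            ≈⟨ solve 5 (λ c s a t x → c :* (s :* (a :* x) :+ (:- t) :* (s :* x)) := c :* (a :- t) :* s :* x) refl
                 (scaling j) (roots js) (ι (θ D k)) (ι (θ D j)) (w y) ⟩
          roots (j ∷ js) * w y ∎

        roots-vanish : ∀ js → k ∈ js → roots js ≈ 0#
        roots-vanish (j ∷ js) (here ≡.refl) = trans (*-congʳ (trans (*-congˡ (-‿inverseʳ _)) (zeroʳ _))) (zeroˡ _)
        roots-vanish (j ∷ js) (there k∈js)  = trans (*-congˡ (roots-vanish js k∈js)) (zeroʳ _)

        interpolant-reject : k ℕ.≤ D → k ≢ i → ∀ y → fun interpolant w y ≈ 0#
        interpolant-reject k≤D k≢i y = trans (steps-eigen (others i) y) (trans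
          (*-congʳ (roots-vanish (others i) (∈-filter⁺ (λ j → ¬? (j ℕₚ.≟ i)) (∈-upTo⁺ (s≤s k≤D)) k≢i))) (zeroˡ (w y)))

        roots-unit : i ≡ k → ∀ js → All (_≢ i) js → roots js ≈ 1#
        roots-unit ≡.refl []       []            = refl
        roots-unit ≡.refl (j ∷ js) (j≢i ∷ js≢i) = trans
          (*-cong (trans (*-congˡ (sym (ι-sub (θ D i) (θ D j))))
                    (ι-inverse (θ D i ℚ.- θ D j) (θ-sub≢0 D (j≢i ∘ ≡.sym))))
                  (roots-unit ≡.refl js js≢i))
          (*-identityˡ 1#)

        interpolant-select : i ≡ k → ∀ y → fun interpolant w y ≈ w y
        interpolant-select i≡k y = trans (steps-eigen (others i) y) (trans
          (*-congʳ (roots-unit i≡k (others i) (all-filter (λ j → ¬? (j ℕₚ.≟ i)) (upTo (suc D))))) (*-identityˡ (w y)))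

    open Interpolation using (interpolant; interpolant-select; interpolant-reject; steps)

    -- Presents each projection as a polynomial in `F`, so that a subspace stable under `F` is
    -- stable under the projection as well.
    interpolant-projection : ∀ {F : Linear K (X D)} {E} → Spectral F E →
      ∀ k → k ℕ.≤ D → ∀ v y → fun (interpolant F k) v y ≈ fun (E k) v y
    interpolant-projection {F} s = projections-unique {E′ = interpolant F} s
      (λ k w h → interpolant-select F k k w h ≡.refl)
      (λ k l w k≤D k≢l h → interpolant-reject F l k w h k≤D k≢l)

    infixl 7 _⊡_
    _⊡_ : (X D → X D → Carrier) → (X D → X D → Carrier) → X D → X D → Carrier
    (M ⊡ N) y z = ∑ λ w → M y w * N w z

    factor : ℕ → ℕ → X D → X D → Carrier
    factor i j y z = ι (1ℚ ÷₀ (θ D i ℚ.- θ D j)) * (adjacency y z + (- ι (θ D j)) * identity y z)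

    lagrange : ℕ → X D → X D → Carrier
    lagrange i = List.foldr _⊡_ identity (List.map (factor i) (others i))

    lagrange-interpolant : ∀ i v y → (lagrange i ▹ v) y ≈ fun (interpolant (derᴸ σx D) i) v y
    lagrange-interpolant i v = go (others i)
      where
      F : Linear K (X D)
      F = derᴸ σx D
      factor-step : ∀ j w y → (factor i j ▹ w) y ≈ Interpolation.step F i j w y
      factor-step j w y = trans (▹-• c (λ y z → adjacency y z + (- t) * identity y z) w y)
        (*-congˡ (trans (▹-+ adjacency (λ y z → (- t) * identity y z) w y)
          (+-cong (adjacency-der w y) (trans (▹-• (- t) identity w y) (*-congˡ (identity-▹ w y))))))
        where
        c t : Carrier
        c = ι (1ℚ ÷₀ (θ D i ℚ.- θ D j))
        t = ι (θ D j)
      go : ∀ js y → (List.foldr _⊡_ identity (List.map (factor i) js) ▹ v) y ≈ steps F i js v y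
      go []       y = identity-▹ v y
      go (j ∷ js) y = trans (▹-* (factor i j) (List.foldr _⊡_ identity (List.map (factor i) js)) v y)
        (trans (∑-cong (λ z → *-congˡ (go js z))) (factor-step j (steps F i js v) y))

    module _ (U⁻¹ : Linear K (X D)) (U-U⁻¹ : ∀ v y → kron ⟦ p₁ ⟧ᴳ (fun U⁻¹ v) y ≈ v y)
             (U⁻¹-U : ∀ v y → fun U⁻¹ (kron ⟦ p₁ ⟧ᴳ v) y ≈ v y) where

      -- Conjugating the resolution of `A*` by `P` yields eigenvalues, completeness and extinction
      -- for `A`; uniqueness then replaces the conjugated projections by the Lagrange products that
      -- define `E`.
      σx-spectral : Spectral (derᴸ σx D) (λ k → matᴸ (lagrange k))
      σx-spectral = spectral-unique
        (Conjugate.spectral (kronᴸ ⟦ p₁ ⟧ᴳ D) U⁻¹ U-U⁻¹ U⁻¹-U (derᴸ σz D) (derᴸ σx D) σz-kron σz-spectral)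
        (λ k w h y → trans (lagrange-interpolant k w y) (interpolant-select (derᴸ σx D) k k w h ≡.refl y))
        (λ k l w k≤D k≢l h y → trans (lagrange-interpolant l w y) (interpolant-reject (derᴸ σx D) l k w h k≤D k≢l y))

      σy-spectral : Spectral (derᴸ σy D) (λ k → Conjugate.conjugate (kronᴸ ⟦ p₁ ⟧ᴳ D) U⁻¹ U-U⁻¹ U⁻¹-U (derᴸ σx D) (derᴸ σy D) σx-kron (matᴸ (lagrange k)))
      σy-spectral = Conjugate.spectral (kronᴸ ⟦ p₁ ⟧ᴳ D) U⁻¹ U-U⁻¹ U⁻¹-U (derᴸ σx D) (derᴸ σy D) σx-kron σx-spectral

    θ-shift : ∀ r k → ι (θ D r) + -2ₖ * nat k ≈ ι (θ D (r ℕ.+ k))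
    θ-shift r k = sym (trans (ι-cong (θ-+ D r k))
      (trans (ι-+ (θ D r) (ℚ.- 2ℚ ℚ.* natℚ k)) (+-congˡ (ι-* (ℚ.- 2ℚ) (natℚ k)))))

    θ-sub : ∀ r k → ι (natℚ D ℚ.- natℚ (r ℕ.+ r ℕ.+ k)) ≈ ι (θ D r) - nat k
    θ-sub r k = trans (ι-cong (θ-minus D r k)) (ι-sub (θ D r) (natℚ k))

    θ-start : ∀ r d → D ≡ r ℕ.+ r ℕ.+ d → ι (θ D r) ≈ nat d
    θ-start r d ≡.refl = ι-cong (θ-top r d)

    eigenvalue : ∀ r d → D ≡ r ℕ.+ r ℕ.+ d → ∀ k → nat d + -2ₖ * nat k ≈ ι (θ D (r ℕ.+ k))
    eigenvalue r d D≡ k = trans (+-congʳ (sym (θ-start r d D≡))) (θ-shift r k)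

    -- Because `D = 2r + d`, the string eigenvalue `d - 2k` is `θ D (r + k)`; hence the offset `r`
    -- in the indices.
    spectral-axis : ∀ {F : Linear K (X D)} {E} → Spectral F E → ∀ r d → D ≡ r ℕ.+ r ℕ.+ d → Vectors.Axis K (X D) F d
    spectral-axis {F} {E} s r d D≡ = record
      { proj   = λ k → E (r ℕ.+ k)
      ; select = λ w k _ h → S.select (r ℕ.+ k) w (λ y → trans (h y) (*-congʳ (eigenvalue r d D≡ k)))
      ; reject = λ w k l k≤d _ k≢l h → S.reject (r ℕ.+ k) (r ℕ.+ l) w (≤D k≤d) (k≢l ∘ ℕₚ.+-cancelˡ-≡ r k l)
          (λ y → trans (h y) (*-congʳ (eigenvalue r d D≡ k))) }
      where
      module S = Spectral s
      ≤D : ∀ {k} → k ℕ.≤ d → r ℕ.+ k ℕ.≤ D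
      ≤D k≤d = ≡.subst (r ℕ.+ _ ℕ.≤_) (≡.sym (≡.trans D≡ (ℕₚ.+-assoc r r d)))
        (ℕₚ.+-monoʳ-≤ r (ℕₚ.≤-trans k≤d (ℕₚ.m≤n+m d r)))

-- Modules of the Terwilliger algebra

module ModuleTheory (K : Scalars) (S : CubeSum K) (D : ℕ) where
  open ScalarTheory K
  open CubeTheory K S
  open Vectors K (X D)
  open import Relation.Binary.Reasoning.Setoid setoid

  form : Form
  form = cubeForm D

  record Invariant (U : Vect → Set) : Set where
    field
      respects    : ∀ {v w} → v ≈ᵛ w → U v → U w
      zero∈   : U 0ᵛ
      linear∈ : ∀ a b {v w} → U v → U w → U (λ y → a * v y + b * w y)
      σx∈     : ∀ {v} → U v → U (der σx v)
      σz∈     : ∀ {v} → U v → U (der σz v)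

    -- `Aε` is `-𝐢/2` times the commutator of the two generators.
    σy∈ : ∀ {v} → U v → U (der σy v)
    σy∈ {v} v∈U = respects
      (λ y → trans (+-congʳ (*-congˡ (Triple.comm₁₂ (cubeTriple D) v y)))
        (solve 2 (λ p q → :-½𝐢 :* (p :+ :2𝐢 :* q) :+ :½𝐢 :* p := q) refl
          (der σz (der σx v) y) (der σy v y)))
      (linear∈ -½𝐢 ½𝐢 (σx∈ (σz∈ v∈U)) (σz∈ (σx∈ v∈U)))

    scale∈ : ∀ a {v} → U v → U (a • v)
    scale∈ a {v} v∈U = respects (λ y → trans (+-congˡ (zeroˡ (v y))) (+-identityʳ _)) (linear∈ a 0# v∈U v∈U)

    sum∈ : ∀ n (c : ℕ → Carrier) (v : ℕ → Vect) → (∀ k → U (v k)) → U (λ y → ∑< n (λ k → c k * v k y))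
    sum∈ zero    c v v∈U = zero∈
    sum∈ (suc n) c v v∈U = respects (λ y → +-congˡ (*-identityˡ _))
      (linear∈ (c 0) 1# (v∈U 0) (sum∈ n (c ∘ suc) (v ∘ suc) (v∈U ∘ suc)))

    combine∈ : ∀ a b {F G : Linear} → (∀ {v} → U v → U (fun F v)) → (∀ {v} → U v → U (fun G v)) →
      ∀ {v} → U v → U (fun (combine a F b G) v)
    combine∈ a b F∈ G∈ v∈U = linear∈ a b (F∈ v∈U) (G∈ v∈U)

    projection∈ : ∀ {F : Linear} {E} → Spectral F E → (∀ {v} → U v → U (fun F v)) →
      ∀ k → k ℕ.≤ D → ∀ {v} → U v → U (fun (E k) v)
    projection∈ {F} s F∈ k k≤D {v} v∈U = respects (interpolant-projection s k k≤D v) (steps∈ (others {D} k))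
      where
      open Interpolation F k
      steps∈ : ∀ js → U (steps js v)
      steps∈ []       = v∈U
      steps∈ (j ∷ js) = respects
        (λ y → solve 4 (λ c t fv v → c :* fv :+ c :* t :* v := c :* (fv :+ t :* v)) refl
          (scaling j) (- ι (θ D j)) (fun F (steps js v) y) (steps js v y))
        (linear∈ (scaling j) (scaling j * - ι (θ D j)) (F∈ (steps∈ js)) (steps∈ js))

  Simple : (Vect → Set) → Set₁
  Simple W = ∀ U → Invariant U → (∀ {v} → U v → W v) →
    ∀ u → U u → ¬ (u ≈ᵛ 0ᵛ) → ¬ ¬ (∀ {w} → W w → U w)

  module Highest (t : Triple form) {E₂ : ℕ → Linear} (s₂ : Spectral (Triple.A₂ t) E₂) (r : ℕ) (u : Vect)
    (weight-u : fun (Triple.A₂ t) u ≈ᵛ ι (θ D r) • u) (highest-u : fun (Ladder.L form t) u ≈ᵛ 0ᵛ) where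
    open Ladder form t
    open Triple t

    -- If `2r > D`, then no factor `D - 2r - n` of a lowering step is 0. The vector `v (suc D)`
    -- would have an eigenvalue outside the spectrum, hence be 0, and the descent would reach `u`.
    r+r≤D : ¬ (u ≈ᵛ 0ᵛ) → r ℕ.+ r ℕ.≤ D
    r+r≤D u≉0 with r ℕ.+ r ℕₚ.≤? D
    ... | yes h = h
    ... | no ¬h = contradiction (to-u (suc D) ends) u≉0
      where
      open String (ι (θ D r)) u weight-u highest-u
      ends : v (suc D) ≈ᵛ 0ᵛ
      ends = Spectral.extinct s₂ (r ℕ.+ suc D) (v (suc D)) (ℕₚ.m≤n+m (suc D) r)
        (λ y → trans (A₂-v (suc D) y) (*-congʳ (θ-shift r (suc D))))
      to-u : ∀ n → v n ≈ᵛ 0ᵛ → u ≈ᵛ 0ᵛ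
      to-u zero    h = h
      to-u (suc n) h = to-u n (descend n (natℚ D ℚ.- natℚ (r ℕ.+ r ℕ.+ n)) (θ-sub r n)
        (natℚ-sub≢0 (λ e → ¬h (ℕₚ.≤-trans (ℕₚ.m≤m+n (r ℕ.+ r) n) (ℕₚ.≤-reflexive (≡.sym e))))) h)

    highestWeight : ∀ d → D ≡ r ℕ.+ r ℕ.+ d → HighestWeight d u
    highestWeight d D≡ = record
      { weight-u = weight-u′ ; highest-u = highest-u
      ; v-ends = ends-early d r refl
          -- The index is chosen so that `r + (suc d + r) = suc D`, the first index outside the
          -- spectrum.
          (Spectral.extinct s₂ (r ℕ.+ (suc d ℕ.+ r)) (v (suc d ℕ.+ r)) (ℕₚ.≤-reflexive D<)
            (λ y → trans (A₂-v (suc d ℕ.+ r) y) (*-congʳ (eigenvalue r d D≡ (suc d ℕ.+ r))))) }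
      where
      weight-u′ : fun A₂ u ≈ᵛ nat d • u
      weight-u′ y = trans (weight-u y) (*-congʳ (θ-start r d D≡))
      open String (nat d) u weight-u′ highest-u
      D< : suc D ≡ r ℕ.+ (suc d ℕ.+ r)
      D< = ≡.trans (≡.cong suc (≡.trans D≡ (≡.trans (ℕₚ.+-assoc r r d) (≡.cong (r ℕ.+_) (ℕₚ.+-comm r d)))))
        (≡.sym (ℕₚ.+-suc r (d ℕ.+ r)))

  -- An irreducible module as the span of a string

  -- Formulated for any of the three rotations. The parameter `generators` expresses that `der σx`
  -- and `der σz` occur among the operators of `t`, whichever positions they have there, so that
  -- closure under the triple yields closure under `T`.
  module Chain
    {W : Vect → Set} (W-invariant : Invariant W) (W-simple : Simple W)
    (t : Triple form)
    (A₁∈ : ∀ {v} → W v → W (fun (Triple.A₁ t) v))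
    (A₃∈ : ∀ {v} → W v → W (fun (Triple.A₃ t) v))
    (generators : (Q : Linear → Set) → Q (Triple.A₁ t) → Q (Triple.A₂ t) → Q (Triple.A₃ t) → Q (derᴸ σx D) × Q (derᴸ σz D))
    {E₁ E₂ : ℕ → Linear} (s₁ : Spectral (Triple.A₁ t) E₁) (s₂ : Spectral (Triple.A₂ t) E₂)
    (r d : ℕ) (D≡ : D ≡ r ℕ.+ r ℕ.+ d) (u : Vect) (u∈W : W u) (u≉0 : ¬ (u ≈ᵛ 0ᵛ))
    (weight-u : fun (Triple.A₂ t) u ≈ᵛ ι (θ D r) • u) (highest-u : fun (Ladder.L form t) u ≈ᵛ 0ᵛ) where

    open Form form using () renaming (⟪_,_⟫ to ⟪_,_⟫ᶠ)
    open Triple t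
    open Ladder form t
    open Invariant W-invariant
    hw : HighestWeight d u
    hw = Highest.highestWeight t s₂ r u weight-u highest-u d D≡
    open HighestWeight hw using (v; A₂-v; descend)
    open FiniteString form t d u hw

    v∈W : ∀ k → W (v k)
    v∈W zero    = u∈W
    v∈W (suc k) = scale∈ _ (combine∈ ½ₖ ½𝐢 {A₁} {A₃} A₁∈ A₃∈ (v∈W k))

    Span : Vect → Set
    Span w = ∃ λ c → w ≈ᵛ comb c

    span-invariant : Invariant Span
    span-invariant = record
      { respects    = λ v≈w (c , v≈c) → c , λ y → trans (sym (v≈w y)) (v≈c y)
      ; zero∈   = (λ _ → 0#) , λ y → sym (comb-0 y)
      ; linear∈ = λ a b (c , v≈c) (e , w≈e) → (λ k → a * c k + b * e k) ,
                  λ y → trans (+-cong (*-congˡ (v≈c y)) (*-congˡ (w≈e y))) (comb-linear a b c e y)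
      ; σx∈     = λ {v} → proj₁ closed {v}
      ; σz∈     = λ {v} → proj₂ closed {v} }
      where
      Closed : Linear → Set
      Closed F = ∀ {v} → Span v → Span (fun F v)
      closed : Closed (derᴸ σx D) × Closed (derᴸ σz D)
      closed = generators Closed
        (λ (c , v≈c) → (λ k → raised c k + lowered c k) , λ y → trans (fcong A₁ v≈c y) (A₁-comb c y))
        (λ (c , v≈c) → (λ k → (nat d + -2ₖ * nat k) * c k) , λ y → trans (fcong A₂ v≈c y) (A₂-comb c y))
        (λ (c , v≈c) → (λ k → -𝐢 * raised c k + 𝐢 * lowered c k) , λ y → trans (fcong A₃ v≈c y) (A₃-comb c y))

    W⊆Span : ¬ ¬ (∀ {w} → W w → Span w)
    W⊆Span = W-simple Span span-invariant
      (λ (c , w≈c) → respects (λ y → sym (w≈c y)) (sum∈ (suc d) c v v∈W))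
      u (δ₀ , λ y → sym (comb-u δ₀ refl (λ _ _ → refl) y)) u≉0
      where
      δ₀ : ℕ → Carrier
      δ₀ zero    = 1#
      δ₀ (suc _) = 0#

    v≉0 : ∀ k → k ℕ.≤ d → ¬ (v k ≈ᵛ 0ᵛ)
    v≉0 zero    _   = u≉0
    v≉0 (suc k) k<d h = v≉0 k (ℕₚ.<⇒≤ k<d) (descend k (natℚ d ℚ.- natℚ k) (ι-sub (natℚ d) (natℚ k))
      (natℚ-sub≢0 (ℕₚ.<⇒≢ k<d ∘ ≡.sym)) h)

    v-eigen : ∀ k y → fun A₂ (v k) y ≈ ι (θ D (r ℕ.+ k)) * v k y
    v-eigen k y = trans (A₂-v k y) (*-congʳ (eigenvalue r d D≡ k))

    E₂-nonzero : ∀ k → k ℕ.≤ d → ¬ (∀ w → W w → fun (E₂ (r ℕ.+ k)) w ≈ᵛ 0ᵛ)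
    E₂-nonzero k k≤d h = v≉0 k k≤d λ y →
      trans (sym (Spectral.select s₂ (r ℕ.+ k) (v k) (v-eigen k) y)) (h (v k) (v∈W k) y)

    -- Every string vector has an `A₂`-index at most `r + d`. With `E₂-nonzero` and minimality of
    -- the endpoint this determines which `E* i` are nonzero on `W`, and thereby the diameter.
    E₂-zero : ∀ i → r ℕ.+ d ℕ.< i → ¬ ¬ (∀ w → W w → fun (E₂ i) w ≈ᵛ 0ᵛ)
    E₂-zero i r+d<i ¬zero = W⊆Span λ spans → ¬zero λ w w∈W y →
      let c , w≈c = spans w∈W in begin
        fun (E₂ i) w y
          ≈⟨ trans (fcong (E₂ i) w≈c y) (sums (E₂ i) (suc d) c v y) ⟩
        ∑< (suc d) (λ k → c k * fun (E₂ i) (v k) y)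
          ≈⟨ ∑<-zero (suc d) (λ k k<1+d → trans (*-congˡ (rejected k (ℕₚ.≤-pred k<1+d) y)) (zeroʳ (c k))) ⟩
        0# ∎
      where
      r+d≤D : r ℕ.+ d ℕ.≤ D
      r+d≤D = ≡.subst (r ℕ.+ d ℕ.≤_) (≡.sym (≡.trans D≡ (ℕₚ.+-assoc r r d))) (ℕₚ.+-monoʳ-≤ r (ℕₚ.m≤n+m d r))
      rejected : ∀ k → k ℕ.≤ d → fun (E₂ i) (v k) ≈ᵛ 0ᵛ
      rejected k k≤d = Spectral.reject s₂ (r ℕ.+ k) i (v k)
        (ℕₚ.≤-trans (ℕₚ.+-monoʳ-≤ r k≤d) r+d≤D)
        (ℕₚ.<⇒≢ (ℕₚ.≤-<-trans (ℕₚ.+-monoʳ-≤ r k≤d) r+d<i)) (v-eigen k)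

    Formula : Vect → Set
    Formula w = ∀ i j → i ℕ.≤ d → j ℕ.≤ d →
      ⟪ fun (E₁ (r ℕ.+ i)) u , fun (E₂ (r ℕ.+ j)) w ⟫ᶠ
        ≈ 𝐢 ^ j * ι (½ ^ℚ d) * ⟪ u , w ⟫ᶠ * ι (binomial d i) * ι (binomial d j) * ι (₂F₁ i j d)

    -- The second component is the highest weight condition with which the chain for the rotated
    -- triple starts at `w`.
    formula : ∀ w → W w → fun A₃ w ≈ᵛ ι (θ D r) • w →
      ¬ ¬ (Formula w × fun (Ladder.L form (rotate t)) w ≈ᵛ 0ᵛ)
    formula w w∈W w-eigen ¬goal = W⊆Span λ spans →
      let c , w≈c = spans w∈W
          w-eigen′ = λ y → trans (w-eigen y) (*-congʳ (θ-start r d D≡))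
      in ¬goal
        ( inner-product-formula (spectral-axis s₁ r d D≡) (spectral-axis s₂ r d D≡) w c w≈c w-eigen′
        , rotated-highest (spectral-axis s₂ r d D≡) w c w≈c w-eigen′)

  module Main
    (stable : ∀ {x y} → ¬ ¬ (x ≈ y) → x ≈ y)
    {W : Vect → Set} (W-invariant : Invariant W) (W-simple : Simple W)
    (U⁻¹ : Linear) (U-U⁻¹ : ∀ v y → kron ⟦ p₁ ⟧ᴳ (fun U⁻¹ v) y ≈ v y)
    (U⁻¹-U : ∀ v y → fun U⁻¹ (kron ⟦ p₁ ⟧ᴳ v) y ≈ v y)
    (r : ℕ) (r≤D : r ℕ.≤ D)
    (minimal : ∀ i → i ℕ.< r → ¬ ¬ (∀ w → W w → sphere i ▹ w ≈ᵛ 0ᵛ)) where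
    open Invariant W-invariant
    open Form form using () renaming (⟪_,_⟫ to ⟪_,_⟫ᶠ)

    t : Triple form
    t = cubeTriple D

    Eε : ℕ → Linear
    Eε k = Conjugate.conjugate (kronᴸ ⟦ p₁ ⟧ᴳ D) U⁻¹ U-U⁻¹ U⁻¹-U (derᴸ σx D) (derᴸ σy D) σx-kron (matᴸ (lagrange k))

    sx-spectral = σx-spectral {D} U⁻¹ U-U⁻¹ U⁻¹-U
    sy-spectral = σy-spectral {D} U⁻¹ U-U⁻¹ U⁻¹-U

    -- `L u` has the `A*`-eigenvalue `θ D r + 2`, so it can only live at distance `r - 1`, where
    -- minimality of `r` forbids it. At any other distance, and everywhere if `r = 0`, the
    -- eigenvalue equation fails unless the entry is 0.
    lowered-zero : ∀ u → W u → der σz u ≈ᵛ ι (θ D r) • u → fun (Ladder.L form t) u ≈ᵛ 0ᵛ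
    lowered-zero u u∈W weight-u y = by-weight (suc (∂ (origin D) y) ℕₚ.≟ r)
      where
      x : Vect
      x = fun (Ladder.L form t) u
      x∈W : W x
      x∈W = combine∈ ½ₖ -½𝐢 {derᴸ σx D} {derᴸ σy D} σx∈ σy∈ u∈W
      x-weight : ∀ y → der σz x y ≈ (ι (θ D r) + 2ₖ) * x y
      x-weight y = trans (Ladder.A₂-L form t u y) (trans
        (+-congʳ (trans (fcong (Ladder.L form t) weight-u y) (scale (Ladder.L form t) (ι (θ D r)) u y)))
        (sym (distribʳ (x y) (ι (θ D r)) 2ₖ)))
      n : ℕ
      n = ∂ (origin D) y
      by-weight : Dec (suc n ≡ r) → x y ≈ 0#
      by-weight (yes 1+n≡r) = stable λ x≉0 → minimal n (ℕₚ.≤-reflexive 1+n≡r) λ zeros →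
        x≉0 (trans (sym (sphere-on n x y ≡.refl)) (zeros x x∈W y))
      by-weight (no 1+n≢r) = cancel-ι-0 (2ℚ ℚ.* (natℚ r ℚ.- natℚ (suc n)))
        (*-≢0 {2ℚ} {natℚ r ℚ.- natℚ (suc n)} (natℚ-suc≢0 1) (natℚ-sub≢0 (1+n≢r ∘ ≡.sym))) (begin
          ι (2ℚ ℚ.* (natℚ r ℚ.- natℚ (suc n))) * x y
            ≈⟨ *-congʳ (trans (ι-cong (θ-gap D r n)) (trans (ι-sub (θ D n) (θ D r ℚ.+ 2ℚ)) (+-congˡ (-‿cong (ι-+ (θ D r) 2ℚ))))) ⟩
          (ι (θ D n) - (ι (θ D r) + 2ₖ)) * x y
            ≈⟨ solve 3 (λ a b x → (a :- b) :* x := a :* x :- b :* x) refl (ι (θ D n)) (ι (θ D r) + 2ₖ) (x y) ⟩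
          ι (θ D n) * x y - (ι (θ D r) + 2ₖ) * x y
            ≈⟨ +-congʳ (trans (weight-der x y) (x-weight y)) ⟩
          (ι (θ D r) + 2ₖ) * x y - (ι (θ D r) + 2ₖ) * x y
            ≈⟨ -‿inverseʳ _ ⟩
          0# ∎)

    module _ {u* : Vect} (u*∈ : ∃ λ w → W w × u* ≈ᵛ sphere r ▹ w) (u*≉0 : ¬ (u* ≈ᵛ 0ᵛ)) where

      eigenvector : ∀ {F : Linear} {E : ℕ → Linear} → Spectral F E → ∀ {u} → (∃ λ w → W w × u ≈ᵛ fun (E r) w) →
        fun F u ≈ᵛ ι (θ D r) • u
      eigenvector {F} s (w , _ , u≈) y =
        trans (fcong F u≈ y) (trans (Spectral.eigen s r w r≤D y) (*-congˡ (sym (u≈ y))))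

      member : ∀ {F : Linear} {E : ℕ → Linear} → Spectral F E → (∀ {v} → W v → W (fun F v)) →
        ∀ {u} → (∃ λ w → W w × u ≈ᵛ fun (E r) w) → W u
      member s F∈ (w , w∈W , u≈) = respects (λ y → sym (u≈ y)) (projection∈ s F∈ r r≤D w∈W)

      u*∈W : W u*
      u*∈W = member σz-spectral σz∈ u*∈

      u*-weight : der σz u* ≈ᵛ ι (θ D r) • u*
      u*-weight = eigenvector σz-spectral u*∈

      u*-highest : fun (Ladder.L form t) u* ≈ᵛ 0ᵛ
      u*-highest = lowered-zero u* u*∈W u*-weight

      r+r≤D : r ℕ.+ r ℕ.≤ D
      r+r≤D = Highest.r+r≤D t σz-spectral r u* u*-weight u*-highest u*≉0

      module _ (d : ℕ) (D≡ : D ≡ r ℕ.+ r ℕ.+ d) where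

        -- The chain at `u*` is separate because it is run with `D - 2r` in place of `d`, to find
        -- the diameter, before the formulas are available at `d`.
        module First = Chain W-invariant W-simple t σx∈ σy∈ (λ Q q₁ q₂ q₃ → q₁ , q₂) sx-spectral σz-spectral
          r d D≡ u* u*∈W u*≉0 u*-weight u*-highest

        three-formulas : ∀ {u uε} → (∃ λ w → W w × u ≈ᵛ lagrange r ▹ w) → (∃ λ w → W w × uε ≈ᵛ fun (Eε r) w) →
          ¬ (u ≈ᵛ 0ᵛ) → ¬ (uε ≈ᵛ 0ᵛ) → ∀ i j → i ℕ.≤ d → j ℕ.≤ d →
          let value = λ x → product₆ (𝐢 ^ j) (ι (½ ^ℚ d)) x (ι (binomial d i)) (ι (binomial d j)) (ι (₂F₁ i j d)) in
          ¬ ¬ ( ⟪ lagrange (r ℕ.+ i) ▹ u* , sphere (r ℕ.+ j) ▹ uε ⟫ᶠ ≈ value ⟪ u* , uε ⟫ᶠ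
              × ⟪ sphere (r ℕ.+ i) ▹ uε , fun (Eε (r ℕ.+ j)) u ⟫ᶠ ≈ value ⟪ uε , u ⟫ᶠ
              × ⟪ fun (Eε (r ℕ.+ i)) u , lagrange (r ℕ.+ j) ▹ u* ⟫ᶠ ≈ value ⟪ u , u* ⟫ᶠ )
        three-formulas {u} {uε} u∈ uε∈ u≉0 uε≉0 i j i≤d j≤d ¬goal =
          -- Once around the cycle `u*`, `uε`, `u`, `u*`: each stage hands the highest weight
          -- condition to the next.
          First.formula uε uε∈W uε-weight λ (f₁ , uε-highest) →
          Chain.formula W-invariant W-simple (rotate t) σz∈ σx∈ (λ Q q₁ q₂ q₃ → q₃ , q₁) σz-spectral sy-spectral
            r d D≡ uε uε∈W uε≉0 uε-weight uε-highest u u∈W u-weight λ (f₂ , u-highest) →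
          Chain.formula W-invariant W-simple (rotate (rotate t)) σy∈ σz∈ (λ Q q₁ q₂ q₃ → q₂ , q₃) sy-spectral sx-spectral
            r d D≡ u u∈W u≉0 u-weight u-highest u* u*∈W u*-weight λ (f₃ , _) →
          ¬goal ( trans (f₁ i j i≤d j≤d) (sym (product₆-def _ _ _ _ _ _))
                , trans (f₂ i j i≤d j≤d) (sym (product₆-def _ _ _ _ _ _))
                , trans (f₃ i j i≤d j≤d) (sym (product₆-def _ _ _ _ _ _)) )
          where
          u∈W : W u
          u∈W = member sx-spectral σx∈ u∈
          uε∈W : W uε
          uε∈W = member sy-spectral σy∈ uε∈
          u-weight : der σx u ≈ᵛ ι (θ D r) • u
          u-weight = eigenvector sx-spectral u∈
          uε-weight : der σy uε ≈ᵛ ι (θ D r) • uε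
          uε-weight = eigenvector sy-spectral uε∈

-- Complex numbers

open import Defs

module ComplexNumbers where
  open import Data.Rational.Base using (∣_∣)
  open ≡ using (refl; sym; trans; cong; subst)
  open +-*-Solver using (solve; _:=_; _:+_; _:*_; _:-_; :-_; con)

  -- `x ≃ y` is by definition `IsNull` of the difference of the sequences, so its laws reduce to
  -- closure properties of null sequences.
  IsNull : (ℕ → ℚ) → Set
  IsNull a = ∀ ε → 0ℚ ℚ.< ε → ∃ λ N → ∀ n → N ≤ n → ∣ a n ∣ ℚ.< ε

  abstract
    ε/2-positive : ∀ ε → 0ℚ ℚ.< ε → 0ℚ ℚ.< ε ℚ.* ½
    ε/2-positive ε 0<ε = ℚₚ.positive⁻¹ (ε ℚ.* ½) ⦃ ℚₚ.pos*pos⇒pos ε ⦃ ℚ.positive 0<ε ⦄ ½ ⦄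

    ε/2+ε/2 : ∀ ε → ε ℚ.* ½ ℚ.+ ε ℚ.* ½ ≡ ε
    ε/2+ε/2 ε = trans (sym (ℚₚ.*-distribˡ-+ ε ½ ½)) (ℚₚ.*-identityʳ ε)

    null-cong : ∀ {a b : ℕ → ℚ} → (∀ n → a n ≡ b n) → IsNull a → IsNull b
    null-cong a≡b na ε 0<ε with na ε 0<ε
    ... | N , h = N , λ n N≤n → subst (λ p → ∣ p ∣ ℚ.< ε) (a≡b n) (h n N≤n)

    null-0 : ∀ {a : ℕ → ℚ} → (∀ n → a n ≡ 0ℚ) → IsNull a
    null-0 a≡0 ε 0<ε = 0 , λ n _ → subst (λ p → ∣ p ∣ ℚ.< ε) (sym (a≡0 n)) 0<ε

    null-+ : ∀ {a b : ℕ → ℚ} → IsNull a → IsNull b → IsNull (λ n → a n ℚ.+ b n)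
    null-+ {a} {b} na nb ε 0<ε
      with na (ε ℚ.* ½) (ε/2-positive ε 0<ε) | nb (ε ℚ.* ½) (ε/2-positive ε 0<ε)
    ... | M , f | N , g = M ℕ.⊔ N , λ n p → begin-strict
      ∣ a n ℚ.+ b n ∣        ≤⟨ ℚₚ.∣p+q∣≤∣p∣+∣q∣ (a n) (b n) ⟩
      ∣ a n ∣ ℚ.+ ∣ b n ∣    <⟨ ℚₚ.+-mono-< (f n (ℕₚ.m⊔n≤o⇒m≤o M N p)) (g n (ℕₚ.m⊔n≤o⇒n≤o M N p)) ⟩
      ε ℚ.* ½ ℚ.+ ε ℚ.* ½    ≡⟨ ε/2+ε/2 ε ⟩
      ε                      ∎
      where open ℚₚ.≤-Reasoning

    null-neg : ∀ {a : ℕ → ℚ} → IsNull a → IsNull (λ n → ℚ.- a n)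
    null-neg {a} na ε 0<ε with na ε 0<ε
    ... | N , h = N , λ n p → subst (ℚ._< ε) (sym (ℚₚ.∣-p∣≡∣p∣ (a n))) (h n p)

    ℝ-bounded : ∀ x → ∃ λ B → ℚ.Positive B × ∃ λ N → ∀ n → N ≤ n → ∣ seq x n ∣ ℚ.≤ B
    ℝ-bounded (mkℝ x cx) with cx 1ℚ (ℚₚ.positive⁻¹ 1ℚ)
    ... | N , h = 1ℚ ℚ.+ ∣ x N ∣ , ℚₚ.pos+nonNeg⇒pos 1ℚ ∣ x N ∣ ⦃ ℚₚ.∣-∣-nonNeg (x N) ⦄ , N ,
      λ n p → begin
        ∣ x n ∣                        ≡⟨ cong ∣_∣ (solve 2 (λ p q → p := (p :- q) :+ q) refl (x n) (x N)) ⟩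
        ∣ (x n ℚ.- x N) ℚ.+ x N ∣      ≤⟨ ℚₚ.∣p+q∣≤∣p∣+∣q∣ (x n ℚ.- x N) (x N) ⟩
        ∣ x n ℚ.- x N ∣ ℚ.+ ∣ x N ∣    ≤⟨ ℚₚ.+-monoˡ-≤ ∣ x N ∣ (ℚₚ.<⇒≤ (h n N p ℕₚ.≤-refl)) ⟩
        1ℚ ℚ.+ ∣ x N ∣                 ∎
      where open ℚₚ.≤-Reasoning

    scaled-bound : ∀ p q B ε (B>0 : ℚ.Positive B) → ∣ q ∣ ℚ.≤ B →
      ∣ p ∣ ℚ.< ε ℚ.* (ℚ.1/ B) ⦃ ℚₚ.pos⇒nonZero B ⦃ B>0 ⦄ ⦄ → ∣ p ℚ.* q ∣ ℚ.< ε
    scaled-bound p q B ε B>0 q≤B p<ε/B = begin-strict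
      ∣ p ℚ.* q ∣         ≡⟨ ℚₚ.∣p*q∣≡∣p∣*∣q∣ p q ⟩
      ∣ p ∣ ℚ.* ∣ q ∣     ≤⟨ ℚₚ.*-monoˡ-≤-nonNeg ∣ p ∣ ⦃ ℚₚ.∣-∣-nonNeg p ⦄ q≤B ⟩
      ∣ p ∣ ℚ.* B         <⟨ ℚₚ.*-monoˡ-<-pos B ⦃ B>0 ⦄ p<ε/B ⟩
      (ε ℚ.* B⁻¹) ℚ.* B   ≡⟨ ℚₚ.*-assoc ε B⁻¹ B ⟩
      ε ℚ.* (B⁻¹ ℚ.* B)   ≡⟨ cong (ε ℚ.*_) (ℚₚ.*-inverseˡ B ⦃ ℚₚ.pos⇒nonZero B ⦃ B>0 ⦄ ⦄) ⟩
      ε ℚ.* 1ℚ            ≡⟨ ℚₚ.*-identityʳ ε ⟩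
      ε                   ∎
      where
      open ℚₚ.≤-Reasoning
      B⁻¹ : ℚ
      B⁻¹ = (ℚ.1/ B) ⦃ ℚₚ.pos⇒nonZero B ⦃ B>0 ⦄ ⦄

    quotient-positive : ∀ ε B (B>0 : ℚ.Positive B) → 0ℚ ℚ.< ε →
      0ℚ ℚ.< ε ℚ.* (ℚ.1/ B) ⦃ ℚₚ.pos⇒nonZero B ⦃ B>0 ⦄ ⦄
    quotient-positive ε B B>0 0<ε = ℚₚ.positive⁻¹ _
      ⦃ ℚₚ.pos*pos⇒pos ε ⦃ ℚ.positive 0<ε ⦄ _ ⦃ ℚₚ.1/pos⇒pos B ⦃ B>0 ⦄ ⦄ ⦄

    null-* : ∀ {a : ℕ → ℚ} x → IsNull a → IsNull (λ n → a n ℚ.* seq x n)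
    null-* {a} x na ε 0<ε = combine (ℝ-bounded x)
      where
      combine : (∃ λ B → ℚ.Positive B × ∃ λ N → ∀ n → N ≤ n → ∣ seq x n ∣ ℚ.≤ B) →
        ∃ λ N → ∀ n → N ≤ n → ∣ a n ℚ.* seq x n ∣ ℚ.< ε
      combine (B , B>0 , M , bx) =
        let N , h = na _ (quotient-positive ε B B>0 0<ε) in
        M ℕ.⊔ N , λ n p → scaled-bound (a n) (seq x n) B ε B>0
          (bx n (ℕₚ.m⊔n≤o⇒m≤o M N p)) (h n (ℕₚ.m⊔n≤o⇒n≤o M N p))

    ≃-pointwise : ∀ {x y} → (∀ n → seq x n ≡ seq y n) → x ≃ y
    ≃-pointwise {x} {y} h = null-0 λ n → trans (cong (ℚ._- seq y n) (h n)) (ℚₚ.+-inverseʳ (seq y n))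

    ≃-sym : ∀ {x y} → x ≃ y → y ≃ x
    ≃-sym {x} {y} h =
      null-cong (λ n → solve 2 (λ x y → :- (x :- y) := y :- x) refl (seq x n) (seq y n)) (null-neg h)

    ≃-trans : ∀ {x y z} → x ≃ y → y ≃ z → x ≃ z
    ≃-trans {x} {y} {z} p q =
      null-cong (λ n → solve 3 (λ x y z → (x :- y) :+ (y :- z) := x :- z) refl (seq x n) (seq y n) (seq z n))
        (null-+ p q)

    +ᵣ-cong : ∀ {x x′ y y′} → x ≃ x′ → y ≃ y′ → x +ᵣ y ≃ x′ +ᵣ y′
    +ᵣ-cong {x} {x′} {y} {y′} p q =
      null-cong (λ n → solve 4 (λ x x′ y y′ → (x :- x′) :+ (y :- y′) := (x :+ y) :- (x′ :+ y′)) refl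
                         (seq x n) (seq x′ n) (seq y n) (seq y′ n))
        (null-+ p q)

    -ᵣ-cong : ∀ {x x′} → x ≃ x′ → -ᵣ x ≃ -ᵣ x′
    -ᵣ-cong {x} {x′} p =
      null-cong (λ n → solve 2 (λ x x′ → :- (x :- x′) := (:- x) :- (:- x′)) refl (seq x n) (seq x′ n))
        (null-neg p)

    *ᵣ-cong : ∀ {x x′ y y′} → x ≃ x′ → y ≃ y′ → x *ᵣ y ≃ x′ *ᵣ y′
    *ᵣ-cong {x} {x′} {y} {y′} p q =
      null-cong (λ n → solve 4 (λ x x′ y y′ → (x :- x′) :* y :+ (y :- y′) :* x′ := (x :* y) :- (x′ :* y′)) refl
                         (seq x n) (seq x′ n) (seq y n) (seq y′ n))
        (null-+ (null-* y p) (null-* x′ q))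

    -- From the moduli of convergence one reads off an index N at which
    -- |x N - y N| < ε/2 decides whether |x n - y n| < ε eventually.
    ≃-stable : ∀ {x y} → ¬ ¬ (x ≃ y) → x ≃ y
    ≃-stable {mkℝ x cx} {mkℝ y cy} ¬¬x≃y ε 0<ε
      with cx (ε ℚ.* ½ ℚ.* ½ ℚ.* ½) ε/8>0 | cy (ε ℚ.* ½ ℚ.* ½ ℚ.* ½) ε/8>0
      where
      ε/8>0 : 0ℚ ℚ.< ε ℚ.* ½ ℚ.* ½ ℚ.* ½
      ε/8>0 = ε/2-positive _ (ε/2-positive _ (ε/2-positive _ 0<ε))
    ... | M , f | N , g = K , bound
      where
      open ℚₚ.≤-Reasoning
      K : ℕ
      K = M ℕ.⊔ N
      ε/4 : ℚ
      ε/4 = ε ℚ.* ½ ℚ.* ½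
      δ : ℕ → ℚ
      δ n = x n ℚ.- y n
      move : ∀ m n → K ≤ m → K ≤ n → ∣ δ m ∣ ℚ.< ε/4 ℚ.+ ∣ δ n ∣
      move m n p q = begin-strict
        ∣ δ m ∣
          ≡⟨ cong ∣_∣ (solve 4 (λ a b c d → a :- b := ((a :- c) :+ (d :- b)) :+ (c :- d)) refl
               (x m) (y m) (x n) (y n)) ⟩
        ∣ ((x m ℚ.- x n) ℚ.+ (y n ℚ.- y m)) ℚ.+ δ n ∣
          ≤⟨ ℚₚ.∣p+q∣≤∣p∣+∣q∣ ((x m ℚ.- x n) ℚ.+ (y n ℚ.- y m)) (δ n) ⟩
        ∣ (x m ℚ.- x n) ℚ.+ (y n ℚ.- y m) ∣ ℚ.+ ∣ δ n ∣
          ≤⟨ ℚₚ.+-monoˡ-≤ ∣ δ n ∣ (ℚₚ.∣p+q∣≤∣p∣+∣q∣ (x m ℚ.- x n) (y n ℚ.- y m)) ⟩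
        ∣ x m ℚ.- x n ∣ ℚ.+ ∣ y n ℚ.- y m ∣ ℚ.+ ∣ δ n ∣
          <⟨ ℚₚ.+-monoˡ-< ∣ δ n ∣ (ℚₚ.+-mono-<
               (f m n (ℕₚ.m⊔n≤o⇒m≤o M N p) (ℕₚ.m⊔n≤o⇒m≤o M N q))
               (g n m (ℕₚ.m⊔n≤o⇒n≤o M N q) (ℕₚ.m⊔n≤o⇒n≤o M N p))) ⟩
        ε/4 ℚ.* ½ ℚ.+ ε/4 ℚ.* ½ ℚ.+ ∣ δ n ∣
          ≡⟨ cong (ℚ._+ ∣ δ n ∣) (ε/2+ε/2 ε/4) ⟩
        ε/4 ℚ.+ ∣ δ n ∣ ∎
      small : ∣ δ K ∣ ℚ.< ε ℚ.* ½
      small with ∣ δ K ∣ ℚₚ.<? ε ℚ.* ½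
      ... | yes p = p
      ... | no ¬p = contradiction (λ x≃y → ¬p (eventually x≃y)) ¬¬x≃y
        where
        eventually : mkℝ x cx ≃ mkℝ y cy → ∣ δ K ∣ ℚ.< ε ℚ.* ½
        eventually x≃y with x≃y ε/4 (ε/2-positive _ (ε/2-positive _ 0<ε))
        ... | J , h = begin-strict
          ∣ δ K ∣                         <⟨ move K (K ℕ.⊔ J) ℕₚ.≤-refl (ℕₚ.m≤m⊔n K J) ⟩
          ε/4 ℚ.+ ∣ δ (K ℕ.⊔ J) ∣         <⟨ ℚₚ.+-monoʳ-< ε/4 (h (K ℕ.⊔ J) (ℕₚ.m≤n⊔m K J)) ⟩
          ε/4 ℚ.+ ε/4                     ≡⟨ ε/2+ε/2 (ε ℚ.* ½) ⟩
          ε ℚ.* ½                         ∎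
      bound : ∀ n → K ≤ n → ∣ δ n ∣ ℚ.< ε
      bound n p = begin-strict
        ∣ δ n ∣                  <⟨ move n K p ℕₚ.≤-refl ⟩
        ε/4 ℚ.+ ∣ δ K ∣          <⟨ ℚₚ.+-monoʳ-< ε/4 small ⟩
        ε/4 ℚ.+ ε ℚ.* ½          ≤⟨ ℚₚ.+-monoˡ-≤ (ε ℚ.* ½) ε/4≤ε/2 ⟩
        ε ℚ.* ½ ℚ.+ ε ℚ.* ½      ≡⟨ ε/2+ε/2 ε ⟩
        ε                        ∎
        where
        ε/4≤ε/2 : ε/4 ℚ.≤ ε ℚ.* ½
        ε/4≤ε/2 = begin
          ε/4             ≡⟨ sym (ℚₚ.+-identityʳ ε/4) ⟩
          ε/4 ℚ.+ 0ℚ      ≤⟨ ℚₚ.+-monoʳ-≤ ε/4 (ℚₚ.<⇒≤ (ε/2-positive _ (ε/2-positive _ 0<ε))) ⟩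
          ε/4 ℚ.+ ε/4     ≡⟨ ε/2+ε/2 (ε ℚ.* ½) ⟩
          ε ℚ.* ½         ∎

  -- Wrapping _≈_ in a record keeps z and w inferable from the type of a proof.
  infix 4 _≋_
  record _≋_ (z w : ℂ) : Set where
    constructor equal
    field unwrap : z ≈ w
  open _≋_ public

  abstract
    -- The operations act term by term on the sequences, so the ring laws of ℂ follow from
    -- polynomial identities in ℚ without estimates.
    ≋-pointwise : ∀ {z w} → (∀ n → seq (re z) n ≡ seq (re w) n) →
      (∀ n → seq (im z) n ≡ seq (im w) n) → z ≋ w
    ≋-pointwise {z} {w} p q = equal (≃-pointwise {re z} {re w} p , ≃-pointwise {im z} {im w} q)

    ≋-stable : ∀ {z w} → ¬ ¬ (z ≋ w) → z ≋ w
    ≋-stable {z} {w} ¬¬z≈w = equal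
      ( ≃-stable {re z} {re w} (λ ¬p → ¬¬z≈w λ e → ¬p (proj₁ (unwrap e)))
      , ≃-stable {im z} {im w} (λ ¬q → ¬¬z≈w λ e → ¬q (proj₂ (unwrap e))))

    ≋-refl : ∀ {z} → z ≋ z
    ≋-refl {z} = ≋-pointwise {z} {z} (λ _ → refl) (λ _ → refl)

    ≋-sym : ∀ {z w} → z ≋ w → w ≋ z
    ≋-sym {z} {w} (equal (p , q)) = equal (≃-sym {re z} {re w} p , ≃-sym {im z} {im w} q)

    ≋-trans : ∀ {z w v} → z ≋ w → w ≋ v → z ≋ v
    ≋-trans {z} {w} {v} (equal (p , q)) (equal (p′ , q′)) =
      equal (≃-trans {re z} {re w} {re v} p p′ , ≃-trans {im z} {im w} {im v} q q′)

    +-cong : ∀ {z z′ w w′} → z ≋ z′ → w ≋ w′ → z + w ≋ z′ + w′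
    +-cong {z} {z′} {w} {w′} (equal (p , q)) (equal (p′ , q′)) = equal
      ( +ᵣ-cong {re z} {re z′} {re w} {re w′} p p′
      , +ᵣ-cong {im z} {im z′} {im w} {im w′} q q′)

    *-cong : ∀ {z z′ w w′} → z ≋ z′ → w ≋ w′ → z * w ≋ z′ * w′
    *-cong {z} {z′} {w} {w′} (equal (p , q)) (equal (p′ , q′)) = equal
      ( +ᵣ-cong {re z *ᵣ re w} {re z′ *ᵣ re w′} { -ᵣ (im z *ᵣ im w)} { -ᵣ (im z′ *ᵣ im w′)}
          (*ᵣ-cong {re z} {re z′} {re w} {re w′} p p′)
          (-ᵣ-cong {im z *ᵣ im w} {im z′ *ᵣ im w′} (*ᵣ-cong {im z} {im z′} {im w} {im w′} q q′))
      , +ᵣ-cong {re z *ᵣ im w} {re z′ *ᵣ im w′} {im z *ᵣ re w} {im z′ *ᵣ re w′}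
          (*ᵣ-cong {re z} {re z′} {im w} {im w′} p q′)
          (*ᵣ-cong {im z} {im z′} {re w} {re w′} q p′))

    -‿cong : ∀ {z z′} → z ≋ z′ → - z ≋ - z′
    -‿cong {z} {z′} (equal (p , q)) = equal (-ᵣ-cong {re z} {re z′} p , -ᵣ-cong {im z} {im z′} q)

    conj-cong : ∀ {z z′} → z ≋ z′ → conj z ≋ conj z′
    conj-cong {z} {z′} (equal (p , q)) = equal (p , -ᵣ-cong {im z} {im z′} q)

    +-assoc : ∀ x y z → (x + y) + z ≋ x + (y + z)
    +-assoc x y z = ≋-pointwise
      (λ n → ℚₚ.+-assoc (seq (re x) n) (seq (re y) n) (seq (re z) n))
      (λ n → ℚₚ.+-assoc (seq (im x) n) (seq (im y) n) (seq (im z) n))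

    +-comm : ∀ x y → x + y ≋ y + x
    +-comm x y = ≋-pointwise
      (λ n → ℚₚ.+-comm (seq (re x) n) (seq (re y) n))
      (λ n → ℚₚ.+-comm (seq (im x) n) (seq (im y) n))

    +-identityˡ : ∀ x → 0ℂ + x ≋ x
    +-identityˡ x = ≋-pointwise 
      (λ n → ℚₚ.+-identityˡ (seq (re x) n)) (λ n → ℚₚ.+-identityˡ (seq (im x) n))

    +-inverseˡ : ∀ x → (- x) + x ≋ 0ℂ
    +-inverseˡ x = ≋-pointwise 
      (λ n → ℚₚ.+-inverseˡ (seq (re x) n)) (λ n → ℚₚ.+-inverseˡ (seq (im x) n))

    *-assoc : ∀ x y z → (x * y) * z ≋ x * (y * z)
    *-assoc x y z = ≋-pointwise
      (λ n → solve 6 (λ a b c d e f →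
          (a :* c :+ :- (b :* d)) :* e :+ :- ((a :* d :+ b :* c) :* f)
        := a :* (c :* e :+ :- (d :* f)) :+ :- (b :* (c :* f :+ d :* e))) refl
        (seq (re x) n) (seq (im x) n) (seq (re y) n) (seq (im y) n) (seq (re z) n) (seq (im z) n))
      (λ n → solve 6 (λ a b c d e f →
          (a :* c :+ :- (b :* d)) :* f :+ (a :* d :+ b :* c) :* e
        := a :* (c :* f :+ d :* e) :+ b :* (c :* e :+ :- (d :* f))) refl
        (seq (re x) n) (seq (im x) n) (seq (re y) n) (seq (im y) n) (seq (re z) n) (seq (im z) n))

    *-comm : ∀ x y → x * y ≋ y * x
    *-comm x y = ≋-pointwise
      (λ n → solve 4 (λ a b c d → a :* c :+ :- (b :* d) := c :* a :+ :- (d :* b)) refl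
        (seq (re x) n) (seq (im x) n) (seq (re y) n) (seq (im y) n))
      (λ n → solve 4 (λ a b c d → a :* d :+ b :* c := c :* b :+ d :* a) refl
        (seq (re x) n) (seq (im x) n) (seq (re y) n) (seq (im y) n))

    *-identityˡ : ∀ x → 1ℂ * x ≋ x
    *-identityˡ x = ≋-pointwise
      (λ n → solve 2 (λ a b → con 1ℚ :* a :+ :- (con 0ℚ :* b) := a) refl (seq (re x) n) (seq (im x) n))
      (λ n → solve 2 (λ a b → con 1ℚ :* b :+ con 0ℚ :* a := b) refl (seq (re x) n) (seq (im x) n))

    *-distribˡ-+ : ∀ x y z → x * (y + z) ≋ x * y + x * z
    *-distribˡ-+ x y z = ≋-pointwise
      (λ n → solve 6 (λ a b c d e f →
          a :* (c :+ e) :+ :- (b :* (d :+ f)) := (a :* c :+ :- (b :* d)) :+ (a :* e :+ :- (b :* f))) refl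
        (seq (re x) n) (seq (im x) n) (seq (re y) n) (seq (im y) n) (seq (re z) n) (seq (im z) n))
      (λ n → solve 6 (λ a b c d e f →
          a :* (d :+ f) :+ b :* (c :+ e) := (a :* d :+ b :* c) :+ (a :* f :+ b :* e)) refl
        (seq (re x) n) (seq (im x) n) (seq (re y) n) (seq (im y) n) (seq (re z) n) (seq (im z) n))

    conj-+ : ∀ x y → conj (x + y) ≋ conj x + conj y
    conj-+ x y = ≋-pointwise 
      (λ _ → refl) (λ n → ℚₚ.neg-distrib-+ (seq (im x) n) (seq (im y) n))

    conj-* : ∀ x y → conj (x * y) ≋ conj x * conj y
    conj-* x y = ≋-pointwise
      (λ n → solve 4 (λ a b c d → a :* c :+ :- (b :* d) := a :* c :+ :- ((:- b) :* (:- d))) refl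
        (seq (re x) n) (seq (im x) n) (seq (re y) n) (seq (im y) n))
      (λ n → solve 4 (λ a b c d → :- (a :* d :+ b :* c) := a :* (:- d) :+ (:- b) :* c) refl
        (seq (re x) n) (seq (im x) n) (seq (re y) n) (seq (im y) n))

    conj-involutive : ∀ x → conj (conj x) ≋ x
    conj-involutive x = ≋-pointwise (λ _ → refl) (λ n → solve 1 (λ a → :- (:- a) := a) refl (seq (im x) n))

  ℂ-commutativeRing : CommutativeRing 0ℓ 0ℓ
  ℂ-commutativeRing = record
    { Carrier = ℂ ; _≈_ = _≋_ ; _+_ = _+_ ; _*_ = _*_ ; -_ = -_ ; 0# = 0ℂ ; 1# = 1ℂ
    ; isCommutativeRing = record
      { isRing = record
        { +-isAbelianGroup = record
          { isGroup = record
            { isMonoid = record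
              { isSemigroup = record
                { isMagma = record
                  { isEquivalence = record { refl = ≋-refl ; sym = ≋-sym ; trans = ≋-trans }
                  ; ∙-cong = +-cong }
                ; assoc = +-assoc }
              ; identity = +-identityˡ , λ x → ≋-trans (+-comm x 0ℂ) (+-identityˡ x) }
            ; inverse = +-inverseˡ , λ x → ≋-trans (+-comm x (- x)) (+-inverseˡ x)
            ; ⁻¹-cong = -‿cong }
          ; comm = +-comm }
        ; *-cong = *-cong
        ; *-assoc = *-assoc
        ; *-identity = *-identityˡ , λ x → ≋-trans (*-comm x 1ℂ) (*-identityˡ x)
        ; distrib = *-distribˡ-+ , λ x y z →
            ≋-trans (*-comm (y + z) x) (≋-trans (*-distribˡ-+ x y z) (+-cong (*-comm x y) (*-comm x z))) }
      ; *-comm = *-comm } }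

open ComplexNumbers

open import Data.Fin.Subset using (Subset; _∈_; inside; outside) renaming (∣_∣ to card)
open import Data.Vec.Base using (here; there)
open import Function.Bundles using (Equivalence)
open ≡ using (refl)

-- The complex numbers as scalars, and counting an interval

ℂ-scalars : Scalars
ℂ-scalars = record
  { commutativeRing = ℂ-commutativeRing
  ; gauss      = λ (p , q) → fromℚ p +i fromℚ q
  ; gauss-+    = λ _ _ _ _ → ≋-pointwise (λ _ → refl) (λ _ → refl)
  ; gauss-*    = λ _ _ _ _ → ≋-pointwise (λ _ → refl) (λ _ → refl)
  ; gauss-neg  = λ _ _ → ≋-pointwise (λ _ → refl) (λ _ → refl)
  ; gauss-0    = ≋-refl
  ; gauss-1    = ≋-refl
  ; conj       = conj
  ; conj-cong  = conj-cong
  ; conj-+     = conj-+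
  ; conj-*     = conj-*
  ; conj-conj  = conj-involutive
  ; conj-gauss = λ _ _ → ≋-pointwise (λ _ → refl) (λ _ → refl) }

ℂ-cubeSum : CubeSum ℂ-scalars
ℂ-cubeSum = record { ∑ = ∑ ; ∑-nil = λ _ → ≋-refl ; ∑-cons = λ _ → ≋-refl }

-- Converts a description of the support of `W` as an interval of indices into its cardinality. The
-- truncated difference covers empty intervals, where `b ≤ a`.
card-interval : ∀ {n} (S : Subset n) a b → b ≤ n →
  (∀ i → i ∈ S → a ≤ toℕ i × toℕ i ℕ.< b) → (∀ i → a ≤ toℕ i → toℕ i ℕ.< b → i ∈ S) → card S ≡ b ℕ.∸ a
card-interval []            zero    zero    _   _ _ = refl
card-interval []            (suc a) zero    _   _ _ = refl
card-interval (inside ∷ S)  a       zero    _   f _ with () ← proj₂ (f zero here)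
card-interval (outside ∷ S) a       zero    _   f g = ≡.trans
  (card-interval S 0 0 z≤n (λ i h → contradiction (proj₂ (f (suc i) (there h))) λ ()) (λ i _ ()))
  (≡.sym (ℕₚ.0∸n≡0 a))
card-interval (outside ∷ S) zero    (suc b) _   f g with () ← g zero z≤n (s≤s z≤n)
card-interval (inside ∷ S)  zero    (suc b) b≤n f g = ≡.cong suc (card-interval S 0 b (ℕₚ.≤-pred b≤n)
  (λ i h → z≤n , ℕₚ.≤-pred (proj₂ (f (suc i) (there h))))
  (λ i _ i<b → drop (g (suc i) z≤n (s≤s i<b))))
  where
  drop : ∀ {i s} → suc i ∈ (s ∷ S) → i ∈ S
  drop (there h) = h
card-interval (inside ∷ S)  (suc a) (suc b) _   f g with () ← proj₁ (f zero here)
card-interval (outside ∷ S) (suc a) (suc b) b≤n f g = card-interval S a b (ℕₚ.≤-pred b≤n)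
  (λ i h → ℕₚ.≤-pred (proj₁ (f (suc i) (there h))) , ℕₚ.≤-pred (proj₂ (f (suc i) (there h))))
  (λ i a≤i i<b → drop (g (suc i) (s≤s a≤i) (s≤s i<b)))
  where
  drop : ∀ {i s} → suc i ∈ (s ∷ S) → i ∈ S
  drop (there h) = h

open ScalarTheory ℂ-scalars using () renaming (_^_ to _^ᴷ_)

^-agrees : ∀ z n → z ^ᴷ n ≡ z ^ n
^-agrees z zero    = refl
^-agrees z (suc n) = ≡.cong (z *_) (^-agrees z n)

open ScalarTheory ℂ-scalars using (product₆; product₆-def)

-- The factors are matched one at a time while they are still variables, so the concrete products
-- are never unfolded for comparison.
product₆-agrees : ∀ {p p′ q q′ r r′ s s′ t t′ u u′} → p ≡ p′ → q ≡ q′ → r ≡ r′ → s ≡ s′ → t ≡ t′ → u ≡ u′ →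
  product₆ p q r s t u ≋ p′ * q′ * r′ * s′ * t′ * u′
product₆-agrees {p} {_} {q} {_} {r} {_} {s} {_} {t} {_} {u} refl refl refl refl refl refl = product₆-def p q r s t u

-- From complex matrices and modules to the abstract setting

module Bridge (D : ℕ) where
  open CubeTheory ℂ-scalars ℂ-cubeSum
  open ModuleTheory ℂ-scalars ℂ-cubeSum D
  open Vectors ℂ-scalars (X D) using (Linear; fun; fcong)

  wrap : ∀ (v w : V D) → v ≈ᵥ w → ∀ y → v y ≋ w y
  wrap v w v≈w y = equal {v y} {w y} (v≈w y)

  wrapₘ : ∀ (M N : Mat D) → M ≈ₘ N → ∀ y z → M y z ≋ N y z
  wrapₘ M N M≈N y z = equal {M y z} {N y z} (M≈N y z)

  A-der : ∀ (v : V D) y → (A · v) y ≋ der σx v y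
  A-der = adjacency-der

  A*-der : ∀ (v : V D) y → (A* · v) y ≋ der σz v y
  A*-der v y = ≋-trans (▹-diag (λ y → ι (θ D (∂ (origin D) y))) v y) (weight-der v y)

  P-kron : ∀ (v : V D) y → (P · v) y ≋ kron ⟦ p₁ ⟧ᴳ v y
  P-kron = kronecker-power ⟦ p₁ ⟧ᴳ P ≋-refl P-cons
    where
    P₁≋ : ∀ a b → P₁ a b ≋ ⟦ p₁ ⟧ᴳ a b
    P₁≋ zero       zero       = ≋-refl
    P₁≋ zero       (suc zero) = ≋-refl
    P₁≋ (suc zero) zero       = ≋-pointwise (λ _ → refl) (λ _ → refl)
    P₁≋ (suc zero) (suc zero) = ≋-refl
    P-cons : ∀ {D} a b (y z : X D) → P (a ∷ y) (b ∷ z) ≋ ⟦ p₁ ⟧ᴳ a b * P y z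
    P-cons a b y z = *-cong (P₁≋ a b) (≋-refl {P y z})

  ≋-reflexive : ∀ {z w} → z ≡ w → z ≋ w
  ≋-reflexive refl = ≋-refl

  pairing-agrees : ∀ {M M′ N N′ : Mat D} → M ≡ M′ → N ≡ N′ → ∀ v w → ⟪ M ▹ v , N ▹ w ⟫ ≡ ⟨ M′ · v , N′ · w ⟩
  pairing-agrees refl refl v w = refl

  E-lagrange : ∀ i → lagrange i ≡ E {D} i
  E-lagrange i = refl

  E*-sphere : ∀ i → sphere i ≡ E* {D} i
  E*-sphere i = refl

  module Scaled (P⁻¹ : Mat D) (inverse : IsInverse P P⁻¹) where

    U⁻¹ : Linear
    U⁻¹ = matᴸ P⁻¹

    kron-U⁻¹ : ∀ v y → kron ⟦ p₁ ⟧ᴳ (fun U⁻¹ v) y ≋ v y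
    kron-U⁻¹ v y = ≋-trans (≋-sym (P-kron (P⁻¹ · v) y)) (≋-trans (≋-sym (▹-* P P⁻¹ v y))
      (≋-trans (▹-congˡ (wrapₘ (P *ₘ P⁻¹) Iₘ (proj₁ inverse)) v y) (identity-▹ v y)))

    U⁻¹-kron : ∀ v y → fun U⁻¹ (kron ⟦ p₁ ⟧ᴳ v) y ≋ v y
    U⁻¹-kron v y = ≋-trans (fcong U⁻¹ (λ y → ≋-sym (P-kron v y)) y) (≋-trans (≋-sym (▹-* P⁻¹ P v y))
      (≋-trans (▹-congˡ (wrapₘ (P⁻¹ *ₘ P) Iₘ (proj₂ inverse)) v y) (identity-▹ v y)))

    Eε-conjugate : ∀ k v y → (Eε P⁻¹ k · v) y ≋ (P⁻¹ ▹ lagrange k ▹ kron ⟦ p₁ ⟧ᴳ v) y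
    Eε-conjugate k v y = ≋-trans (▹-* P⁻¹ (E k *ₘ P) v y)
      (fcong U⁻¹ (λ y → ≋-trans (▹-* (E k) P v y) (fcong (matᴸ (lagrange k)) (P-kron v) y)) y)

  invariant⇒module : ∀ {U : Pred (V D) 0ℓ} → Invariant U → IsModule U
  invariant⇒module {U} inv = record
    { isSubspace = record
      { ≈-closed = λ {v} {w} v≈w → respects (wrap v w v≈w)
      ; 0-closed = zero∈
      ; +-closed = λ {v} {w} v∈U w∈U → respects (λ y → +-cong (*-identityˡ (v y)) (*-identityˡ (w y)))
          (linear∈ 1ℂ 1ℂ v∈U w∈U)
      ; •-closed = λ c → scale∈ c }
    ; T-closed = closed }
    where
    open Invariant inv
    closed : ∀ {B w} → T B → U w → U (B · w)
    closed {w = w} gen₁              h = respects (λ y → ≋-sym (A-der w y)) (σx∈ h)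
    closed {w = w} gen₂              h = respects (λ y → ≋-sym (A*-der w y)) (σz∈ h)
    closed {w = w} unit              h = respects (λ y → ≋-sym (identity-▹ w y)) h
    closed {w = w} (add {M} {N} m n) h = respects
      (λ y → ≋-trans (+-cong (*-identityˡ ((M · w) y)) (*-identityˡ ((N · w) y))) (≋-sym (▹-+ M N w y)))
      (linear∈ 1ℂ 1ℂ (closed m h) (closed n h))
    closed {w = w} (mul {M} {N} m n) h = respects (λ y → ≋-sym (▹-* M N w y)) (closed m (closed n h))
    closed {w = w} (scale c {M} m)   h = respects (λ y → ≋-sym (▹-• c M w y)) (scale∈ c (closed m h))
    closed {w = w} (resp {M} {N} M≈N m) h = respects (▹-congˡ (wrapₘ M N M≈N) w) (closed m h)

  module⇒invariant : ∀ {U : Pred (V D) 0ℓ} → IsModule U → Invariant U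
  module⇒invariant isModule = record
    { respects = λ {v} {w} v≈w → ≈-closed {v} {w} (λ y → unwrap (v≈w y))
    ; zero∈   = 0-closed
    ; linear∈ = λ a b v∈U w∈U → +-closed (•-closed a v∈U) (•-closed b w∈U)
    ; σx∈     = λ {v} v∈U → ≈-closed {A · v} {der σx v} (λ y → unwrap (A-der v y)) (T-closed gen₁ v∈U)
    ; σz∈     = λ {v} v∈U → ≈-closed {A* · v} {der σz v} (λ y → unwrap (A*-der v y)) (T-closed gen₂ v∈U) }
    where
    open IsModule isModule
    open IsSubspace isSubspace

  -- The nonzero vector `u` refutes `IsZero U`, and a refutation of `W ⊆ U` refutes `U ≐ W`, so the
  -- negatively stated simplicity applies directly.
  irreducible⇒simple : ∀ {W : Pred (V D) 0ℓ} → IsIrreducible W → Simple W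
  irreducible⇒simple irr U U-invariant U⊆W u u∈U u≉0 ¬W⊆U =
    IsIrreducible.simple irr U (invariant⇒module U-invariant) U⊆W
      ( (λ U-zero → u≉0 (wrap u 0ᵥ (U-zero u u∈U)))
      , (λ (_ , W⊆U) → ¬W⊆U W⊆U) )

  sphere-zero⇒isZero : ∀ {W : Pred (V D) 0ℓ} i → (∀ w → W w → ∀ y → (sphere i ▹ w) y ≋ 0ℂ) → IsZero (E* i ⟪ W ⟫)
  sphere-zero⇒isZero i zeros v (w , w∈W , v≈) y =
    unwrap (≋-trans (wrap v (E* i · w) v≈ y) (zeros w w∈W y))

  isZero⇒sphere-zero : ∀ {W : Pred (V D) 0ℓ} i → IsZero (E* i ⟪ W ⟫) → ∀ w → W w → ∀ y → (sphere i ▹ w) y ≋ 0ℂ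
  isZero⇒sphere-zero i isZero w w∈W =
    wrap (E* i · w) 0ᵥ (isZero (E* i · w) (w , w∈W , λ y → unwrap (≋-refl {(E* i · w) y})))

-- The three inner product formulas

theorem11p6 :
    (D : ℕ) → .{{_ : NonZero D}} →
    (P⁻¹ : Mat D) → IsInverse P P⁻¹ →
    (W : Pred (V D) 0ℓ) → IsIrreducible W →
    (r d : ℕ) → IsEndpoint W r → IsDiameter W d →
    (i j : ℕ) → i ≤ d → j ≤ d →
    (u u* uε : V D) →
    (E r ⟪ W ⟫) u → (E* r ⟪ W ⟫) u* → (Eε P⁻¹ r ⟪ W ⟫) uε →
    ¬ (u ≈ᵥ 0ᵥ) → ¬ (u* ≈ᵥ 0ᵥ) → ¬ (uε ≈ᵥ 0ᵥ) →
    (⟨ E (r ℕ.+ i) · u* , E* (r ℕ.+ j) · uε ⟩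
      ≈ 𝐢 ^ j * ι (½ ^ℚ d) * ⟨ u* , uε ⟩ * ιℕ (d C i) * ιℕ (d C j) * ι (₂F₁ i j d))
    × (⟨ E* (r ℕ.+ i) · uε , Eε P⁻¹ (r ℕ.+ j) · u ⟩
      ≈ 𝐢 ^ j * ι (½ ^ℚ d) * ⟨ uε , u ⟩ * ιℕ (d C i) * ιℕ (d C j) * ι (₂F₁ i j d))
    × (⟨ Eε P⁻¹ (r ℕ.+ i) · u , E (r ℕ.+ j) · u* ⟩
      ≈ 𝐢 ^ j * ι (½ ^ℚ d) * ⟨ u , u* ⟩ * ιℕ (d C i) * ιℕ (d C j) * ι (₂F₁ i j d))
theorem11p6 D P⁻¹ inverse W irr r d endpoint (S , S-spec , S-card) i j i≤d j≤d u u* uε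
  (w , w∈W , u≈) (w* , w*∈W , u*≈) (wε , wε∈W , uε≈) u≉0 u*≉0 uε≉0 =
    unwrap formula₁ , unwrap formula₂ , unwrap formula₃
  where
  open IsEndpoint endpoint
  open Bridge D
  open Scaled P⁻¹ inverse
  open CubeTheory ℂ-scalars ℂ-cubeSum using (cubeForm; lagrange; sphere; _▹_)
  open ModuleTheory ℂ-scalars ℂ-cubeSum D
  open Vectors.Form (cubeForm D) using (⟪⟫-cong)

  W-invariant : Invariant W
  W-invariant = module⇒invariant (IsIrreducible.isModule irr)

  module M = Main ≋-stable W-invariant (irreducible⇒simple irr) U⁻¹ kron-U⁻¹ U⁻¹-kron r r≤D
    -- Contraposition: were `E* i` not zero on `W` for some `i < r`, the endpoint would be at most
    -- `i`. This yields the vanishing up to double negation.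
    (λ i i<r ¬zeros → ℕₚ.<⇒≱ i<r (minimal i (ℕₚ.≤-trans (ℕₚ.<⇒≤ i<r) r≤D)
      (λ isZero → ¬zeros (isZero⇒sphere-zero i isZero))))

  u*∈ : ∃ λ w → W w × (∀ y → u* y ≋ (sphere r ▹ w) y)
  u*∈ = w* , w*∈W , wrap u* (E* r · w*) u*≈

  u*≉0′ : ¬ (∀ y → u* y ≋ 0ℂ)
  u*≉0′ h = u*≉0 λ y → unwrap (h y)

  -- `d` is only known as a cardinality, so `D - 2r` has its own name until the count of `S`
  -- identifies the two.
  m : ℕ
  m = D ℕ.∸ (r ℕ.+ r)

  D≡ : D ≡ r ℕ.+ r ℕ.+ m
  D≡ = ≡.sym (ℕₚ.m+[n∸m]≡n (M.r+r≤D u*∈ u*≉0′))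

  module F = M.First u*∈ u*≉0′ m D≡

  r+m≤D : r ℕ.+ m ≤ D
  r+m≤D = ≡.subst (r ℕ.+ m ≤_) (≡.sym (≡.trans D≡ (ℕₚ.+-assoc r r m))) (ℕₚ.+-monoʳ-≤ r (ℕₚ.m≤n+m m r))

  S-interval : card S ≡ suc (r ℕ.+ m) ℕ.∸ r
  S-interval = card-interval S r (suc (r ℕ.+ m)) (s≤s r+m≤D) bounds members
    where
    -- The lower bound is minimality of the endpoint; the upper bound holds because the projections
    -- beyond the end of the string vanish on `W`.
    bounds : ∀ i → i ∈ S → r ≤ toℕ i × toℕ i ℕ.< suc (r ℕ.+ m)
    bounds i i∈S = minimal (toℕ i) (ℕₚ.≤-pred (Finₚ.toℕ<n i)) nonzero , s≤s (ℕₚ.≮⇒≥ λ r+m<i →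
      F.E₂-zero (toℕ i) r+m<i λ zeros → nonzero (sphere-zero⇒isZero (toℕ i) zeros))
      where
      nonzero : ¬ IsZero (E* (toℕ i) ⟪ W ⟫)
      nonzero = Equivalence.to (S-spec i) i∈S
    members : ∀ i → r ≤ toℕ i → toℕ i ℕ.< suc (r ℕ.+ m) → i ∈ S
    members i r≤i i≤r+m = Equivalence.from (S-spec i) λ isZero →
      F.E₂-nonzero (toℕ i ℕ.∸ r) (ℕₚ.≤-trans (ℕₚ.∸-monoˡ-≤ r (ℕₚ.≤-pred i≤r+m)) (ℕₚ.≤-reflexive (ℕₚ.m+n∸m≡n r m)))
        (≡.subst (λ k → ∀ w → W w → ∀ y → (sphere k ▹ w) y ≋ 0ℂ) (≡.sym (ℕₚ.m+[n∸m]≡n r≤i))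
          (isZero⇒sphere-zero (toℕ i) isZero))

  d≡m : d ≡ m
  d≡m = ℕₚ.suc-injective (≡.trans (≡.sym S-card) (≡.trans S-interval
    (≡.trans (ℕₚ.+-∸-assoc 1 (ℕₚ.m≤m+n r m)) (≡.cong suc (ℕₚ.m+n∸m≡n r m)))))

  -- The three equations hold here only under a double negation; `≋-stable` removes it from each of
  -- them separately below.
  formulas = M.three-formulas u*∈ u*≉0′ d (≡.trans D≡ (≡.cong (r ℕ.+ r ℕ.+_) (≡.sym d≡m))) {u} {uε}
    (w , w∈W , wrap u (E r · w) u≈)
    (wε , wε∈W , λ y → ≋-trans (wrap uε (Eε P⁻¹ r · wε) uε≈ y) (Eε-conjugate r wε y))
    (λ h → u≉0 λ y → unwrap (h y)) (λ h → uε≉0 λ y → unwrap (h y)) i j i≤d j≤d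

  formula₁ : ⟨ E (r ℕ.+ i) · u* , E* (r ℕ.+ j) · uε ⟩ ≋ 𝐢 ^ j * ι (½ ^ℚ d) * ⟨ u* , uε ⟩ * ιℕ (d C i) * ιℕ (d C j) * ι (₂F₁ i j d)
  formula₁ = ≋-trans
    (≋-reflexive (≡.sym (pairing-agrees (E-lagrange (r ℕ.+ i)) (E*-sphere (r ℕ.+ j)) u* uε)))
    (≋-trans (≋-stable λ ¬f → formulas λ (f , _ , _) → ¬f f)
      (product₆-agrees {p′ = 𝐢 ^ j} {q′ = ι (½ ^ℚ d)} {r′ = ⟨ u* , uε ⟩} {s′ = ιℕ (d C i)} {t′ = ιℕ (d C j)}
        {u′ = ι (₂F₁ i j d)} (^-agrees 𝐢 j) refl refl refl refl refl))

  formula₂ : ⟨ E* (r ℕ.+ i) · uε , Eε P⁻¹ (r ℕ.+ j) · u ⟩ ≋ 𝐢 ^ j * ι (½ ^ℚ d) * ⟨ uε , u ⟩ * ιℕ (d C i) * ιℕ (d C j) * ι (₂F₁ i j d)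
  formula₂ = ≋-trans
    (≋-trans (≋-reflexive (≡.sym (pairing-agrees {N = Eε P⁻¹ (r ℕ.+ j)} (E*-sphere (r ℕ.+ i)) refl uε u)))
      (⟪⟫-cong {v = sphere (r ℕ.+ i) ▹ uε} (λ y → ≋-refl) (Eε-conjugate (r ℕ.+ j) u)))
    (≋-trans (≋-stable λ ¬f → formulas λ (_ , f , _) → ¬f f)
      (product₆-agrees {p′ = 𝐢 ^ j} {q′ = ι (½ ^ℚ d)} {r′ = ⟨ uε , u ⟩} {s′ = ιℕ (d C i)} {t′ = ιℕ (d C j)}
        {u′ = ι (₂F₁ i j d)} (^-agrees 𝐢 j) refl refl refl refl refl))

  formula₃ : ⟨ Eε P⁻¹ (r ℕ.+ i) · u , E (r ℕ.+ j) · u* ⟩ ≋ 𝐢 ^ j * ι (½ ^ℚ d) * ⟨ u , u* ⟩ * ιℕ (d C i) * ιℕ (d C j) * ι (₂F₁ i j d)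
  formula₃ = ≋-trans
    (≋-trans (≋-reflexive (≡.sym (pairing-agrees {M = Eε P⁻¹ (r ℕ.+ i)} refl (E-lagrange (r ℕ.+ j)) u u*)))
      (⟪⟫-cong {w = lagrange (r ℕ.+ j) ▹ u*} (Eε-conjugate (r ℕ.+ i) u) (λ y → ≋-refl)))
    (≋-trans (≋-stable λ ¬f → formulas λ (_ , _ , f) → ¬f f)
      (product₆-agrees {p′ = 𝐢 ^ j} {q′ = ι (½ ^ℚ d)} {r′ = ⟨ u , u* ⟩} {s′ = ιℕ (d C i)} {t′ = ιℕ (d C j)}
        {u′ = ι (₂F₁ i j d)} (^-agrees 𝐢 j) refl refl refl refl refl))
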